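{- Let $X$ be the surface $$x^4+y^4+z^4=w^2$$ in the weighted projective space $\mathbb{P}(1,1,1,2)$ over $\mathbb{Q}$, where $x,y,z$ have weight $1$ and $w$ has weight $2$; it is a del Pezzo surface of degree $2$. Let $X'$ be the surface $$m^2-p^4-q^4=2mr^2$$ in the weighted projective space $\mathbb{P}(1,1,1,2)$ over $\mathbb{Q}$, where $p,q,r$ have weight $1$ and $m$ has weight $2$. Then the map $$f\colon X'\dashrightarrow X,\qquad (p,q,r,m)\mapsto(x,y,z,w)=(r,p,q,r^2-m)$$ is birational. Moreover, let $C$ be the curve on $X'$ defined by $m=p^2+q^2$, understood via elimination of $m$ as birational to the plane curve $p^2q^2=(p^2+q^2)r^2$ in $\mathbb{P}^2$. Then $C$ is birationally equivalent to $\mathbb{P}^1$ over $\mathbb{Q}$, it is not contracted by $f$, and its image under $f$ is a curve on $X$ that is birationally equivalent to $\mathbb{P}^1$ over $\mathbb{Q}$.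
   Context: All varieties and maps are over $\mathbb{Q}$. A curve is contracted by a rational map if its image is a point. -}

module Defs where

open import Algebra.Bundles.Raw using (RawRing)
import Algebra.Definitions.RawSemiring as RawSemiringDefs
open import Data.Fin.Base using (Fin; zero; suc)
open import Data.Integer.Base using (+_)
open import Data.List.Base as List using (List; []; _∷_; _++_)
open import Data.Nat.Base as ℕ using (ℕ; NonZero)
import Data.Nat.Properties as ℕ
open import Data.Product.Base using (Σ-syntax; ∃-syntax; _×_; _,_; proj₁; proj₂)
open import Data.Rational.Base as ℚ using (ℚ; 0ℚ; 1ℚ)
open import Data.Sum.Base using (_⊎_)
open import Data.Vec.Base as Vec using (Vec; []; _∷_; lookup)
open import Data.Vec.Properties using (≡-dec)
open import Data.Vec.Relation.Unary.All using (All)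
open import Function.Base using (_∘_)
open import Level using (0ℓ)
open import Relation.Binary.PropositionalEquality.Core using (_≡_; _≢_)
open import Relation.Nullary.Decidable.Core using (does)
open import Relation.Nullary.Negation.Core using (¬_)
open import Relation.Unary using (Pred; _∈_; _∉_; _⊆_)
open import Data.Bool.Base using (if_then_else_)

private
  variable
    k l n : ℕ

------------------------------------------------------------------------
-- The polynomial ring ℚ[x₀,…,xₙ₋₁]

Monomial : ℕ → Set
Monomial n = Vec ℕ n

-- A formal sum of terms c·x^e. Exponents may repeat and coefficients may
-- vanish; polynomials are compared by _≈_ below, never by _≡_.
Poly : ℕ → Set
Poly n = List (ℚ × Monomial n)

coeff : Poly n → Monomial n → ℚ
coeff []            e = 0ℚ
coeff ((c , d) ∷ p) e =
  if does (≡-dec ℕ._≟_ d e) then c ℚ.+ coeff p e else coeff p e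

infix  4 _≈_ _≉_
infixl 6 _+_ _-_
infixl 7 _*_
infixr 8 _^_
infix  9 -_

_≈_ _≉_ : Poly n → Poly n → Set
p ≈ q = ∀ e → coeff p e ≡ coeff q e
p ≉ q = ¬ (p ≈ q)

const : ℚ → Poly n
const c = (c , Vec.replicate _ 0) ∷ []

var : Fin n → Poly n
var i = (1ℚ , Vec.replicate _ 0 Vec.[ i ]≔ 1) ∷ []

_+_ _*_ : Poly n → Poly n → Poly n
p + q = p ++ q
p * q = List.cartesianProductWith
          (λ (c , d) (c′ , d′) → c ℚ.* c′ , Vec.zipWith ℕ._+_ d d′) p q

-_ : Poly n → Poly n
- p = List.map (λ (c , d) → ℚ.- c , d) p

_-_ : Poly n → Poly n → Poly n
p - q = p + (- q)

0ₚ 1ₚ : Poly n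
0ₚ = []
1ₚ = const 1ℚ

polyRing : ℕ → RawRing 0ℓ 0ℓ
polyRing n = record
  { Carrier = Poly n
  ; _≈_     = _≈_
  ; _+_     = _+_
  ; _*_     = _*_
  ; -_      = -_
  ; 0#      = 0ₚ
  ; 1#      = 1ₚ
  }

_^_ : Poly n → ℕ → Poly n
_^_ {n} = RawSemiringDefs._^_ (RawRing.rawSemiring (polyRing n))

vars : Vec (Poly n) n
vars = Vec.tabulate var

-- The value p(x₀,…,xₙ₋₁) in a ring A receiving the scalars through ι.
module Evaluation {a ℓ} (A : RawRing a ℓ) (ι : ℚ → RawRing.Carrier A) where
  private
    module A = RawRing A
    module Aˢ = RawSemiringDefs A.rawSemiring

  monomial : Monomial n → Vec A.Carrier n → A.Carrier
  monomial e x = Vec.foldr _ A._*_ A.1# (Vec.zipWith Aˢ._^_ x e)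

  eval : Poly n → Vec A.Carrier n → A.Carrier
  eval []            x = A.0#
  eval ((c , e) ∷ p) x = (ι c A.* monomial e x) A.+ eval p x

subst : Poly n → Vec (Poly k) n → Poly k
subst {k = k} = Evaluation.eval (polyRing k) const

weightedDegree : Vec ℕ n → Monomial n → ℕ
weightedDegree w e = Vec.sum (Vec.zipWith ℕ._*_ w e)

-- The zero polynomial is homogeneous of every degree.
Homogeneous : Vec ℕ n → ℕ → Poly n → Set
Homogeneous w d p = ∀ e → coeff p e ≢ 0ℚ → weightedDegree w e ≡ d

component : Vec ℕ n → ℕ → Poly n → Poly n
component w d = List.filter (λ (_ , e) → weightedDegree w e ℕ.≟ d)

------------------------------------------------------------------------
-- Varieties in weighted projective spaces

-- A closed subscheme of ℙ(w) over ℚ, given by an ideal of the graded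
-- ring ℚ[x₀,…,xₙ₋₁] with deg xᵢ = wᵢ.
record Closed {n} (w : Vec ℕ n) : Set₁ where
  constructor closed
  field
    ideal : Pred (Poly n) 0ℓ

open Closed public

combination : Vec (Poly n) k → Vec (Poly n) k → Poly n
combination c g = Vec.foldr _ _+_ 0ₚ (Vec.zipWith _*_ c g)

⟨_⟩ : Vec (Poly n) k → Pred (Poly n) 0ℓ
⟨_⟩ {n} {k} g p = ∃[ c ] p ≈ combination {n} {k} c g

zeros : (w : Vec ℕ n) → Vec (Poly n) k → Closed w
zeros w g = closed ⟨ g ⟩

infix 4 _⊑_
_⊑_ : {w : Vec ℕ n} → Closed w → Closed w → Set
V ⊑ W = ideal W ⊆ ideal V

record IsVariety {n} {w : Vec ℕ n} (V : Closed w) : Set where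
  private I = ideal V
  field
    positive    : All NonZero w
    respects    : ∀ {p q} → p ≈ q → p ∈ I → q ∈ I
    0∈          : 0ₚ ∈ I
    +-closed    : ∀ {p q} → p ∈ I → q ∈ I → p + q ∈ I
    *-closed    : ∀ {p q} → q ∈ I → p * q ∈ I
    homogeneous : ∀ {p} d → p ∈ I → component w d p ∈ I
    proper      : 1ₚ ∉ I
    prime       : ∀ {p q} → p * q ∈ I → p ∈ I ⊎ q ∈ I
    -- the ideal does not contain (x₀,…,xₙ₋₁), so that V is nonempty
    relevant    : ∃[ i ] var i ∉ I

------------------------------------------------------------------------
-- Function field and dimension

record Fraction (n : ℕ) : Set where
  constructor _/_
  field
    num den : Poly n

open Fraction public

-- The degree-zero part (see IsRationalFunction) of this ring is the
-- function field of a variety V. The operations are total; they are the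
-- field operations when the denominators are not in the ideal of V.
fractionRing : {w : Vec ℕ n} → Closed w → RawRing 0ℓ 0ℓ
fractionRing {n} V = record
  { Carrier = Fraction n
  ; _≈_     = λ (a / b) (c / d) → a * d - c * b ∈ ideal V
  ; _+_     = λ (a / b) (c / d) → (a * d + c * b) / (b * d)
  ; _*_     = λ (a / b) (c / d) → (a * c) / (b * d)
  ; -_      = λ (a / b) → (- a) / b
  ; 0#      = 0ₚ / 1ₚ
  ; 1#      = 1ₚ / 1ₚ
  }

module _ {n} {w : Vec ℕ n} (V : Closed w) where
  private module K = RawRing (fractionRing V)

  IsRationalFunction : Fraction n → Set
  IsRationalFunction φ =
    (∃[ d ] Homogeneous w d (num φ) × Homogeneous w d (den φ)) × den φ ∉ ideal V

  IsRelation : Poly k → Vec (Fraction n) k → Set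
  IsRelation R φ =
    Evaluation.eval (fractionRing V) (λ c → const c / 1ₚ) R φ K.≈ K.0#

  AlgebraicallyIndependent : Vec (Fraction n) k → Set
  AlgebraicallyIndependent {k} φ = ∀ (R : Poly k) → IsRelation R φ → R ≈ 0ₚ

  AlgebraicallyDependent : Vec (Fraction n) k → Set
  AlgebraicallyDependent {k} φ = ∃[ R ] R ≉ 0ₚ {k} × IsRelation R φ

  -- The dimension of a variety is the transcendence degree over ℚ of its
  -- function field: the length of a maximal algebraically independent
  -- family of rational functions.
  HasDimension : ℕ → Set
  HasDimension d =
    Σ[ φ ∈ Vec (Fraction n) d ]
      All IsRationalFunction φ ×
      AlgebraicallyIndependent φ ×
      (∀ ψ → IsRationalFunction ψ → AlgebraicallyDependent (ψ ∷ φ))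

  IsPoint IsCurve : Set
  IsPoint = IsVariety V × HasDimension 0
  IsCurve = IsVariety V × HasDimension 1

------------------------------------------------------------------------
-- Rational maps

-- A rational map into ℙ(v) is given by polynomials fⱼ of weighted
-- degrees d·vⱼ, not all zero on the source. Multiplying each fⱼ by h^vⱼ for a
-- form h of positive degree does not change the map, so d > 0 is no
-- restriction; it makes the ideal of `image` below homogeneous.
record IsRationalMap {n m} {w : Vec ℕ n} {v : Vec ℕ m}
                     (V : Closed w) (W : Closed v) (f : Vec (Poly n) m) : Set where
  field
    degree    : ℕ
    positive  : NonZero degree
    isForm    : ∀ j → Homogeneous w (degree ℕ.* lookup v j) (lookup f j)
    isDefined : ∃[ j ] lookup f j ∉ ideal V
    intoW     : ∀ {G} → G ∈ ideal W → subst G f ∈ ideal V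

-- f and g are the same rational map from V to ℙ(v): over the function
-- field of V they differ by (yⱼ) ↦ (λ^vⱼ yⱼ), where λ = a / b.
SameMap : {w : Vec ℕ n} → Closed w → (v : Vec ℕ k) → (f g : Vec (Poly n) k) → Set
SameMap {w = w} V v f g =
  ∃[ a ] ∃[ b ]
    (∃[ d ] Homogeneous w d a) × (∃[ d ] Homogeneous w d b) ×
    a ∉ ideal V × b ∉ ideal V ×
    (∀ j → b ^ lookup v j * lookup f j - a ^ lookup v j * lookup g j ∈ ideal V)

infixr 9 _∘ₘ_
_∘ₘ_ : Vec (Poly k) l → Vec (Poly n) k → Vec (Poly n) l
g ∘ₘ f = Vec.map (λ p → subst p f) g

-- `vars` is the identity map.
IsBirational : {w : Vec ℕ n} {v : Vec ℕ k} →
               Closed w → Closed v → Vec (Poly n) k → Set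
IsBirational {n} {k} {w} {v} V W f =
  IsVariety V × IsVariety W × IsRationalMap V W f ×
  Σ[ g ∈ Vec (Poly k) n ]
    IsRationalMap W V g × SameMap V w (g ∘ₘ f) vars × SameMap W v (f ∘ₘ g) vars

BirationallyEquivalent : {w : Vec ℕ n} {v : Vec ℕ k} → Closed w → Closed v → Set
BirationallyEquivalent V W = ∃[ f ] IsBirational V W f

-- The closure of the image of V: a form G vanishes on it exactly when
-- G ∘ f vanishes on V.
image : {w : Vec ℕ n} → Vec (Poly n) k → (v : Vec ℕ k) → Closed w → Closed v
image f v V = closed (λ G → subst G f ∈ ideal V)

Contracts : {w : Vec ℕ n} → Vec (Poly n) k → (v : Vec ℕ k) → Closed w → Set
Contracts f v C = IsPoint (image f v C)

------------------------------------------------------------------------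
-- The varieties of the theorem

w₁₁ : Vec ℕ 2
w₁₁ = 1 ∷ 1 ∷ []

w₁₁₁ : Vec ℕ 3
w₁₁₁ = 1 ∷ 1 ∷ 1 ∷ []

w₁₁₁₂ : Vec ℕ 4
w₁₁₁₂ = 1 ∷ 1 ∷ 1 ∷ 2 ∷ []

ℙ¹ : Closed w₁₁
ℙ¹ = zeros w₁₁ []

private
  -- Variables in the order (x,y,z,w) resp. (p,q,r,m).
  v₀ v₁ v₂ v₃ : Poly 4
  v₀ = var zero
  v₁ = var (suc zero)
  v₂ = var (suc (suc zero))
  v₃ = var (suc (suc (suc zero)))

equationX : Poly 4
equationX = x ^ 4 + y ^ 4 + z ^ 4 - w ^ 2
  where x = v₀; y = v₁; z = v₂; w = v₃

equationX′ : Poly 4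
equationX′ = m ^ 2 - p ^ 4 - q ^ 4 - const (+ 2 ℚ./ 1) * m * r ^ 2
  where p = v₀; q = v₁; r = v₂; m = v₃

equationC : Poly 4
equationC = m - (p ^ 2 + q ^ 2)
  where p = v₀; q = v₁; m = v₃

equationΓ : Poly 3
equationΓ = p ^ 2 * q ^ 2 - (p ^ 2 + q ^ 2) * r ^ 2
  where p = var zero; q = var (suc zero); r = var (suc (suc zero))

X X′ C : Closed w₁₁₁₂
X  = zeros w₁₁₁₂ (equationX ∷ [])
X′ = zeros w₁₁₁₂ (equationX′ ∷ [])
C  = zeros w₁₁₁₂ (equationX′ ∷ equationC ∷ [])

Γ : Closed w₁₁₁
Γ = zeros w₁₁₁ (equationΓ ∷ [])

f : Vec (Poly 4) 4
f = r ∷ p ∷ q ∷ r ^ 2 - m ∷ []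
  where p = v₀; q = v₁; r = v₂; m = v₃

-- Forgetting m, on C a function of p and q.
eliminate-m : Vec (Poly 4) 3
eliminate-m = p ∷ q ∷ r ∷ []
  where p = v₀; q = v₁; r = v₂

{-# OPTIONS --safe #-}

module Submission where

-- The surfaces X and X′ are double covers of the plane. Completing the
-- square, (m - r²)² = p⁴ + q⁴ + r⁴ on X′, so f is an isomorphism, with inverse
-- (x,y,z,w) ↦ (y,z,x,x² - w). Both are isomorphic to u² = a⁴ + b⁴ + c⁴. This is
-- irreducible since the right-hand side is 3 modulo 4 at odd integers, hence
-- not a square of a rational function; the multiplicativity of the norm
-- A² - D·B² of A + B·u then shows that u² - D generates a prime ideal
-- (sumOfFourthPowers-nonsquare, quadratic-prime).
--
-- Substituting m = p² + q² in the equation of X′ gives twice the equation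
-- p²q² = (p² + q²)r² of Γ, that is 1/r² = 1/p² + 1/q². This is a conic in
-- (1/p : 1/q : 1/r), parametrized by
--
--   p = s⁴ - t⁴,  q = 2st(s² + t²),  r = 2st(s² - t²),  m = (s² + t²)⁴,
--
-- with inverse (s : t) = (p(q + r) : qr).
--
-- Polynomials are handled through their values: since ℚ is infinite, p ≈ q
-- holds exactly when p and q agree at all rational points (≈⇒ev, ev⇒≈), so that
-- every identity of polynomials reduces to an identity in ℚ, and polynomials
-- form a domain (*-integral).
--
-- The main point is that the ideals of Γ and C, given by equations, are the
-- kernels of the parametrizations (Γ-kernel, ∈C⁺). The equation of Γ is
-- quadratic in p with leading coefficient q² - r². Pseudo-division of a
-- polynomial G in the kernel leaves a remainder A + B·p; the symmetry
-- (p,q,r) ↦ (-p,q,r) of Γ gives A = B·p = 0 on a set of points whose (q,r) are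
-- dense, so A = B = 0. The factors q - r and q + r of the leading coefficient
-- are prime to the equation of Γ and can be cancelled one at a time.
--
-- The ideal of the image of C under f is then the kernel of f composed with
-- the parametrization. A curve whose ideal is the kernel of a parametrization
-- by ℙ¹ with a rational inverse is a variety, as its ideal is the preimage of
-- the zero ideal, and is birational to ℙ¹; its function field is algebraic
-- over ℚ(s/t), and s/t is transcendental (RationalCurve). Hence it is a curve,
-- and not a point.

open import Algebra.Bundles using (CommutativeRing)
open import Algebra.Bundles.Raw using (RawRing)
import Algebra.Definitions.RawSemiring as RawSemiringDefs
import Algebra.Properties.CommutativeSemiring.Exp as Exp
open import Data.Bool.Base using (true; false; if_then_else_)
open import Data.Fin.Base using (Fin; zero; suc)
import Data.Fin.Properties as Fin
open import Data.Integer.Base as ℤ using (ℤ)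
import Data.Integer.Properties as ℤ
open import Data.List.Base as List using (List; []; _∷_; _++_)
import Data.List.Properties as List
open import Data.List.Relation.Unary.All as ListAll using ([]; _∷_)
import Data.List.Relation.Unary.All.Properties as ListAll
open import Data.Nat.Base as ℕ using (ℕ; zero; suc; NonZero)
import Data.Nat.DivMod as ℕ
import Data.Nat.Properties as ℕ
import Data.Nat.Tactic.RingSolver as ℕ-Solver
open import Data.Product.Base using (∃-syntax; _×_; _,_; proj₁; proj₂)
open import Data.Rational.Base as ℚ using (ℚ; 0ℚ; 1ℚ; ½; _+_; _*_; _-_; -_; ↥_; ↧_; ↧ₙ_)
open import Data.Rational.Properties as ℚ using (_≟_)
import Data.Rational.Unnormalised.Base as ℚᵘ
import Data.Rational.Unnormalised.Properties as ℚᵘ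
open import Data.Sum.Base as Sum using (_⊎_; inj₁; inj₂; [_,_]′)
open import Data.Vec.Base as Vec using (Vec; []; _∷_; lookup)
import Data.Vec.Properties as Vec
open import Data.Vec.Relation.Unary.All using (All; []; _∷_)
open import Data.Vec.Relation.Unary.All.Properties using (tabulate⁺)
open import Function.Base using (_∘_; id)
open import Level using (0ℓ)
open import Relation.Binary.Definitions using (tri<; tri≈; tri>)
open import Relation.Binary.PropositionalEquality
  using (_≡_; _≢_; refl; sym; trans; cong; cong₂; module ≡-Reasoning)
  renaming (subst to transport)
open import Relation.Nullary.Decidable as Dec
  using (Dec; yes; no; does; from-yes)
open import Relation.Nullary.Negation.Core using (¬_; contradiction)
open import Relation.Unary using (Pred; _∈_; _∉_; _⊆_)
open import Tactic.RingSolver using (solve-∀)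
open import Tactic.RingSolver.Core.AlmostCommutativeRing
  using (AlmostCommutativeRing; fromCommutativeRing)
open import Defs
  renaming (_+_ to _+ₚ_; _*_ to _*ₚ_; _-_ to _-ₚ_; -_ to -ₚ_; _^_ to _^ₚ_;
            _/_ to _/ₚ_; subst to substₚ)

private
  variable
    k l n : ℕ

-- Rational numbers

ℚ-ring : AlmostCommutativeRing 0ℓ 0ℓ
ℚ-ring = fromCommutativeRing ℚ.+-*-commutativeRing λ x → Dec.dec⇒maybe (0ℚ ≟ x)

open Exp (CommutativeRing.commutativeSemiring ℚ.+-*-commutativeRing)
  using (_^_; ^-homo-*; ^-assocʳ; ^-distrib-*)

ℚ-integral : ∀ x y → x * y ≡ 0ℚ → x ≡ 0ℚ ⊎ y ≡ 0ℚ
ℚ-integral x y xy≡0 with x ≟ 0ℚ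
... | yes x≡0 = inj₁ x≡0
... | no  x≢0 = inj₂ (begin
  y                  ≡⟨ ℚ.*-identityˡ y ⟨
  1ℚ * y             ≡⟨ cong (_* y) (ℚ.*-inverseˡ x) ⟨
  (ℚ.1/ x) * x * y   ≡⟨ ℚ.*-assoc (ℚ.1/ x) x y ⟩
  (ℚ.1/ x) * (x * y) ≡⟨ cong ((ℚ.1/ x) *_) xy≡0 ⟩
  (ℚ.1/ x) * 0ℚ      ≡⟨ ℚ.*-zeroʳ (ℚ.1/ x) ⟩
  0ℚ                 ∎)
  where
  open ≡-Reasoning
  instance _ = ℚ.≢-nonZero x≢0

*-nonzero : ∀ {x y} → x ≢ 0ℚ → y ≢ 0ℚ → x * y ≢ 0ℚ
*-nonzero x≢0 y≢0 xy≡0 = [ x≢0 , y≢0 ]′ (ℚ-integral _ _ xy≡0)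

^-one : ∀ k → 1ℚ ^ k ≡ 1ℚ
^-one zero    = refl
^-one (suc k) = trans (ℚ.*-identityˡ (1ℚ ^ k)) (^-one k)

^-nonzero : ∀ {x} k → x ≢ 0ℚ → x ^ k ≢ 0ℚ
^-nonzero zero    x≢0 = λ ()
^-nonzero (suc k) x≢0 = *-nonzero x≢0 (^-nonzero k x≢0)

divides-by : ∀ y {x} → x ≢ 0ℚ → ∃[ z ] y ≡ z * x
divides-by y {x} x≢0 = y * ℚ.1/ x , sym (trans (ℚ.*-assoc y (ℚ.1/ x) x)
  (trans (cong (y *_) (ℚ.*-inverseˡ x)) (ℚ.*-identityʳ y)))
  where instance _ = ℚ.≢-nonZero x≢0

-≡0⇒≡ : ∀ {x y} → x - y ≡ 0ℚ → x ≡ y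
-≡0⇒≡ {x} {y} eq = trans (lemma x y) (trans (cong (_+ y) eq) (ℚ.+-identityˡ y))
  where
  lemma : ∀ x y → x ≡ x - y + y
  lemma = solve-∀ ℚ-ring

≡⇒-≡0 : ∀ {x y} → x ≡ y → x - y ≡ 0ℚ
≡⇒-≡0 {x} refl = ℚ.+-inverseʳ x

-- Polynomials as functions on rational points

open Evaluation ℚ.+-*-rawRing (λ c → c) using () renaming (eval to ev; monomial to mono)

-- The points p(x) for p in a tuple of polynomials.
evs : Vec (Poly n) k → Vec ℚ n → Vec ℚ k
evs f x = Vec.map (λ p → ev p x) f

mono-1 : (x : Vec ℚ n) → mono (Vec.replicate n 0) x ≡ 1ℚ
mono-1 []      = refl
mono-1 (x ∷ v) = trans (ℚ.*-identityˡ _) (mono-1 v)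

mono-* : (d e : Monomial n) (x : Vec ℚ n) →
         mono (Vec.zipWith ℕ._+_ d e) x ≡ mono d x * mono e x
mono-* []      []      []      = refl
mono-* (i ∷ d) (j ∷ e) (x ∷ v) =
  trans (cong₂ _*_ (^-homo-* x i j) (mono-* d e v)) (lemma (x ^ i) (x ^ j) (mono d v) (mono e v))
  where
  lemma : ∀ a b c d → a * b * (c * d) ≡ a * c * (b * d)
  lemma = solve-∀ ℚ-ring

ev-+ : ∀ (p q : Poly n) x → ev (p +ₚ q) x ≡ ev p x + ev q x
ev-+ []            q x = sym (ℚ.+-identityˡ _)
ev-+ ((c , e) ∷ p) q x =
  trans (cong (c * mono e x +_) (ev-+ p q x)) (sym (ℚ.+-assoc (c * mono e x) (ev p x) (ev q x)))

ev-neg : ∀ (p : Poly n) x → ev (-ₚ p) x ≡ - ev p x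
ev-neg []            x = refl
ev-neg ((c , e) ∷ p) x =
  trans (cong (- c * mono e x +_) (ev-neg p x)) (lemma c (mono e x) (ev p x))
  where
  lemma : ∀ a b c → - a * b + - c ≡ - (a * b + c)
  lemma = solve-∀ ℚ-ring

ev-minus : ∀ (p q : Poly n) x → ev (p -ₚ q) x ≡ ev p x - ev q x
ev-minus p q x = trans (ev-+ p (-ₚ q) x) (cong (ev p x +_) (ev-neg q x))

ev-* : ∀ (p q : Poly n) x → ev (p *ₚ q) x ≡ ev p x * ev q x
ev-* []            q x = sym (ℚ.*-zeroˡ (ev q x))
ev-* {n} ((c , d) ∷ p) q x = begin
  ev (List.map term q ++ (p *ₚ q)) x        ≡⟨ ev-+ (List.map term q) (p *ₚ q) x ⟩
  ev (List.map term q) x + ev (p *ₚ q) x    ≡⟨ cong₂ _+_ (ev-term q) (ev-* p q x) ⟩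
  c * mono d x * ev q x + ev p x * ev q x   ≡⟨ ℚ.*-distribʳ-+ (ev q x) (c * mono d x) (ev p x) ⟨
  (c * mono d x + ev p x) * ev q x          ∎
  where
  open ≡-Reasoning
  term : ℚ × Monomial n → ℚ × Monomial n
  term (c′ , d′) = c * c′ , Vec.zipWith ℕ._+_ d d′
  lemma : ∀ a b c d e → a * b * (c * d) + a * c * e ≡ a * c * (b * d + e)
  lemma = solve-∀ ℚ-ring
  ev-term : ∀ r → ev (List.map term r) x ≡ c * mono d x * ev r x
  ev-term []              = sym (ℚ.*-zeroʳ (c * mono d x))
  ev-term ((c′ , d′) ∷ r) =
    trans (cong₂ _+_ (cong (c * c′ *_) (mono-* d d′ x)) (ev-term r))
          (lemma c c′ (mono d x) (mono d′ x) (ev r x))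

ev-const : ∀ c (x : Vec ℚ n) → ev (const c) x ≡ c
ev-const c x = trans (ℚ.+-identityʳ _) (trans (cong (c *_) (mono-1 x)) (ℚ.*-identityʳ c))

ev-var : ∀ i (x : Vec ℚ n) → ev (var i) x ≡ lookup x i
ev-var i x = trans (ℚ.+-identityʳ _) (trans (ℚ.*-identityˡ _) (mono-var i x))
  where
  mono-var : ∀ {n} (i : Fin n) x → mono (Vec.replicate n 0 Vec.[ i ]≔ 1) x ≡ lookup x i
  mono-var zero    (x ∷ v) = trans (cong₂ _*_ (ℚ.*-identityʳ x) (mono-1 v)) (ℚ.*-identityʳ x)
  mono-var (suc i) (x ∷ v) = trans (ℚ.*-identityˡ _) (mono-var i v)

ev-^ : ∀ (p : Poly n) k x → ev (p ^ₚ k) x ≡ ev p x ^ k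
ev-^ p zero    x = ev-const 1ℚ x
ev-^ p (suc k) x = trans (ev-* p (p ^ₚ k) x) (cong (ev p x *_) (ev-^ p k x))

ev-subst : ∀ (p : Poly n) (f : Vec (Poly k) n) x → ev (substₚ p f) x ≡ ev p (evs f x)
ev-subst []            f x = refl
ev-subst {k = k} ((c , e) ∷ p) f x =
  trans (ev-+ (const c *ₚ monomialₚ e f) (substₚ p f) x)
    (cong₂ _+_ (trans (ev-* (const c) (monomialₚ e f) x) (cong₂ _*_ (ev-const c x) (ev-monomial e f)))
               (ev-subst p f x))
  where
  open Evaluation (polyRing k) const using () renaming (monomial to monomialₚ)
  ev-monomial : ∀ {n} (e : Monomial n) f → ev (monomialₚ e f) x ≡ mono e (evs f x)
  ev-monomial []      []      = ev-const 1ℚ x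
  ev-monomial (i ∷ e) (g ∷ f) =
    trans (ev-* (g ^ₚ i) (monomialₚ e f) x) (cong₂ _*_ (ev-^ g i x) (ev-monomial e f))

-- Expressions for polynomials, built by the ring operations from variables,
-- constants and given polynomials. The same operations of ℚ give their values.
infixl 6 _:+_ _:-_
infixl 7 _:*_
infixr 8 _:^_

data Expr (n : ℕ) : Set where
  :con           : ℚ → Expr n
  :poly          : Poly n → Expr n
  :var           : Fin n → Expr n
  _:+_ _:-_ _:*_ : Expr n → Expr n → Expr n
  _:^_           : Expr n → ℕ → Expr n

toPoly : Expr n → Poly n
toPoly (:con c) = const c
toPoly (:poly p) = p
toPoly (:var i) = var i
toPoly (a :+ b) = toPoly a +ₚ toPoly b
toPoly (a :- b) = toPoly a -ₚ toPoly b
toPoly (a :* b) = toPoly a *ₚ toPoly b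
toPoly (a :^ k) = toPoly a ^ₚ k

value : Expr n → Vec ℚ n → ℚ
value (:con c) x = c
value (:poly p) x = ev p x
value (:var i) x = lookup x i
value (a :+ b) x = value a x + value b x
value (a :- b) x = value a x - value b x
value (a :* b) x = value a x * value b x
value (a :^ k) x = value a x ^ k

ev-toPoly : ∀ (a : Expr n) x → ev (toPoly a) x ≡ value a x
ev-toPoly (:con c) x = ev-const c x
ev-toPoly (:poly p) x = refl
ev-toPoly (:var i) x = ev-var i x
ev-toPoly (a :+ b) x = trans (ev-+ (toPoly a) (toPoly b) x) (cong₂ _+_ (ev-toPoly a x) (ev-toPoly b x))
ev-toPoly (a :- b) x = trans (ev-minus (toPoly a) (toPoly b) x) (cong₂ _-_ (ev-toPoly a x) (ev-toPoly b x))
ev-toPoly (a :* b) x = trans (ev-* (toPoly a) (toPoly b) x) (cong₂ _*_ (ev-toPoly a x) (ev-toPoly b x))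
ev-toPoly (a :^ k) x = trans (ev-^ (toPoly a) k x) (cong (_^ k) (ev-toPoly a x))

-- Polynomials with equal coefficients have equal values

coeff-+ : ∀ (p q : Poly n) e → coeff (p +ₚ q) e ≡ coeff p e + coeff q e
coeff-+ []            q e = sym (ℚ.+-identityˡ _)
coeff-+ ((c , d) ∷ p) q e with does (Vec.≡-dec ℕ._≟_ d e)
... | true  = trans (cong (c +_) (coeff-+ p q e)) (sym (ℚ.+-assoc c (coeff p e) (coeff q e)))
... | false = coeff-+ p q e

coeff-neg : ∀ (p : Poly n) e → coeff (-ₚ p) e ≡ - coeff p e
coeff-neg []            e = refl
coeff-neg ((c , d) ∷ p) e with does (Vec.≡-dec ℕ._≟_ d e)
... | true  = trans (cong (- c +_) (coeff-neg p e)) (sym (ℚ.neg-distrib-+ c (coeff p e)))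
... | false = coeff-neg p e

-- The terms of p whose exponent is not d.
remove : Monomial n → Poly n → Poly n
remove d []            = []
remove d ((c , e) ∷ p) =
  if does (Vec.≡-dec ℕ._≟_ e d) then remove d p else ((c , e) ∷ remove d p)

ev-remove : ∀ d (p : Poly n) x → ev p x ≡ coeff p d * mono d x + ev (remove d p) x
ev-remove d []            x = sym (trans (ℚ.+-identityʳ _) (ℚ.*-zeroˡ (mono d x)))
ev-remove d ((c , e) ∷ p) x with Vec.≡-dec ℕ._≟_ e d
... | yes refl = trans (cong (c * mono d x +_) (ev-remove d p x))
                       (lemma c (mono d x) (coeff p d) (ev (remove d p) x))
  where
  lemma : ∀ a b c d → a * b + (c * b + d) ≡ (a + c) * b + d
  lemma = solve-∀ ℚ-ring
... | no _     = trans (cong (c * mono e x +_) (ev-remove d p x))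
                       (lemma (c * mono e x) (coeff p d * mono d x) (ev (remove d p) x))
  where
  lemma : ∀ a b c → a + (b + c) ≡ b + (a + c)
  lemma = solve-∀ ℚ-ring

coeff-remove : ∀ d (p : Poly n) e → coeff p e ≡ 0ℚ → coeff (remove d p) e ≡ 0ℚ
coeff-remove d p e p≡0 with Vec.≡-dec ℕ._≟_ d e
... | yes refl = same p
  where
  same : ∀ p → coeff (remove d p) d ≡ 0ℚ
  same []             = refl
  same ((c , e′) ∷ p) with Vec.≡-dec ℕ._≟_ e′ d in eq
  ... | yes _ = same p
  ... | no  _ rewrite eq = same p
... | no d≢e = trans (other p) p≡0
  where
  other : ∀ p → coeff (remove d p) e ≡ coeff p e
  other []             = refl
  other ((c , e′) ∷ p) with Vec.≡-dec ℕ._≟_ e′ d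
  ... | no  _ with does (Vec.≡-dec ℕ._≟_ e′ e)
  ...   | true  = cong (c +_) (other p)
  ...   | false = other p
  other ((c , e′) ∷ p) | yes refl with Vec.≡-dec ℕ._≟_ e′ e
  ...   | yes e′≡e = contradiction e′≡e d≢e
  ...   | no  _    = other p

remove-length : ∀ d (p : Poly n) → List.length (remove d p) ℕ.≤ List.length p
remove-length d []            = ℕ.z≤n
remove-length d ((c , e) ∷ p) with does (Vec.≡-dec ℕ._≟_ e d)
... | true  = ℕ.m≤n⇒m≤1+n (remove-length d p)
... | false = ℕ.s≤s (remove-length d p)

-- Removing all terms with a given exponent splits off a zero coefficient
-- and shortens the sum.
≈0⇒ev : (p : Poly n) → p ≈ 0ₚ → ∀ x → ev p x ≡ 0ℚ
≈0⇒ev p p≈0 x = bounded (List.length p) p ℕ.≤-refl p≈0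
  where
  bounded : ∀ l p → List.length p ℕ.≤ l → p ≈ 0ₚ → ev p x ≡ 0ℚ
  bounded l       []                _           _   = refl
  bounded (suc l) p@((c , d) ∷ p′) (ℕ.s≤s p≤l) p≈0 = begin
    ev p x                               ≡⟨ ev-remove d p x ⟩
    coeff p d * mono d x + ev (remove d p) x
      ≡⟨ cong₂ _+_ (cong (_* mono d x) (p≈0 d))
                   (bounded l (remove d p) (ℕ.≤-trans shorter p≤l) λ e → coeff-remove d p e (p≈0 e)) ⟩
    0ℚ * mono d x + 0ℚ                   ≡⟨ trans (ℚ.+-identityʳ _) (ℚ.*-zeroˡ (mono d x)) ⟩
    0ℚ                                   ∎
    where
    open ≡-Reasoning
    shorter : List.length (remove d p) ℕ.≤ List.length p′
    shorter with Vec.≡-dec ℕ._≟_ d d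
    ... | yes _  = remove-length d p′
    ... | no d≢d = contradiction refl d≢d

≈⇒-≈0 : (p q : Poly n) → p ≈ q → p -ₚ q ≈ 0ₚ
≈⇒-≈0 p q p≈q e = trans (coeff-+ p (-ₚ q) e)
  (trans (cong (coeff p e +_) (coeff-neg q e)) (≡⇒-≡0 (p≈q e)))

-≈0⇒≈ : (p q : Poly n) → p -ₚ q ≈ 0ₚ → p ≈ q
-≈0⇒≈ p q p-q≈0 e = -≡0⇒≡
  (trans (sym (trans (coeff-+ p (-ₚ q) e) (cong (coeff p e +_) (coeff-neg q e)))) (p-q≈0 e))

≈⇒ev : (p q : Poly n) → p ≈ q → ∀ x → ev p x ≡ ev q x
≈⇒ev p q p≈q x = -≡0⇒≡ (trans (sym (ev-minus p q x)) (≈0⇒ev (p -ₚ q) (≈⇒-≈0 p q p≈q) x))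

-- Univariate polynomials, given by their coefficients

-- The value a₀ + x(a₁ + x(a₂ + …)) of the polynomial with coefficients
-- a₀, a₁, a₂, ….
horner : Vec ℚ n → ℚ → ℚ
horner []       x = 0ℚ
horner (a ∷ as) x = a + x * horner as x

AllZero : Vec ℚ n → Set
AllZero = All (_≡ 0ℚ)

horner-zero : {as : Vec ℚ n} → AllZero as → ∀ x → horner as x ≡ 0ℚ
horner-zero []          x = refl
horner-zero (refl ∷ as) x =
  trans (ℚ.+-identityˡ _) (trans (cong (x *_) (horner-zero as x)) (ℚ.*-zeroʳ x))

-- The quotient of a polynomial by X - c, which has one coefficient less.
quotient : Vec ℚ (suc n) → ℚ → Vec ℚ n
quotient (a ∷ [])         c = []
quotient (a ∷ as@(_ ∷ _)) c = horner as c ∷ quotient as c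

horner-quotient : ∀ (as : Vec ℚ (suc n)) c x →
                  horner as x ≡ (x - c) * horner (quotient as c) x + horner as c
horner-quotient (a ∷ []) c x = lemma a c x
  where
  lemma : ∀ a c x → a + x * 0ℚ ≡ (x - c) * 0ℚ + (a + c * 0ℚ)
  lemma = solve-∀ ℚ-ring
horner-quotient (a ∷ as@(_ ∷ _)) c x =
  trans (cong (λ y → a + x * y) (horner-quotient as c x))
        (lemma a c x (horner (quotient as c) x) (horner as c))
  where
  lemma : ∀ a c x q h → a + x * ((x - c) * q + h) ≡ (x - c) * (h + x * q) + (a + c * h)
  lemma = solve-∀ ℚ-ring

horner-root : ∀ (as : Vec ℚ (suc n)) {c} → horner as c ≡ 0ℚ →
              ∀ x → horner as x ≡ (x - c) * horner (quotient as c) x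
horner-root as {c} root x = trans (horner-quotient as c x)
  (trans (cong (((x - c) * horner (quotient as c) x) +_) root) (ℚ.+-identityʳ _))

-- An infinite set of nonzero rational numbers; a polynomial that vanishes
-- on such a set is zero.
record TestPoints : Set where
  field
    point     : ℕ → ℚ
    distinct  : ∀ {i j} → point i ≡ point j → i ≡ j
    nonzero   : ∀ i → point i ≢ 0ℚ

  point-zero≢suc : ∀ i → point (suc i) - point 0 ≢ 0ℚ
  point-zero≢suc i eq = ℕ.1+n≢0 (distinct (-≡0⇒≡ eq))

open TestPoints

next : TestPoints → TestPoints
next c .point i     = point c (suc i)
next c .distinct eq = ℕ.suc-injective (distinct c eq)
next c .nonzero i   = nonzero c (suc i)

-- If point 0 is a root, it is divided out. If the quotient vanishes, then so
-- does a₀, and X is divided out of the polynomial; since the points are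
-- nonzero, the remaining coefficients can be tested at the same points.
horner-nonzero : (c : TestPoints) (as : Vec ℚ n) →
                 AllZero as ⊎ ∃[ i ] horner as (point c i) ≢ 0ℚ
horner-nonzero c []            = inj₁ []
horner-nonzero c as₀@(a ∷ as) with horner as₀ (point c 0) ≟ 0ℚ
... | no  ≢0   = inj₂ (0 , ≢0)
... | yes root with horner-nonzero (next c) (quotient as₀ (point c 0))
...   | inj₂ (i , ≢0) = inj₂ (suc i , λ eq →
          *-nonzero (point-zero≢suc c i) ≢0 (trans (sym (horner-root as₀ root (point c (suc i)))) eq))
...   | inj₁ quotient≡0 = Sum.map
          (trans (lemma₁ a (horner as 0ℚ)) (vanishes 0ℚ) ∷_)
          (λ (i , ≢0) → contradiction (x*horner≡0 (point c i)) (*-nonzero (nonzero c i) ≢0))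
          (horner-nonzero c as)
  where
  vanishes : ∀ x → horner as₀ x ≡ 0ℚ
  vanishes x = trans (horner-root as₀ root x)
    (trans (cong ((x - point c 0) *_) (horner-zero quotient≡0 x)) (ℚ.*-zeroʳ (x - point c 0)))
  lemma₁ : ∀ a b → a ≡ a + 0ℚ * b
  lemma₁ = solve-∀ ℚ-ring
  lemma₂ : ∀ a x y z → x * y ≡ (a + x * y) - (a + 0ℚ * z)
  lemma₂ = solve-∀ ℚ-ring
  x*horner≡0 : ∀ x → x * horner as x ≡ 0ℚ
  x*horner≡0 x = trans (lemma₂ a x (horner as x) (horner as 0ℚ)) (cong₂ _-_ (vanishes x) (vanishes 0ℚ))

vanishes⇒AllZero : (c : TestPoints) (as : Vec ℚ n) →
                   (∀ i → horner as (point c i) ≡ 0ℚ) → AllZero as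
vanishes⇒AllZero c as vanishes =
  [ id , (λ (i , ≢0) → contradiction (vanishes i) ≢0) ]′ (horner-nonzero c as)

-- At every test point one of the factors vanishes, and the corresponding
-- linear factor can be divided out of it.
horner-integral : (c : TestPoints) (as : Vec ℚ l) (bs : Vec ℚ n) →
                  (∀ i → horner as (point c i) * horner bs (point c i) ≡ 0ℚ) →
                  AllZero as ⊎ AllZero bs
horner-integral c []           bs            eq = inj₁ []
horner-integral c as@(_ ∷ _)   []            eq = inj₂ []
horner-integral c as₀@(_ ∷ _) bs₀@(_ ∷ _) eq
  with ℚ-integral (horner as₀ (point c 0)) (horner bs₀ (point c 0)) (eq 0)
... | inj₁ root = Sum.map₁ (λ q≡0 → vanishes⇒AllZero c as₀ λ i →
        trans (horner-root as₀ root (point c i))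
          (trans (cong ((point c i - point c 0) *_) (horner-zero q≡0 (point c i))) (ℚ.*-zeroʳ (point c i - point c 0))))
        (horner-integral (next c) (quotient as₀ (point c 0)) bs₀ λ i →
          [ (λ eq₀ → contradiction eq₀ (point-zero≢suc c i)) , id ]′
            (ℚ-integral (point c (suc i) - point c 0) _
              (trans (sym (ℚ.*-assoc (point c (suc i) - point c 0) _ _))
                (trans (cong (_* horner bs₀ (point c (suc i))) (sym (horner-root as₀ root (point c (suc i))))) (eq (suc i))))))
... | inj₂ root = Sum.map₂ (λ q≡0 → vanishes⇒AllZero c bs₀ λ i →
        trans (horner-root bs₀ root (point c i))
          (trans (cong ((point c i - point c 0) *_) (horner-zero q≡0 (point c i))) (ℚ.*-zeroʳ (point c i - point c 0))))
        (horner-integral (next c) as₀ (quotient bs₀ (point c 0)) λ i →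
          [ (λ eq₀ → contradiction eq₀ (point-zero≢suc c i)) , id ]′
            (ℚ-integral (point c (suc i) - point c 0) _
              (trans (lemma (point c (suc i) - point c 0) (horner as₀ (point c (suc i))) _)
                (trans (cong (horner as₀ (point c (suc i)) *_) (sym (horner-root bs₀ root (point c (suc i))))) (eq (suc i))))))
  where
  lemma : ∀ x y z → x * (y * z) ≡ y * (x * z)
  lemma = solve-∀ ℚ-ring

-- Polynomials as univariate polynomials in the first variable

-- p = low p + x₀ · high p, where x₀ does not occur in low p.
low : Poly (suc n) → Poly n
low []                      = []
low ((c , zero  ∷ e) ∷ p) = (c , e) ∷ low p
low ((c , suc _ ∷ e) ∷ p) = low p

high : Poly (suc n) → Poly (suc n)
high []                      = []
high ((c , zero  ∷ e) ∷ p) = high p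
high ((c , suc i ∷ e) ∷ p) = (c , i ∷ e) ∷ high p

ev-low-high : ∀ (p : Poly (suc n)) x v → ev p (x ∷ v) ≡ ev (low p) v + x * ev (high p) (x ∷ v)
ev-low-high []                    x v = sym (trans (ℚ.+-identityˡ _) (ℚ.*-zeroʳ x))
ev-low-high ((c , zero  ∷ e) ∷ p) x v =
  trans (cong (c * (1ℚ * mono e v) +_) (ev-low-high p x v)) (lemma c (mono e v) (ev (low p) v) (x * ev (high p) (x ∷ v)))
  where
  lemma : ∀ a b c d → a * (1ℚ * b) + (c + d) ≡ a * b + c + d
  lemma = solve-∀ ℚ-ring
ev-low-high ((c , suc i ∷ e) ∷ p) x v =
  trans (cong (c * (x * x ^ i * mono e v) +_) (ev-low-high p x v)) (lemma c x (x ^ i) (mono e v) (ev (low p) v) (ev (high p) (x ∷ v)))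
  where
  lemma : ∀ c x y z a b → c * (x * y * z) + (a + x * b) ≡ a + x * (c * (y * z) + b)
  lemma = solve-∀ ℚ-ring

coeff-low : ∀ (p : Poly (suc n)) e → coeff p (0 ∷ e) ≡ coeff (low p) e
coeff-low []                    e = refl
coeff-low ((c , zero  ∷ d) ∷ p) e =
  cong (λ a → if does (Vec.≡-dec ℕ._≟_ d e) then c + a else a) (coeff-low p e)
coeff-low ((c , suc _ ∷ d) ∷ p) e = coeff-low p e

coeff-high : ∀ (p : Poly (suc n)) i e → coeff p (suc i ∷ e) ≡ coeff (high p) (i ∷ e)
coeff-high []                    i e = refl
coeff-high ((c , zero  ∷ d) ∷ p) i e = coeff-high p i e
coeff-high ((c , suc j ∷ d) ∷ p) i e =
  cong (λ a → if does (Vec.≡-dec ℕ._≟_ (j ∷ d) (i ∷ e)) then c + a else a) (coeff-high p i e)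

-- The coefficients of p as a polynomial of degree less than b in x₀.
coefficients : ∀ b → Poly (suc n) → Vec (Poly n) b
coefficients zero    p = []
coefficients (suc b) p = low p ∷ coefficients b (high p)

-- The exponents of the first variable, also in terms that cancel, are less
-- than b.
HeadDegree< : ℕ → Poly (suc n) → Set
HeadDegree< b = ListAll.All (λ t → Vec.head (proj₂ t) ℕ.< b)

high-HeadDegree< : ∀ {b} (p : Poly (suc n)) → HeadDegree< (suc b) p → HeadDegree< b (high p)
high-HeadDegree< []                    []               = []
high-HeadDegree< ((c , zero  ∷ e) ∷ p) (_ ∷ bs)         = high-HeadDegree< p bs
high-HeadDegree< ((c , suc i ∷ e) ∷ p) (ℕ.s≤s i<b ∷ bs) = i<b ∷ high-HeadDegree< p bs

headBound : (p : Poly (suc n)) → ∃[ b ] HeadDegree< b p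
headBound []                = 0 , []
headBound ((c , i ∷ e) ∷ p) with headBound p
... | b , bs = suc i ℕ.⊔ b , ℕ.m≤m⊔n (suc i) b ∷ ListAll.map (λ j<b → ℕ.≤-trans j<b (ℕ.m≤n⊔m (suc i) b)) bs

ev-coefficients : ∀ {b} (p : Poly (suc n)) → HeadDegree< b p →
                  ∀ x v → ev p (x ∷ v) ≡ horner (evs (coefficients b p) v) x
ev-coefficients {b = zero}  []      []        x v = refl
ev-coefficients {b = zero}  (_ ∷ _) (() ∷ _)  x v
ev-coefficients {b = suc b} p       bound     x v = trans (ev-low-high p x v)
  (cong (λ y → ev (low p) v + x * y) (ev-coefficients (high p) (high-HeadDegree< p bound) x v))

coefficients≈0 : ∀ {b} (p : Poly (suc n)) → HeadDegree< b p →
                 All (_≈ 0ₚ) (coefficients b p) → p ≈ 0ₚ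
coefficients≈0 {b = zero}  []      []       []         _           = refl
coefficients≈0 {b = zero}  (_ ∷ _) (() ∷ _) _          _
coefficients≈0 {b = suc b} p       bound    (low≈0 ∷ ≈0) (zero  ∷ e) = trans (coeff-low p e) (low≈0 e)
coefficients≈0 {b = suc b} p       bound    (low≈0 ∷ ≈0) (suc i ∷ e) =
  trans (coeff-high p i e) (coefficients≈0 (high p) (high-HeadDegree< p bound) ≈0 (i ∷ e))

-- A polynomial is determined by its values; polynomials form a domain

module _ (c : TestPoints) where

  -- The grid of points all of whose coordinates are test points.
  testPoint : Vec ℕ n → Vec ℚ n
  testPoint = Vec.map (point c)

  ≈0-or-nonzero : (p : Poly n) → p ≈ 0ₚ ⊎ ∃[ v ] ev p (testPoint v) ≢ 0ℚ
  ≈0-or-nonzero {zero}  p with ev p [] ≟ 0ℚ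
  ... | yes eq = inj₁ λ { [] → trans (constant p) eq }
    where
    constant : (p : Poly 0) → coeff p [] ≡ ev p []
    constant []            = refl
    constant ((c , []) ∷ p) = cong₂ _+_ (sym (ℚ.*-identityʳ c)) (constant p)
  ... | no ≢0  = inj₂ ([] , ≢0)
  ≈0-or-nonzero {suc n} p with headBound p
  ... | b , bound with each (coefficients b p)
    where
    each : (qs : Vec (Poly n) k) → All (_≈ 0ₚ) qs ⊎ ∃[ v ] ¬ AllZero (evs qs (testPoint v))
    each []       = inj₁ []
    each (q ∷ qs) with ≈0-or-nonzero q | each qs
    ... | inj₂ (v , ≢0) | _              = inj₂ (v , λ { (eq ∷ _) → ≢0 eq })
    ... | inj₁ _        | inj₂ (v , ≢0)  = inj₂ (v , λ { (_ ∷ eqs) → ≢0 eqs })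
    ... | inj₁ q≈0      | inj₁ qs≈0      = inj₁ (q≈0 ∷ qs≈0)
  ...   | inj₁ ≈0       = inj₁ (coefficients≈0 p bound ≈0)
  ...   | inj₂ (v , ≢0) with horner-nonzero c (evs (coefficients b p) (testPoint v))
  ...     | inj₁ ≡0       = contradiction ≡0 ≢0
  ...     | inj₂ (i , ≢0′) = inj₂ (i ∷ v , λ eq → ≢0′ (trans (sym (ev-coefficients p bound (point c i) (testPoint v))) eq))

  vanishes⇒≈0 : (p : Poly n) → (∀ v → ev p (testPoint v) ≡ 0ℚ) → p ≈ 0ₚ
  vanishes⇒≈0 p vanishes = [ id , (λ (v , ≢0) → contradiction (vanishes v) ≢0) ]′ (≈0-or-nonzero p)

  -- At a grid point v, all coefficients of p or all coefficients of q in x₀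
  -- vanish. Hence so does each product of a coefficient of p and one of q.
  integral : (p q : Poly n) → (∀ v → ev p (testPoint v) * ev q (testPoint v) ≡ 0ℚ) → p ≈ 0ₚ ⊎ q ≈ 0ₚ
  integral {zero} p q eq =
    Sum.map (λ p≡0 → vanishes⇒≈0 p λ { [] → p≡0 }) (λ q≡0 → vanishes⇒≈0 q λ { [] → q≡0 })
            (ℚ-integral _ _ (eq []))
  integral {suc n} p q eq with headBound p | headBound q
  ... | a , boundₚ | b , boundₛ = Sum.map (coefficients≈0 p boundₚ) (coefficients≈0 q boundₛ)
      (either (coefficients a p) (coefficients b q) λ v →
        horner-integral c _ _ λ i →
          trans (sym (cong₂ _*_ (ev-coefficients p boundₚ (point c i) (testPoint v))
                                (ev-coefficients q boundₛ (point c i) (testPoint v))))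
                (eq (i ∷ v)))
    where
    one : (r : Poly n) (qs : Vec (Poly n) l) →
          (∀ v → ev r (testPoint v) ≡ 0ℚ ⊎ AllZero (evs qs (testPoint v))) →
          r ≈ 0ₚ ⊎ All (_≈ 0ₚ) qs
    one r []       eq = inj₂ []
    one r (q ∷ qs) eq with integral r q (λ v → [ (λ r≡0 → trans (cong (_* ev q (testPoint v)) r≡0) (ℚ.*-zeroˡ (ev q (testPoint v))))
                                               , (λ { (q≡0 ∷ _) → trans (cong (ev r (testPoint v) *_) q≡0) (ℚ.*-zeroʳ (ev r (testPoint v))) }) ]′ (eq v))
                         | one r qs (λ v → Sum.map₂ (λ { (_ ∷ eqs) → eqs }) (eq v))
    ... | inj₁ r≈0 | _         = inj₁ r≈0
    ... | inj₂ _   | inj₁ r≈0  = inj₁ r≈0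
    ... | inj₂ q≈0 | inj₂ qs≈0 = inj₂ (q≈0 ∷ qs≈0)
    either : (ps : Vec (Poly n) k) (qs : Vec (Poly n) l) →
             (∀ v → AllZero (evs ps (testPoint v)) ⊎ AllZero (evs qs (testPoint v))) →
             All (_≈ 0ₚ) ps ⊎ All (_≈ 0ₚ) qs
    either []       qs eq = inj₁ []
    either (p ∷ ps) qs eq with one p qs (λ v → Sum.map₁ (λ { (p≡0 ∷ _) → p≡0 }) (eq v))
                             | either ps qs (λ v → Sum.map₁ (λ { (_ ∷ eqs) → eqs }) (eq v))
    ... | inj₂ qs≈0 | _          = inj₂ qs≈0
    ... | inj₁ _    | inj₂ qs≈0  = inj₂ qs≈0
    ... | inj₁ p≈0  | inj₁ ps≈0  = inj₁ (p≈0 ∷ ps≈0)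

-- Integers in ℚ

-- The inclusion of ℤ into ℚ.
ι : ℤ → ℚ
ι i = i ℚ./ 1

private
  toℚᵘ-ι : ∀ i → ℚ.toℚᵘ (ι i) ℚᵘ.≃ ℚᵘ.mkℚᵘ i 0
  toℚᵘ-ι i = ℚ.toℚᵘ-fromℚᵘ (ℚᵘ.mkℚᵘ i 0)

ι-+ : ∀ i j → ι (i ℤ.+ j) ≡ ι i + ι j
ι-+ i j = ℚ.toℚᵘ-injective (begin
  ℚ.toℚᵘ (ι (i ℤ.+ j))                   ≈⟨ toℚᵘ-ι (i ℤ.+ j) ⟩
  ℚᵘ.mkℚᵘ (i ℤ.+ j) 0                    ≡⟨ cong (λ k → ℚᵘ.mkℚᵘ k 0) (cong₂ ℤ._+_ (ℤ.*-identityʳ i) (ℤ.*-identityʳ j)) ⟨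
  ℚᵘ.mkℚᵘ i 0 ℚᵘ.+ ℚᵘ.mkℚᵘ j 0           ≈⟨ ℚᵘ.+-cong (toℚᵘ-ι i) (toℚᵘ-ι j) ⟨
  ℚ.toℚᵘ (ι i) ℚᵘ.+ ℚ.toℚᵘ (ι j)         ≈⟨ ℚ.toℚᵘ-homo-+ (ι i) (ι j) ⟨
  ℚ.toℚᵘ (ι i + ι j)                     ∎)
  where open ℚᵘ.≃-Reasoning

ι-* : ∀ i j → ι (i ℤ.* j) ≡ ι i * ι j
ι-* i j = ℚ.toℚᵘ-injective (begin
  ℚ.toℚᵘ (ι (i ℤ.* j))                   ≈⟨ toℚᵘ-ι (i ℤ.* j) ⟩
  ℚᵘ.mkℚᵘ i 0 ℚᵘ.* ℚᵘ.mkℚᵘ j 0           ≈⟨ ℚᵘ.*-cong (toℚᵘ-ι i) (toℚᵘ-ι j) ⟨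
  ℚ.toℚᵘ (ι i) ℚᵘ.* ℚ.toℚᵘ (ι j)         ≈⟨ ℚ.toℚᵘ-homo-* (ι i) (ι j) ⟨
  ℚ.toℚᵘ (ι i * ι j)                     ∎)
  where open ℚᵘ.≃-Reasoning

ι-injective : ∀ {i j} → ι i ≡ ι j → i ≡ j
ι-injective {i} {j} eq
  with ℚᵘ.≃-trans (ℚᵘ.≃-sym (toℚᵘ-ι i)) (ℚᵘ.≃-trans (ℚ.toℚᵘ-cong eq) (toℚᵘ-ι j))
... | ℚᵘ.*≡* i*1≡j*1 = ℤ.*-cancelʳ-≡ i j (ℤ.+ 1) i*1≡j*1

ι-^ : ∀ i k → ι (ℤ.+ (i ℕ.^ k)) ≡ ι (ℤ.+ i) ^ k
ι-^ i zero    = refl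
ι-^ i (suc k) = trans (cong ι (ℤ.pos-* i (i ℕ.^ k)))
  (trans (ι-* (ℤ.+ i) (ℤ.+ (i ℕ.^ k))) (cong (ι (ℤ.+ i) *_) (ι-^ i k)))

numerator-denominator : ∀ p → p * ι (↧ p) ≡ ι (↥ p)
numerator-denominator p@record{} = ℚ.toℚᵘ-injective (begin
  ℚ.toℚᵘ (p * ι (↧ p))                   ≈⟨ ℚ.toℚᵘ-homo-* p (ι (↧ p)) ⟩
  ℚ.toℚᵘ p ℚᵘ.* ℚ.toℚᵘ (ι (↧ p))         ≈⟨ ℚᵘ.*-cong (ℚᵘ.≃-refl {ℚ.toℚᵘ p}) (toℚᵘ-ι (↧ p)) ⟩
  ℚ.toℚᵘ p ℚᵘ.* ℚᵘ.mkℚᵘ (↧ p) 0          ≈⟨ ℚᵘ.*≡* (trans (ℤ.*-identityʳ _) (cong (↥ p ℤ.*_) (sym (cong ℤ.+_ (ℕ.*-identityʳ (↧ₙ p)))))) ⟩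
  ℚᵘ.mkℚᵘ (↥ p) 0                        ≈⟨ toℚᵘ-ι (↥ p) ⟨
  ℚ.toℚᵘ (ι (↥ p))                       ∎)
  where open ℚᵘ.≃-Reasoning

-- The k-th powers of the positive integers.
powers : ∀ k → .{{NonZero k}} → TestPoints
powers k = record
  { point    = λ i → ι (ℤ.+ (suc i ℕ.^ k))
  ; distinct = λ eq → ℕ.suc-injective (^-injective (ℤ.+-injective (ι-injective eq)))
  ; nonzero  = λ i eq → ℕ.1+n≢0 (ℕ.m^n≡0⇒m≡0 (suc i) k (ℤ.+-injective (ι-injective eq)))
  }
  where
  ^-injective : ∀ {i j} → i ℕ.^ k ≡ j ℕ.^ k → i ≡ j
  ^-injective {i} {j} eq with ℕ.<-cmp i j
  ... | tri< i<j _ _ = contradiction eq (ℕ.<⇒≢ (ℕ.^-monoˡ-< k i<j))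
  ... | tri≈ _ i≡j _ = i≡j
  ... | tri> _ _ i>j = contradiction (sym eq) (ℕ.<⇒≢ (ℕ.^-monoˡ-< k i>j))

integers : TestPoints
integers = powers 1

-- Consequences for polynomials on all rational points

ev⇒≈ : (p q : Poly n) → (∀ x → ev p x ≡ ev q x) → p ≈ q
ev⇒≈ p q eq = -≈0⇒≈ p q (vanishes⇒≈0 integers (p -ₚ q) λ v →
  trans (ev-minus p q _) (≡⇒-≡0 (eq _)))

ev⇒≈0 : (p : Poly n) → (∀ x → ev p x ≡ 0ℚ) → p ≈ 0ₚ
ev⇒≈0 p eq = ev⇒≈ p 0ₚ eq

≉0 : (p : Poly n) (x : Vec ℚ n) → ev p x ≢ 0ℚ → p ≉ 0ₚ
≉0 p x ≢0 p≈0 = ≢0 (≈0⇒ev p p≈0 x)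

*-integral : (p q : Poly n) → (∀ x → ev p x * ev q x ≡ 0ℚ) → p ≈ 0ₚ ⊎ q ≈ 0ₚ
*-integral p q eq = integral integers p q λ v → eq _

*-≉0 : (p q : Poly n) → p ≉ 0ₚ → q ≉ 0ₚ → p *ₚ q ≉ 0ₚ
*-≉0 p q p≉0 q≉0 pq≈0 = [ p≉0 , q≉0 ]′ (*-integral p q λ x → trans (sym (ev-* p q x)) (≈0⇒ev (p *ₚ q) pq≈0 x))

-- Complements of hypersurfaces are Zariski dense.
≈0-on-dense : (p q : Poly n) → q ≉ 0ₚ → (∀ x → ev q x ≢ 0ℚ → ev p x ≡ 0ℚ) → p ≈ 0ₚ
≈0-on-dense p q q≉0 eq = [ id , (λ q≈0 → contradiction q≈0 q≉0) ]′ (*-integral p q product)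
  where
  product : ∀ x → ev p x * ev q x ≡ 0ℚ
  product x with ev q x ≟ 0ℚ
  ... | yes q≡0 = trans (cong (ev p x *_) q≡0) (ℚ.*-zeroʳ (ev p x))
  ... | no  q≢0 = trans (cong (_* ev q x) (eq x q≢0)) (ℚ.*-zeroˡ (ev q x))

-- A property of polynomials that respects _≈_, holds for constants and is
-- closed under sums and products holds for values of polynomials at tuples
-- that have it.
module _ (P : Poly k → Set)
         (P-const : ∀ c → P (const c))
         (P-+ : ∀ {p q} → P p → P q → P (p +ₚ q))
         (P-* : ∀ {p q} → P p → P q → P (p *ₚ q))
         (P-resp : ∀ {p q} → (∀ x → ev p x ≡ ev q x) → P p → P q) where

  substₚ-closed : (p : Poly n) {f : Vec (Poly k) n} → All P f → P (substₚ p f)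
  substₚ-closed []            Pf = P-resp (ev-const 0ℚ) (P-const 0ℚ)
  substₚ-closed ((c , e) ∷ p) Pf = P-+ (P-* (P-const c) (monomial-closed e Pf)) (substₚ-closed p Pf)
    where
    power-closed : ∀ {q} i → P q → P (q ^ₚ i)
    power-closed zero    Pq = P-const 1ℚ
    power-closed (suc i) Pq = P-* Pq (power-closed i Pq)
    monomial-closed : ∀ {n} (e : Monomial n) {f} → All P f →
                      P (Evaluation.monomial (polyRing k) const e f)
    monomial-closed []      []        = P-const 1ℚ
    monomial-closed (i ∷ e) (Pg ∷ Pf) = P-* (power-closed i Pg) (monomial-closed e Pf)

evs-vars : (x : Vec ℚ n) → evs vars x ≡ x
evs-vars x = trans (Vec.map-cong (λ _ → refl) vars) (trans (sym (Vec.tabulate-∘ (λ p → ev p x) var))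
  (trans (Vec.tabulate-cong (λ i → ev-var i x)) (Vec.tabulate∘lookup x)))

poly-induction : (P : Poly n → Set) →
                 (∀ c → P (const c)) → (∀ i → P (var i)) →
                 (∀ {p q} → P p → P q → P (p +ₚ q)) →
                 (∀ {p q} → P p → P q → P (p *ₚ q)) →
                 (∀ {p q} → (∀ x → ev p x ≡ ev q x) → P p → P q) →
                 ∀ p → P p
poly-induction P P-const P-var P-+ P-* P-resp p =
  P-resp (λ x → trans (ev-subst p vars x) (cong (ev p) (evs-vars x)))
         (substₚ-closed P P-const P-+ P-* P-resp p (tabulate⁺ P-var))

-- If each coordinate of f differs from the corresponding variable by a
-- multiple of d, then p ∘ f differs from p by a multiple of d.
multiple-of-difference :
  (d : Poly n) (f : Vec (Poly n) n) →
  (∀ i → ∃[ h ] ∀ x → lookup x i - lookup (evs f x) i ≡ ev h x * ev d x) →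
  ∀ p → ∃[ h ] ∀ x → ev p x - ev p (evs f x) ≡ ev h x * ev d x
multiple-of-difference d f base = poly-induction _
  (λ c → 0ₚ , λ x → trans (cong₂ _-_ (ev-const c x) (ev-const c (evs f x))) (lemma₁ c (ev d x)))
  (λ i → let h , eq = base i in h , λ x → trans (cong₂ _-_ (ev-var i x) (ev-var i (evs f x))) (eq x))
  (λ {p} {q} (g , eqₚ) (h , eqₛ) → g +ₚ h , λ x → begin
    ev (p +ₚ q) x - ev (p +ₚ q) (evs f x)
      ≡⟨ cong₂ _-_ (ev-+ p q x) (ev-+ p q (evs f x)) ⟩
    (ev p x + ev q x) - (ev p (evs f x) + ev q (evs f x))
      ≡⟨ lemma₂ (ev p x) (ev q x) (ev p (evs f x)) (ev q (evs f x)) ⟩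
    (ev p x - ev p (evs f x)) + (ev q x - ev q (evs f x))
      ≡⟨ cong₂ _+_ (eqₚ x) (eqₛ x) ⟩
    ev g x * ev d x + ev h x * ev d x
      ≡⟨ ℚ.*-distribʳ-+ (ev d x) (ev g x) (ev h x) ⟨
    (ev g x + ev h x) * ev d x
      ≡⟨ cong (_* ev d x) (ev-+ g h x) ⟨
    ev (g +ₚ h) x * ev d x ∎)
  (λ {p} {q} (g , eqₚ) (h , eqₛ) → g *ₚ q +ₚ substₚ p f *ₚ h , λ x → begin
    ev (p *ₚ q) x - ev (p *ₚ q) (evs f x)
      ≡⟨ cong₂ _-_ (ev-* p q x) (ev-* p q (evs f x)) ⟩
    ev p x * ev q x - ev p (evs f x) * ev q (evs f x)
      ≡⟨ lemma₃ (ev p x) (ev q x) (ev p (evs f x)) (ev q (evs f x)) ⟩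
    (ev p x - ev p (evs f x)) * ev q x + ev p (evs f x) * (ev q x - ev q (evs f x))
      ≡⟨ cong₂ (λ a b → a * ev q x + ev p (evs f x) * b) (eqₚ x) (eqₛ x) ⟩
    (ev g x * ev d x) * ev q x + ev p (evs f x) * (ev h x * ev d x)
      ≡⟨ lemma₄ (ev g x) (ev d x) (ev q x) (ev p (evs f x)) (ev h x) ⟩
    (ev g x * ev q x + ev p (evs f x) * ev h x) * ev d x
      ≡⟨ cong (_* ev d x) (trans (ev-+ (g *ₚ q) (substₚ p f *ₚ h) x)
           (cong₂ _+_ (ev-* g q x) (trans (ev-* (substₚ p f) h x) (cong (_* ev h x) (ev-subst p f x))))) ⟨
    ev (g *ₚ q +ₚ substₚ p f *ₚ h) x * ev d x ∎)
  (λ eq (h , eqₚ) → h , λ x → trans (cong₂ _-_ (sym (eq x)) (sym (eq (evs f x)))) (eqₚ x))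
  where
  open ≡-Reasoning
  lemma₁ : ∀ a b → a - a ≡ 0ℚ * b
  lemma₁ = solve-∀ ℚ-ring
  lemma₂ : ∀ a b c d → (a + b) - (c + d) ≡ (a - c) + (b - d)
  lemma₂ = solve-∀ ℚ-ring
  lemma₃ : ∀ a b c d → a * b - c * d ≡ (a - c) * b + c * (b - d)
  lemma₃ = solve-∀ ℚ-ring
  lemma₄ : ∀ g d q p h → (g * d) * q + p * (h * d) ≡ (g * q + p * h) * d
  lemma₄ = solve-∀ ℚ-ring

-- Graded polynomials

-- Every term of p, including those with zero coefficient, has weighted
-- degree d. This is stronger than Homogeneous, and decidable.
record IsForm (w : Vec ℕ n) (d : ℕ) (p : Poly n) : Set where
  constructor isForm
  field
    terms : ListAll.All (λ t → weightedDegree w (proj₂ t) ≡ d) p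

isForm? : (w : Vec ℕ n) (d : ℕ) (p : Poly n) → Dec (IsForm w d p)
isForm? w d p = Dec.map′ isForm IsForm.terms (ListAll.all? (λ t → weightedDegree w (proj₂ t) ℕ.≟ d) p)

weightedDegree-+ : ∀ (w : Vec ℕ n) d e →
                   weightedDegree w (Vec.zipWith ℕ._+_ d e) ≡ weightedDegree w d ℕ.+ weightedDegree w e
weightedDegree-+ []      []      []      = refl
weightedDegree-+ (i ∷ w) (a ∷ d) (b ∷ e) =
  trans (cong (i ℕ.* (a ℕ.+ b) ℕ.+_) (weightedDegree-+ w d e))
        (lemma i a b (weightedDegree w d) (weightedDegree w e))
  where
  lemma : ∀ i a b x y → i ℕ.* (a ℕ.+ b) ℕ.+ (x ℕ.+ y) ≡ i ℕ.* a ℕ.+ x ℕ.+ (i ℕ.* b ℕ.+ y)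
  lemma = ℕ-Solver.solve-∀

weightedDegree-0 : (w : Vec ℕ n) → weightedDegree w (Vec.replicate n 0) ≡ 0
weightedDegree-0 []      = refl
weightedDegree-0 (i ∷ w) = cong₂ ℕ._+_ (ℕ.*-zeroʳ i) (weightedDegree-0 w)

weightedDegree-var : ∀ (w : Vec ℕ n) i → weightedDegree w (Vec.replicate n 0 Vec.[ i ]≔ 1) ≡ lookup w i
weightedDegree-var (a ∷ w) zero    =
  trans (cong₂ ℕ._+_ (ℕ.*-identityʳ a) (weightedDegree-0 w)) (ℕ.+-identityʳ a)
weightedDegree-var (a ∷ w) (suc i) = cong₂ ℕ._+_ (ℕ.*-zeroʳ a) (weightedDegree-var w i)

isForm-+ : ∀ {w : Vec ℕ n} {d} {p q : Poly n} → IsForm w d p → IsForm w d q → IsForm w d (p +ₚ q)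
isForm-+ (isForm fp) (isForm fq) = isForm (ListAll.++⁺ fp fq)

isForm-const : ∀ (w : Vec ℕ n) c → IsForm w 0 (const c)
isForm-const w c = isForm (weightedDegree-0 w ∷ [])

isForm-var : ∀ (w : Vec ℕ n) i → IsForm w (lookup w i) (var i)
isForm-var w i = isForm (weightedDegree-var w i ∷ [])

-- The product of the term c·x^a and q.
multiple : ℚ → Monomial n → Poly n → Poly n
multiple c a q = List.map (λ (c′ , b) → c * c′ , Vec.zipWith ℕ._+_ a b) q

isForm-multiple : ∀ {w : Vec ℕ n} {d} c a {q : Poly n} → IsForm w d q →
                  IsForm w (weightedDegree w a ℕ.+ d) (multiple c a q)
isForm-multiple {w = w} {d} c a (isForm fq) = isForm (terms fq)
  where
  terms : ∀ {q} → ListAll.All (λ t → weightedDegree w (proj₂ t) ≡ d) q →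
          ListAll.All (λ t → weightedDegree w (proj₂ t) ≡ weightedDegree w a ℕ.+ d) (multiple c a q)
  terms                []        = []
  terms {(_ , b) ∷ q} (eq ∷ fq) = trans (weightedDegree-+ w a b) (cong (weightedDegree w a ℕ.+_) eq) ∷ terms fq

isForm-* : ∀ {w : Vec ℕ n} {d e} {p q : Poly n} → IsForm w d p → IsForm w e q → IsForm w (d ℕ.+ e) (p *ₚ q)
isForm-* {p = []}          (isForm [])          fq = isForm []
isForm-* {p = (c , a) ∷ p} (isForm (refl ∷ fp)) fq = isForm-+ (isForm-multiple c a fq) (isForm-* {p = p} (isForm fp) fq)

isForm-^ : ∀ {w : Vec ℕ n} {d} {p : Poly n} i → IsForm w d p → IsForm w (d ℕ.* i) (p ^ₚ i)
isForm-^ {w = w} {d} zero    fp = transport (λ a → IsForm w a 1ₚ) (sym (ℕ.*-zeroʳ d)) (isForm-const w 1ℚ)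
isForm-^ {w = w} {d} {p} (suc i) fp =
  transport (λ a → IsForm w a (p ^ₚ suc i)) (sym (ℕ.*-suc d i)) (isForm-* fp (isForm-^ i fp))

-- f is given by forms of the weighted degrees d·vⱼ.
record AreForms (w : Vec ℕ n) (d : ℕ) (v : Vec ℕ k) (f : Vec (Poly n) k) : Set where
  constructor areForms
  field
    form : ∀ j → IsForm w (d ℕ.* lookup v j) (lookup f j)

open AreForms

module _ {n} {w : Vec ℕ n} {d : ℕ} where

  open Evaluation (polyRing n) const using () renaming (monomial to monomialₚ)

  isForm-monomial : ∀ {v : Vec ℕ k} {f} → AreForms w d v f →
                    ∀ e → IsForm w (d ℕ.* weightedDegree v e) (monomialₚ e f)
  isForm-monomial {v = []}    {[]}    forms []      =
    transport (λ a → IsForm w a 1ₚ) (sym (ℕ.*-zeroʳ d)) (isForm-const w 1ℚ)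
  isForm-monomial {v = a ∷ v} {g ∷ f} forms (i ∷ e) =
    transport (λ a → IsForm w a (monomialₚ (i ∷ e) (g ∷ f)))
      (trans (cong (ℕ._+ d ℕ.* weightedDegree v e) (ℕ.*-assoc d a i)) (sym (ℕ.*-distribˡ-+ d (a ℕ.* i) (weightedDegree v e))))
      (isForm-* (isForm-^ i (form forms zero)) (isForm-monomial {v = v} {f} (areForms (form forms ∘ suc)) e))

  isForm-term : ∀ {v : Vec ℕ k} {f} → AreForms w d v f → ∀ c e →
                IsForm w (d ℕ.* weightedDegree v e) (const c *ₚ monomialₚ e f)
  isForm-term forms c e = isForm-* (isForm-const w c) (isForm-monomial forms e)

  isForm-subst : ∀ {a} {v : Vec ℕ k} {p f} → AreForms w d v f → IsForm v a p → IsForm w (d ℕ.* a) (substₚ p f)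
  isForm-subst {p = []}          forms (isForm [])          = isForm []
  isForm-subst {p = (c , e) ∷ p} forms (isForm (refl ∷ fp)) =
    isForm-+ (isForm-term forms c e) (isForm-subst {p = p} forms (isForm fp))

component-accept : ∀ {w : Vec ℕ n} {d} t p → weightedDegree w (proj₂ t) ≡ d → component w d (t ∷ p) ≡ t ∷ component w d p
component-accept {w = w} {d} t p = List.filter-accept (λ t → weightedDegree w (proj₂ t) ℕ.≟ d) {t} {p}

component-reject : ∀ {w : Vec ℕ n} {d} t p → weightedDegree w (proj₂ t) ≢ d → component w d (t ∷ p) ≡ component w d p
component-reject {w = w} {d} t p = List.filter-reject (λ t → weightedDegree w (proj₂ t) ℕ.≟ d) {t} {p}

component-+ : ∀ {w : Vec ℕ n} {d} p q → component w d (p +ₚ q) ≡ component w d p +ₚ component w d q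
component-+ {w = w} {d} = List.filter-++ (λ t → weightedDegree w (proj₂ t) ℕ.≟ d)

component-form : ∀ {w : Vec ℕ n} {d} {p} → IsForm w d p → component w d p ≡ p
component-form {w = w} {d} (isForm fp) = List.filter-all (λ t → weightedDegree w (proj₂ t) ℕ.≟ d) fp

component-other : ∀ {w : Vec ℕ n} {d e} {p} → IsForm w e p → e ≢ d → component w d p ≡ 0ₚ
component-other {w = w} {d} (isForm fp) e≢d = List.filter-none (λ t → weightedDegree w (proj₂ t) ℕ.≟ d)
  (ListAll.map (λ eq eq′ → e≢d (trans (sym eq) eq′)) fp)

-- Substitution of forms multiplies degrees by d. As d is not zero, different
-- degrees remain different.
component-subst : ∀ {w : Vec ℕ n} {d} .{{_ : NonZero d}} {v : Vec ℕ k} {f} → AreForms w d v f →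
                  ∀ a p → component w (d ℕ.* a) (substₚ p f) ≡ substₚ (component v a p) f
component-subst forms a [] = refl
component-subst {w = w} {d} {v} {f} forms a ((c , e) ∷ p) with weightedDegree v e ℕ.≟ a
... | yes eq@refl = trans (component-+ {w = w} (const c *ₚ Evaluation.monomial (polyRing _) const e f) (substₚ p f)) (trans
        (cong₂ _++_ (component-form (isForm-term {v = v} {f} forms c e)) (component-subst forms a p))
        (cong (λ q → substₚ q f) (sym (component-accept {w = v} (c , e) p eq))))
... | no  ≢a = trans (component-+ {w = w} (const c *ₚ Evaluation.monomial (polyRing _) const e f) (substₚ p f)) (trans
        (cong₂ _++_ (component-other (isForm-term forms c e) (≢a ∘ ℕ.*-cancelˡ-≡ _ _ d)) (component-subst forms a p))
        (cong (λ q → substₚ q f) (sym (component-reject {w = v} (c , e) p ≢a))))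

coeff-other : ∀ c {d} (p : Poly n) {e} → d ≢ e → coeff ((c , d) ∷ p) e ≡ coeff p e
coeff-other c {d} p {e} d≢e = cong (λ b → if b then c + coeff p e else coeff p e)
  (Dec.dec-false (Vec.≡-dec ℕ._≟_ d e) d≢e)

coeff-component : ∀ (w : Vec ℕ n) p e → coeff (component w (weightedDegree w e) p) e ≡ coeff p e
coeff-component w []            e = refl
coeff-component w ((c , a) ∷ p) e with weightedDegree w a ℕ.≟ weightedDegree w e
... | yes eq = trans (cong (λ q → coeff q e) (component-accept {w = w} (c , a) p eq))
  (cong (λ b → if does (Vec.≡-dec ℕ._≟_ a e) then c + b else b) (coeff-component w p e))
... | no  ≢d = trans (cong (λ q → coeff q e) (component-reject {w = w} (c , a) p ≢d))
  (trans (coeff-component w p e) (sym (coeff-other c {a} p {e} λ { refl → ≢d refl })))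

coeff-component-other : ∀ (w : Vec ℕ n) d p e → weightedDegree w e ≢ d → coeff (component w d p) e ≡ 0ℚ
coeff-component-other w d []            e ≢d = refl
coeff-component-other w d ((c , a) ∷ p) e ≢d with weightedDegree w a ℕ.≟ d
... | yes refl = trans (cong (λ q → coeff q e) (component-accept {w = w} (c , a) p refl))
  (trans (coeff-other c {a} (component w d p) {e} λ { refl → ≢d refl }) (coeff-component-other w d p e ≢d))
... | no  ≢d′  = trans (cong (λ q → coeff q e) (component-reject {w = w} (c , a) p ≢d′))
  (coeff-component-other w d p e ≢d)

component-cong : ∀ (w : Vec ℕ n) d {p q : Poly n} → p ≈ q → component w d p ≈ component w d q
component-cong w d {p} {q} p≈q e with weightedDegree w e ℕ.≟ d
... | yes refl = trans (coeff-component w p e) (trans (p≈q e) (sym (coeff-component w q e)))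
... | no  ≢d   = trans (coeff-component-other w d p e ≢d) (sym (coeff-component-other w d q e ≢d))

-- The components of a multiple of a form are multiples of it.
component-* : ∀ {w : Vec ℕ n} {d} {q : Poly n} → IsForm w d q → ∀ a p → ∃[ r ] component w a (p *ₚ q) ≡ r *ₚ q
component-* fq a []            = [] , refl
component-* {w = w} {d} {q} fq a ((c , e) ∷ p) with component-* fq a p | weightedDegree w e ℕ.+ d ℕ.≟ a
... | r , eq | yes refl = (c , e) ∷ r ,
        trans (component-+ {w = w} (multiple c e q) (p *ₚ q)) (cong₂ _++_ (component-form (isForm-multiple c e fq)) eq)
... | r , eq | no  ≢a   = r ,
        trans (component-+ {w = w} (multiple c e q) (p *ₚ q)) (cong₂ _++_ (component-other (isForm-multiple c e fq) ≢a) eq)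

isForm⇒homogeneous : ∀ {w : Vec ℕ n} {d} {p : Poly n} → IsForm w d p → Homogeneous w d p
isForm⇒homogeneous {p = []}          (isForm [])        e ≢0 = contradiction refl ≢0
isForm⇒homogeneous {w = w} {p = (c , a) ∷ p} (isForm (eq ∷ fp)) e ≢0 with Vec.≡-dec ℕ._≟_ a e
... | yes refl = eq
... | no  _    = isForm⇒homogeneous {w = w} {p = p} (isForm fp) e ≢0

homogeneous⇒component≈ : ∀ {w : Vec ℕ n} {d} (p : Poly n) → Homogeneous w d p → component w d p ≈ p
homogeneous⇒component≈ {w = w} {d} p hom e with weightedDegree w e ℕ.≟ d
... | yes refl = coeff-component w p e
... | no  ≢d   with coeff p e ≟ 0ℚ
...   | yes ≡0 = trans (coeff-component-other w d p e ≢d) (sym ≡0)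
...   | no  ≢0 = contradiction (hom e ≢0) ≢d

-- The action of t ∈ ℚ on weighted coordinates.
scale : Vec ℕ n → ℚ → Vec ℚ n → Vec ℚ n
scale w t x = Vec.zipWith (λ i y → t ^ i * y) w x

mono-scale : ∀ (w : Vec ℕ n) t e x → mono e (scale w t x) ≡ t ^ weightedDegree w e * mono e x
mono-scale []      t []      []      = refl
mono-scale (i ∷ w) t (a ∷ e) (y ∷ x) = begin
  (t ^ i * y) ^ a * mono e (scale w t x)
    ≡⟨ cong₂ _*_ (trans (^-distrib-* (t ^ i) y a) (cong (_* y ^ a) (^-assocʳ t i a))) (mono-scale w t e x) ⟩
  t ^ (i ℕ.* a) * y ^ a * (t ^ weightedDegree w e * mono e x)
    ≡⟨ lemma (t ^ (i ℕ.* a)) (y ^ a) (t ^ weightedDegree w e) (mono e x) ⟩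
  t ^ (i ℕ.* a) * t ^ weightedDegree w e * (y ^ a * mono e x)
    ≡⟨ cong (_* (y ^ a * mono e x)) (^-homo-* t (i ℕ.* a) (weightedDegree w e)) ⟨
  t ^ (i ℕ.* a ℕ.+ weightedDegree w e) * (y ^ a * mono e x) ∎
  where
  open ≡-Reasoning
  lemma : ∀ a b c d → a * b * (c * d) ≡ a * c * (b * d)
  lemma = solve-∀ ℚ-ring

ev-scale-form : ∀ {w : Vec ℕ n} {d} {p : Poly n} → IsForm w d p → ∀ t x → ev p (scale w t x) ≡ t ^ d * ev p x
ev-scale-form {d = d} {[]}          (isForm [])          t x = sym (ℚ.*-zeroʳ (t ^ d))
ev-scale-form {w = w} {p = (c , e) ∷ p} (isForm (refl ∷ fp)) t x =
  trans (cong₂ _+_ (cong (c *_) (mono-scale w t e x)) (ev-scale-form {p = p} (isForm fp) t x))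
        (lemma c (t ^ weightedDegree w e) (mono e x) (ev p x))
  where
  lemma : ∀ c t m p → c * (t * m) + t * p ≡ t * (c * m + p)
  lemma = solve-∀ ℚ-ring

ev-scale : ∀ {w : Vec ℕ n} {d} (p : Poly n) → Homogeneous w d p → ∀ t x → ev p (scale w t x) ≡ t ^ d * ev p x
ev-scale {w = w} {d} p hom t x = begin
  ev p (scale w t x)                   ≡⟨ ≈⇒ev (component w d p) p p≈ (scale w t x) ⟨
  ev (component w d p) (scale w t x)   ≡⟨ ev-scale-form (isForm (ListAll.all-filter (λ t → weightedDegree w (proj₂ t) ℕ.≟ d) p)) t x ⟩
  t ^ d * ev (component w d p) x       ≡⟨ cong (t ^ d *_) (≈⇒ev (component w d p) p p≈ x) ⟩
  t ^ d * ev p x                       ∎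
  where
  open ≡-Reasoning
  p≈ = homogeneous⇒component≈ {w = w} p hom

evs-scale : ∀ {w : Vec ℕ n} {d} {v : Vec ℕ k} {f} → AreForms w d v f →
            ∀ t x → evs f (scale w t x) ≡ scale v (t ^ d) (evs f x)
evs-scale {v = []}            {[]}    forms t x = refl
evs-scale {w = w} {d} {a ∷ v} {g ∷ f} forms t x = cong₂ _∷_
  (trans (ev-scale-form (form forms zero) t x) (cong (_* ev g x) (sym (^-assocʳ t d a))))
  (evs-scale {w = w} {d} {v} {f} (areForms (form forms ∘ suc)) t x)

-- Images of varieties

isVariety-resp : ∀ {w : Vec ℕ n} {I J : Pred (Poly n) 0ℓ} → I ⊆ J → J ⊆ I →
                 IsVariety {w = w} (closed I) → IsVariety {w = w} (closed J)
isVariety-resp I⊆J J⊆I V = record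
  { positive    = positive
  ; respects    = λ p≈q p∈J → I⊆J (respects p≈q (J⊆I p∈J))
  ; 0∈          = I⊆J 0∈
  ; +-closed    = λ p∈J q∈J → I⊆J (+-closed (J⊆I p∈J) (J⊆I q∈J))
  ; *-closed    = λ {p} {q} q∈J → I⊆J (*-closed {p} {q} (J⊆I q∈J))
  ; homogeneous = λ d p∈J → I⊆J (homogeneous d (J⊆I p∈J))
  ; proper      = proper ∘ J⊆I
  ; prime       = λ pq∈J → Sum.map I⊆J I⊆J (prime (J⊆I pq∈J))
  ; relevant    = let i , var∉I = relevant in i , var∉I ∘ J⊆I
  }
  where open IsVariety V

-- The closure of the image of a variety is a variety: its ideal is the
-- preimage of a prime ideal under a homomorphism of rings.
image-isVariety : ∀ {w : Vec ℕ n} {V : Closed w} {d} .{{_ : NonZero d}} {v : Vec ℕ k} (f : Vec (Poly n) k) →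
                  IsVariety V → All NonZero v → AreForms w d v f → (∃[ j ] lookup f j ∉ ideal V) →
                  IsVariety (image f v V)
image-isVariety {V = V} {d} f isV v>0 forms (j , fⱼ∉V) = record
  { positive    = v>0
  ; respects    = λ {p} {q} p≈q → respects (ev⇒≈ (substₚ p f) (substₚ q f) λ x →
      trans (ev-subst p f x) (trans (≈⇒ev p q p≈q (evs f x)) (sym (ev-subst q f x))))
  ; 0∈          = 0∈
  ; +-closed    = λ {p} {q} p∈I q∈I → respects (ev⇒≈ (substₚ p f +ₚ substₚ q f) (substₚ (p +ₚ q) f) λ x → sym (begin
      ev (substₚ (p +ₚ q) f) x               ≡⟨ ev-subst (p +ₚ q) f x ⟩
      ev (p +ₚ q) (evs f x)                  ≡⟨ ev-+ p q (evs f x) ⟩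
      ev p (evs f x) + ev q (evs f x)        ≡⟨ cong₂ _+_ (ev-subst p f x) (ev-subst q f x) ⟨
      ev (substₚ p f) x + ev (substₚ q f) x  ≡⟨ ev-+ (substₚ p f) (substₚ q f) x ⟨
      ev (substₚ p f +ₚ substₚ q f) x        ∎)) (+-closed p∈I q∈I)
  ; *-closed    = λ {p} {q} q∈I → respects (subst-* p q) (*-closed {substₚ p f} {substₚ q f} q∈I)
  ; homogeneous = λ {p} a p∈I → transport (_∈ ideal V) (component-subst forms a p) (homogeneous {substₚ p f} (d ℕ.* a) p∈I)
  ; proper      = λ 1∈I → proper (respects (ev⇒≈ (substₚ 1ₚ f) 1ₚ λ x →
      trans (ev-subst 1ₚ f x) (trans (ev-const 1ℚ (evs f x)) (sym (ev-const 1ℚ x)))) 1∈I)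
  ; prime       = λ {p} {q} pq∈I → prime (respects (λ e → sym (subst-* p q e)) pq∈I)
  ; relevant    = j , λ var∈I → fⱼ∉V (respects (ev⇒≈ (substₚ (var j) f) (lookup f j) λ x →
      trans (ev-subst (var j) f x) (trans (ev-var j (evs f x)) (Vec.lookup-map j (λ p → ev p x) f))) var∈I)
  }
  where
  open IsVariety isV
  open ≡-Reasoning
  subst-* : ∀ p q → substₚ p f *ₚ substₚ q f ≈ substₚ (p *ₚ q) f
  subst-* p q = ev⇒≈ (substₚ p f *ₚ substₚ q f) (substₚ (p *ₚ q) f) λ x → sym (begin
    ev (substₚ (p *ₚ q) f) x               ≡⟨ ev-subst (p *ₚ q) f x ⟩
    ev (p *ₚ q) (evs f x)                  ≡⟨ ev-* p q (evs f x) ⟩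
    ev p (evs f x) * ev q (evs f x)        ≡⟨ cong₂ _*_ (ev-subst p f x) (ev-subst q f x) ⟨
    ev (substₚ p f) x * ev (substₚ q f) x  ≡⟨ ev-* (substₚ p f) (substₚ q f) x ⟨
    ev (substₚ p f *ₚ substₚ q f) x        ∎)

-- Hypersurfaces and the projective line

∈principal⁻ : ∀ (t p : Poly n) → p ∈ ⟨ t ∷ [] ⟩ → ∃[ c ] ∀ x → ev p x ≡ ev c x * ev t x
∈principal⁻ t p (c ∷ [] , p≈) = c , λ x →
  trans (≈⇒ev p (c *ₚ t +ₚ 0ₚ) p≈ x)
    (trans (ev-+ (c *ₚ t) 0ₚ x) (trans (ℚ.+-identityʳ _) (ev-* c t x)))

∈principal⁺ : ∀ (t p : Poly n) c → (∀ x → ev p x ≡ ev c x * ev t x) → p ∈ ⟨ t ∷ [] ⟩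
∈principal⁺ t p c eq = c ∷ [] , ev⇒≈ p (c *ₚ t +ₚ 0ₚ) λ x →
  trans (eq x) (sym (trans (ev-+ (c *ₚ t) 0ₚ x) (trans (ℚ.+-identityʳ _) (ev-* c t x))))

-- The zero x₀ of t, which may be the origin, shows that the ideal is proper.
hypersurface-isVariety : ∀ {w : Vec ℕ n} {d} (t : Poly n) → All NonZero w → IsForm w d t →
                         (∃[ x ] ev t x ≡ 0ℚ) →
                         (∀ {p q} → p *ₚ q ∈ ⟨ t ∷ [] ⟩ → p ∈ ⟨ t ∷ [] ⟩ ⊎ q ∈ ⟨ t ∷ [] ⟩) →
                         (∃[ i ] var i ∉ ⟨ t ∷ [] ⟩) →
                         IsVariety (zeros w (t ∷ []))
hypersurface-isVariety {w = w} t w>0 form (x₀ , tx₀≡0) isPrime isRelevant = record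
  { positive    = w>0
  ; respects    = λ p≈q (c , p≈) → c , λ e → trans (sym (p≈q e)) (p≈ e)
  ; 0∈          = ∈principal⁺ t 0ₚ 0ₚ λ x → sym (ℚ.*-zeroˡ (ev t x))
  ; +-closed    = λ {p} {q} p∈ q∈ → let a , eqₚ = ∈principal⁻ t p p∈ ; b , eqₛ = ∈principal⁻ t q q∈ in
      ∈principal⁺ t (p +ₚ q) (a +ₚ b) λ x → begin
        ev (p +ₚ q) x                        ≡⟨ ev-+ p q x ⟩
        ev p x + ev q x                      ≡⟨ cong₂ _+_ (eqₚ x) (eqₛ x) ⟩
        ev a x * ev t x + ev b x * ev t x    ≡⟨ ℚ.*-distribʳ-+ (ev t x) (ev a x) (ev b x) ⟨
        (ev a x + ev b x) * ev t x           ≡⟨ cong (_* ev t x) (ev-+ a b x) ⟨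
        ev (a +ₚ b) x * ev t x               ∎
  ; *-closed    = λ {p} {q} q∈ → let b , eq = ∈principal⁻ t q q∈ in
      ∈principal⁺ t (p *ₚ q) (p *ₚ b) λ x → begin
        ev (p *ₚ q) x                        ≡⟨ ev-* p q x ⟩
        ev p x * ev q x                      ≡⟨ cong (ev p x *_) (eq x) ⟩
        ev p x * (ev b x * ev t x)           ≡⟨ ℚ.*-assoc (ev p x) (ev b x) (ev t x) ⟨
        (ev p x * ev b x) * ev t x           ≡⟨ cong (_* ev t x) (ev-* p b x) ⟨
        ev (p *ₚ b) x * ev t x               ∎
  ; homogeneous = λ {p} a p∈ → let c , eq = ∈principal⁻ t p p∈ ; r , eq′ = component-* form a c in
      ∈principal⁺ t (component w a p) r λ x → begin
        ev (component w a p) x               ≡⟨ ≈⇒ev (component w a p) (component w a (c *ₚ t)) (component-cong w a {p} {c *ₚ t}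
                                                  (ev⇒≈ p (c *ₚ t) λ y → trans (eq y) (sym (ev-* c t y)))) x ⟩
        ev (component w a (c *ₚ t)) x        ≡⟨ cong (λ q → ev q x) eq′ ⟩
        ev (r *ₚ t) x                        ≡⟨ ev-* r t x ⟩
        ev r x * ev t x                      ∎
  ; proper      = λ 1∈ → let c , eq = ∈principal⁻ t 1ₚ 1∈ in ℚ.1≢0 (begin
        1ℚ                 ≡⟨ ev-const 1ℚ x₀ ⟨
        ev 1ₚ x₀           ≡⟨ eq x₀ ⟩
        ev c x₀ * ev t x₀  ≡⟨ cong (ev c x₀ *_) tx₀≡0 ⟩
        ev c x₀ * 0ℚ       ≡⟨ ℚ.*-zeroʳ (ev c x₀) ⟩
        0ℚ                 ∎)
  ; prime       = λ {p} {q} → isPrime {p} {q}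
  ; relevant    = isRelevant
  }
  where open ≡-Reasoning

∈ℙ¹⁻ : ∀ p → p ∈ ideal ℙ¹ → p ≈ 0ₚ
∈ℙ¹⁻ p ([] , p≈0) = p≈0

∈ℙ¹⁺ : ∀ p → p ≈ 0ₚ → p ∈ ideal ℙ¹
∈ℙ¹⁺ p p≈0 = [] , p≈0

ℙ¹-isVariety : IsVariety ℙ¹
ℙ¹-isVariety = record
  { positive    = _ ∷ _ ∷ []
  ; respects    = λ {p} {q} p≈q p∈ → ∈ℙ¹⁺ q λ e → trans (sym (p≈q e)) (∈ℙ¹⁻ p p∈ e)
  ; 0∈          = ∈ℙ¹⁺ 0ₚ λ _ → refl
  ; +-closed    = λ {p} {q} p∈ q∈ → ∈ℙ¹⁺ (p +ₚ q) λ e → trans (coeff-+ p q e) (cong₂ _+_ (∈ℙ¹⁻ p p∈ e) (∈ℙ¹⁻ q q∈ e))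
  ; *-closed    = λ {p} {q} q∈ → ∈ℙ¹⁺ (p *ₚ q) (ev⇒≈0 (p *ₚ q) λ x → trans (ev-* p q x)
      (trans (cong (ev p x *_) (≈0⇒ev q (∈ℙ¹⁻ q q∈) x)) (ℚ.*-zeroʳ (ev p x))))
  ; homogeneous = λ {p} d p∈ → ∈ℙ¹⁺ (component w₁₁ d p) (component-cong w₁₁ d {p} {0ₚ} (∈ℙ¹⁻ p p∈))
  ; proper      = λ 1∈ → contradiction (∈ℙ¹⁻ 1ₚ 1∈ (0 ∷ 0 ∷ [])) λ ()
  ; prime       = λ {p} {q} pq∈ → Sum.map (∈ℙ¹⁺ p) (∈ℙ¹⁺ q) (*-integral p q λ x →
      trans (sym (ev-* p q x)) (≈0⇒ev (p *ₚ q) (∈ℙ¹⁻ (p *ₚ q) pq∈) x))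
  ; relevant    = zero , λ var∈ → contradiction (∈ℙ¹⁻ (var zero) var∈ (1 ∷ 0 ∷ [])) λ ()
  }

-- Values of fractions

-- The fraction φ is defined at the point x, with the value q.
record HasValue (x : Vec ℚ n) (φ : Fraction n) (q : ℚ) : Set where
  constructor hasValue
  field
    defined : ev (den φ) x ≢ 0ℚ
    value-≡ : ev (num φ) x ≡ q * ev (den φ) x

-- The fractions φ are defined at x, with the values q.
data HaveValues (x : Vec ℚ n) : Vec (Fraction n) k → Vec ℚ k → Set where
  []  : HaveValues x [] []
  _∷_ : ∀ {φ q} {φs : Vec (Fraction n) k} {qs} → HasValue x φ q → HaveValues x φs qs → HaveValues x (φ ∷ φs) (q ∷ qs)

module _ {w : Vec ℕ n} (V : Closed w) (x : Vec ℚ n) where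

  private module K = RawRing (fractionRing V)

  const-hasValue : ∀ c → HasValue x (const c /ₚ 1ₚ) c
  const-hasValue c = hasValue (λ eq → ℚ.1≢0 (trans (sym (ev-const 1ℚ x)) eq))
    (trans (ev-const c x) (trans (sym (ℚ.*-identityʳ c)) (cong (c *_) (sym (ev-const 1ℚ x)))))

  zero-hasValue : HasValue x K.0# 0ℚ
  zero-hasValue = hasValue (HasValue.defined (const-hasValue 1ℚ)) (sym (ℚ.*-zeroˡ (ev {n} 1ₚ x)))

  +-hasValue : ∀ {φ ψ p q} → HasValue x φ p → HasValue x ψ q → HasValue x (φ K.+ ψ) (p + q)
  +-hasValue {a /ₚ b} {c /ₚ d} {p} {q} (hasValue b≢0 a≡) (hasValue d≢0 c≡) = hasValue
    (λ eq → *-nonzero b≢0 d≢0 (trans (sym (ev-* b d x)) eq))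
    (begin
      ev (a *ₚ d +ₚ c *ₚ b) x                                  ≡⟨ trans (ev-+ (a *ₚ d) (c *ₚ b) x) (cong₂ _+_ (ev-* a d x) (ev-* c b x)) ⟩
      ev a x * ev d x + ev c x * ev b x                        ≡⟨ cong₂ (λ y z → y * ev d x + z * ev b x) a≡ c≡ ⟩
      p * ev b x * ev d x + q * ev d x * ev b x                ≡⟨ lemma p q (ev b x) (ev d x) ⟩
      (p + q) * (ev b x * ev d x)                              ≡⟨ cong ((p + q) *_) (ev-* b d x) ⟨
      (p + q) * ev (b *ₚ d) x                                  ∎)
    where
    open ≡-Reasoning
    lemma : ∀ p q b d → p * b * d + q * d * b ≡ (p + q) * (b * d)
    lemma = solve-∀ ℚ-ring

  *-hasValue : ∀ {φ ψ p q} → HasValue x φ p → HasValue x ψ q → HasValue x (φ K.* ψ) (p * q)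
  *-hasValue {a /ₚ b} {c /ₚ d} {p} {q} (hasValue b≢0 a≡) (hasValue d≢0 c≡) = hasValue
    (λ eq → *-nonzero b≢0 d≢0 (trans (sym (ev-* b d x)) eq))
    (begin
      ev (a *ₚ c) x                    ≡⟨ ev-* a c x ⟩
      ev a x * ev c x                  ≡⟨ cong₂ _*_ a≡ c≡ ⟩
      p * ev b x * (q * ev d x)        ≡⟨ lemma p q (ev b x) (ev d x) ⟩
      (p * q) * (ev b x * ev d x)      ≡⟨ cong ((p * q) *_) (ev-* b d x) ⟨
      (p * q) * ev (b *ₚ d) x          ∎)
    where
    open ≡-Reasoning
    lemma : ∀ p q b d → p * b * (q * d) ≡ (p * q) * (b * d)
    lemma = solve-∀ ℚ-ring

  private
    module E = Evaluation (fractionRing V) (λ c → const c /ₚ 1ₚ)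
    module Kˢ = RawSemiringDefs K.rawSemiring

  ^-hasValue : ∀ {φ p} i → HasValue x φ p → HasValue x (φ Kˢ.^ i) (p ^ i)
  ^-hasValue zero    v = const-hasValue 1ℚ
  ^-hasValue (suc i) v = *-hasValue v (^-hasValue i v)

  monomial-hasValue : ∀ (e : Monomial k) {φ q} → HaveValues x φ q → HasValue x (E.monomial e φ) (mono e q)
  monomial-hasValue []      []       = const-hasValue 1ℚ
  monomial-hasValue (i ∷ e) (v ∷ vs) = *-hasValue (^-hasValue i v) (monomial-hasValue e vs)

  -- The total operations on fractions compute the values of rational
  -- expressions wherever all the fractions involved are defined.
  eval-hasValue : ∀ (R : Poly k) {φ q} → HaveValues x φ q → HasValue x (E.eval R φ) (ev R q)
  eval-hasValue []            vs = zero-hasValue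
  eval-hasValue ((c , e) ∷ R) vs =
    +-hasValue (*-hasValue (const-hasValue c) (monomial-hasValue e vs)) (eval-hasValue R vs)

  -- A relation in the function field says that this polynomial y is in the
  -- ideal.
  num-zero : ∀ φ {y} → y ≡ num φ *ₚ 1ₚ -ₚ 0ₚ *ₚ den φ → ev y x ≡ ev (num φ) x
  num-zero (a /ₚ b) refl = begin
    ev (a *ₚ 1ₚ -ₚ 0ₚ *ₚ b) x                ≡⟨ ev-minus (a *ₚ 1ₚ) (0ₚ *ₚ b) x ⟩
    ev (a *ₚ 1ₚ) x - 0ℚ                      ≡⟨ ℚ.+-identityʳ _ ⟩
    ev (a *ₚ 1ₚ) x                           ≡⟨ trans (ev-* a 1ₚ x) (cong (ev a x *_) (ev-const 1ℚ x)) ⟩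
    ev a x * 1ℚ                              ≡⟨ ℚ.*-identityʳ (ev a x) ⟩
    ev a x                                   ∎
    where open ≡-Reasoning

-- Curves with a rational parametrization

lookup-evs : ∀ (f : Vec (Poly n) k) x j → lookup (evs f x) j ≡ ev (lookup f j) x
lookup-evs f x j = Vec.lookup-map j (λ p → ev p x) f

lookup-scale : ∀ (w : Vec ℕ n) t x j → lookup (scale w t x) j ≡ t ^ lookup w j * lookup x j
lookup-scale w t x j = Vec.lookup-zipWith (λ i y → t ^ i * y) j w x

-- V is the closure of the image of π : ℙ¹ → ℙ(w), and g is a map to ℙ¹ with
-- g ∘ π = h · id. The value of h at (s₀,1) shows that h(s,1), and hence h, is
-- not zero. The coordinate xᵢ of weight 1 serves to express the factor
-- between π ∘ g and the identity as a fraction.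
module RationalCurve
  {n} {w : Vec ℕ n} (V : Closed w) (w>0 : All NonZero w)
  {d} .{{_ : NonZero d}} (π : Vec (Poly 2) n) (π-forms : AreForms w₁₁ d w π)
  (∈ideal⁻ : ∀ {p} → p ∈ ideal V → ∀ x → ev p (evs π x) ≡ 0ℚ)
  (∈ideal⁺ : ∀ {p} → (∀ x → ev p (evs π x) ≡ 0ℚ) → p ∈ ideal V)
  {e} .{{_ : NonZero e}} (g : Vec (Poly n) 2) (g-forms : AreForms w e w₁₁ g)
  {c} (h : Poly 2) (h-form : IsForm w₁₁ c h)
  (g∘π : ∀ x → evs g (evs π x) ≡ scale w₁₁ (ev h x) x)
  (s₀ : ℚ) (h≢0 : ev h (s₀ ∷ 1ℚ ∷ []) ≢ 0ℚ)
  (i : Fin n) (wᵢ≡1 : lookup w i ≡ 1) (πᵢ≉0 : lookup π i ≉ 0ₚ)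
  where

  open ≡-Reasoning

  private
    h≉0 : h ≉ 0ₚ
    h≉0 = ≉0 h (s₀ ∷ 1ℚ ∷ []) h≢0

    ev-g : ∀ x j → ev (lookup g j) (evs π x) ≡ ev h x ^ lookup w₁₁ j * lookup x j
    ev-g x j = trans (sym (lookup-evs g (evs π x) j)) (trans (cong (λ y → lookup y j) (g∘π x)) (lookup-scale w₁₁ (ev h x) x j))

    ev-g₀ : ∀ x → ev (lookup g zero) (evs π x) ≡ ev h x * lookup x zero
    ev-g₀ x = trans (ev-g x zero) (cong (_* lookup x zero) (ℚ.*-identityʳ (ev h x)))

    ev-g₁ : ∀ x → ev (lookup g (suc zero)) (evs π x) ≡ ev h x * lookup x (suc zero)
    ev-g₁ x = trans (ev-g x (suc zero)) (cong (_* lookup x (suc zero)) (ℚ.*-identityʳ (ev h x)))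

    -- π ∘ g ∘ π = h^d · π
    π∘g∘π : ∀ x → evs π (evs g (evs π x)) ≡ scale w (ev h x ^ d) (evs π x)
    π∘g∘π x = trans (cong (evs π) (g∘π x)) (evs-scale π-forms (ev h x) x)

    ev-π∘g : ∀ x j → ev (substₚ (lookup π j) g) (evs π x) ≡ (ev h x ^ d) ^ lookup w j * ev (lookup π j) x
    ev-π∘g x j = begin
      ev (substₚ (lookup π j) g) (evs π x)        ≡⟨ ev-subst (lookup π j) g (evs π x) ⟩
      ev (lookup π j) (evs g (evs π x))           ≡⟨ lookup-evs π (evs g (evs π x)) j ⟨
      lookup (evs π (evs g (evs π x))) j          ≡⟨ cong (λ y → lookup y j) (π∘g∘π x) ⟩
      lookup (scale w (ev h x ^ d) (evs π x)) j   ≡⟨ lookup-scale w (ev h x ^ d) (evs π x) j ⟩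
      (ev h x ^ d) ^ lookup w j * lookup (evs π x) j ≡⟨ cong ((ev h x ^ d) ^ lookup w j *_) (lookup-evs π x j) ⟩
      (ev h x ^ d) ^ lookup w j * ev (lookup π j) x ∎

    ev-π∘gᵢ : ∀ x → ev (substₚ (lookup π i) g) (evs π x) ≡ ev h x ^ d * ev (lookup π i) x
    ev-π∘gᵢ x = trans (ev-π∘g x i) (cong (_* ev (lookup π i) x)
      (trans (cong ((ev h x ^ d) ^_) wᵢ≡1) (ℚ.*-identityʳ (ev h x ^ d))))

    ev-varᵢ : ∀ x → ev (var i) (evs π x) ≡ ev (lookup π i) x
    ev-varᵢ x = trans (ev-var i (evs π x)) (lookup-evs π x i)

    varᵢ∉V : var i ∉ ideal V
    varᵢ∉V var∈V = πᵢ≉0 (ev⇒≈0 (lookup π i) λ x → trans (sym (ev-varᵢ x)) (∈ideal⁻ var∈V x))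

    g₁∉V : lookup g (suc zero) ∉ ideal V
    g₁∉V g₁∈V = *-nonzero h≢0 ℚ.1≢0 (trans (sym (ev-g₁ (s₀ ∷ 1ℚ ∷ []))) (∈ideal⁻ g₁∈V (s₀ ∷ 1ℚ ∷ [])))

  -- The ideal of V is the ideal of the image of ℙ¹ under π.
  isVariety : IsVariety V
  isVariety = isVariety-resp
    (λ {p} p∈ → ∈ideal⁺ λ x → trans (sym (ev-subst p π x)) (≈0⇒ev (substₚ p π) (∈ℙ¹⁻ (substₚ p π) p∈) x))
    (λ {p} p∈V → ∈ℙ¹⁺ (substₚ p π) (ev⇒≈0 (substₚ p π) λ x → trans (ev-subst p π x) (∈ideal⁻ p∈V x)))
    (image-isVariety π ℙ¹-isVariety w>0 π-forms (i , λ πᵢ∈ → πᵢ≉0 (∈ℙ¹⁻ (lookup π i) πᵢ∈)))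

  parametrization : IsRationalMap ℙ¹ V π
  parametrization = record
    { degree    = d
    ; positive  = ℕ.>-nonZero (ℕ.>-nonZero⁻¹ d)
    ; isForm    = λ j → isForm⇒homogeneous {w = w₁₁} (AreForms.form π-forms j)
    ; isDefined = i , λ πᵢ∈ → πᵢ≉0 (∈ℙ¹⁻ (lookup π i) πᵢ∈)
    ; intoW     = λ {p} p∈V → ∈ℙ¹⁺ (substₚ p π) (ev⇒≈0 (substₚ p π) λ x → trans (ev-subst p π x) (∈ideal⁻ p∈V x))
    }

  projection : IsRationalMap V ℙ¹ g
  projection = record
    { degree    = e
    ; positive  = ℕ.>-nonZero (ℕ.>-nonZero⁻¹ e)
    ; isForm    = λ j → isForm⇒homogeneous {w = w} (AreForms.form g-forms j)
    ; isDefined = suc zero , g₁∉V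
    ; intoW     = λ {p} p∈ → ∈ideal⁺ λ x → trans (ev-subst p g (evs π x)) (≈0⇒ev p (∈ℙ¹⁻ p p∈) (evs g (evs π x)))
    }

  -- On V the maps π ∘ g and id differ by the factor h^d, which is the value
  -- of the quotient of (π ∘ g)ᵢ by the variable xᵢ.
  π∘g-sameMap : SameMap V w (π ∘ₘ g) vars
  π∘g-sameMap = substₚ (lookup π i) g , var i ,
    (_ , isForm⇒homogeneous {w = w} (isForm-subst g-forms (AreForms.form π-forms i))) ,
    (_ , isForm⇒homogeneous {w = w} (isForm-var w i)) ,
    (λ a∈V → πᵢ≉0 (≈0-on-dense (lookup π i) h h≉0 λ x hx≢0 →
      [ (λ hx^d≡0 → contradiction hx^d≡0 (^-nonzero d hx≢0)) , id ]′
        (ℚ-integral (ev h x ^ d) (ev (lookup π i) x) (trans (sym (ev-π∘gᵢ x)) (∈ideal⁻ a∈V x))))) ,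
    varᵢ∉V ,
    λ j → ∈ideal⁺ λ x → let wⱼ = lookup w j ; H = ev h x ^ d ; πᵢ = ev (lookup π i) x ; πⱼ = ev (lookup π j) x in begin
      ev (var i ^ₚ wⱼ *ₚ lookup (π ∘ₘ g) j -ₚ substₚ (lookup π i) g ^ₚ wⱼ *ₚ lookup vars j) (evs π x)
        ≡⟨ trans (ev-minus (var i ^ₚ wⱼ *ₚ lookup (π ∘ₘ g) j) (substₚ (lookup π i) g ^ₚ wⱼ *ₚ lookup vars j) (evs π x))
             (cong₂ _-_ (ev-* (var i ^ₚ wⱼ) (lookup (π ∘ₘ g) j) (evs π x))
                        (ev-* (substₚ (lookup π i) g ^ₚ wⱼ) (lookup vars j) (evs π x))) ⟩
      ev (var i ^ₚ wⱼ) (evs π x) * ev (lookup (π ∘ₘ g) j) (evs π x) -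
      ev (substₚ (lookup π i) g ^ₚ wⱼ) (evs π x) * ev (lookup vars j) (evs π x)
        ≡⟨ cong₂ _-_
             (cong₂ _*_ (trans (ev-^ (var i) wⱼ (evs π x)) (cong (_^ wⱼ) (ev-varᵢ x)))
                        (trans (cong (λ p → ev p (evs π x)) (Vec.lookup-map j (λ p → substₚ p g) π)) (ev-π∘g x j)))
             (cong₂ _*_ (trans (ev-^ (substₚ (lookup π i) g) wⱼ (evs π x)) (cong (_^ wⱼ) (ev-π∘gᵢ x)))
                        (trans (cong (λ p → ev p (evs π x)) (Vec.lookup∘tabulate var j))
                               (trans (ev-var j (evs π x)) (lookup-evs π x j)))) ⟩
      πᵢ ^ wⱼ * (H ^ wⱼ * πⱼ) - (H * πᵢ) ^ wⱼ * πⱼ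
        ≡⟨ cong (λ y → πᵢ ^ wⱼ * (H ^ wⱼ * πⱼ) - y * πⱼ) (^-distrib-* H πᵢ wⱼ) ⟩
      πᵢ ^ wⱼ * (H ^ wⱼ * πⱼ) - H ^ wⱼ * πᵢ ^ wⱼ * πⱼ
        ≡⟨ lemma (πᵢ ^ wⱼ) (H ^ wⱼ) πⱼ ⟩
      0ℚ ∎
    where
    lemma : ∀ a b c → a * (b * c) - b * a * c ≡ 0ℚ
    lemma = solve-∀ ℚ-ring

  g∘π-sameMap : SameMap ℙ¹ w₁₁ (g ∘ₘ π) vars
  g∘π-sameMap = h , 1ₚ ,
    (c , isForm⇒homogeneous {w = w₁₁} h-form) , (0 , isForm⇒homogeneous {w = w₁₁} (isForm-const w₁₁ 1ℚ)) ,
    (λ h∈ → h≉0 (∈ℙ¹⁻ h h∈)) , (IsVariety.proper ℙ¹-isVariety) ,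
    λ j → ∈ℙ¹⁺ (F j) (ev⇒≈0 (F j) λ x → let k = lookup w₁₁ j in begin
      ev (F j) x
        ≡⟨ trans (ev-minus (1ₚ ^ₚ k *ₚ lookup (g ∘ₘ π) j) (h ^ₚ k *ₚ lookup vars j) x)
             (cong₂ _-_ (ev-* (1ₚ ^ₚ k) (lookup (g ∘ₘ π) j) x) (ev-* (h ^ₚ k) (lookup vars j) x)) ⟩
      ev (1ₚ ^ₚ k) x * ev (lookup (g ∘ₘ π) j) x - ev (h ^ₚ k) x * ev (lookup vars j) x
        ≡⟨ cong₂ _-_
             (cong₂ _*_ (trans (ev-^ 1ₚ k x) (trans (cong (_^ k) (ev-const 1ℚ x)) (^-one k)))
                        (trans (cong (λ p → ev p x) (Vec.lookup-map j (λ p → substₚ p π) g))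
                               (trans (ev-subst (lookup g j) π x) (ev-g x j))))
             (cong₂ _*_ (ev-^ h k x)
                        (trans (cong (λ p → ev p x) (Vec.lookup∘tabulate var j)) (ev-var j x))) ⟩
      1ℚ * (ev h x ^ k * lookup x j) - ev h x ^ k * lookup x j
        ≡⟨ lemma (ev h x ^ k * lookup x j) ⟩
      0ℚ ∎)
    where
    F : Fin 2 → Poly 2
    F j = 1ₚ ^ₚ lookup w₁₁ j *ₚ lookup (g ∘ₘ π) j -ₚ h ^ₚ lookup w₁₁ j *ₚ lookup vars j
    lemma : ∀ a → 1ℚ * a - a ≡ 0ℚ
    lemma = solve-∀ ℚ-ring

  birational : BirationallyEquivalent V ℙ¹
  birational = g , isVariety , ℙ¹-isVariety , projection , π , parametrization , π∘g-sameMap , g∘π-sameMap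

  -- The coordinate s/t of the point (s : t) of ℙ¹, as a function on V.
  φ : Fraction n
  φ = lookup g zero /ₚ lookup g (suc zero)

  φ-isRationalFunction : IsRationalFunction V φ
  φ-isRationalFunction =
    (e ℕ.* 1 , isForm⇒homogeneous {w = w} (AreForms.form g-forms zero) , isForm⇒homogeneous {w = w} (AreForms.form g-forms (suc zero))) ,
    g₁∉V

  private
    φ-hasValue : ∀ s {t} → t ≢ 0ℚ → ev h (s * t ∷ t ∷ []) ≢ 0ℚ → HasValue (evs π (s * t ∷ t ∷ [])) φ s
    φ-hasValue s {t} t≢0 h≢0 = hasValue
      (λ eq → *-nonzero h≢0 t≢0 (trans (sym (ev-g₁ (s * t ∷ t ∷ []))) eq))
      (trans (ev-g₀ (s * t ∷ t ∷ []))
        (trans (lemma (ev h (s * t ∷ t ∷ [])) s t) (cong (s *_) (sym (ev-g₁ (s * t ∷ t ∷ []))))))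
      where
      lemma : ∀ h s t → h * (s * t) ≡ s * (h * t)
      lemma = solve-∀ ℚ-ring

    vanish : ∀ {k} {R : Poly k} {φs qs} x → IsRelation V R φs → HaveValues (evs π x) φs qs → ev R qs ≡ 0ℚ
    vanish {R = R} {φs} {qs} x R∈ vs with eval-hasValue V (evs π x) R vs
    ... | hasValue den≢0 num≡ = [ id , (λ den≡0 → contradiction den≡0 den≢0) ]′ (ℚ-integral _ _
      (trans (sym num≡) (trans (sym (num-zero V (evs π x) (Evaluation.eval (fractionRing V) (λ c → const c /ₚ 1ₚ) R φs) refl))
                               (∈ideal⁻ R∈ x))))

  -- A relation R(φ) = 0 gives R(s) = 0 for all s with h(s,1) ≠ 0.
  φ-independent : AlgebraicallyIndependent V (φ ∷ [])
  φ-independent R R∈ = ≈0-on-dense R h₁ (≉0 h₁ (s₀ ∷ []) λ eq → h≢0 (trans (sym (ev-h₁ s₀)) eq))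
    λ { (s ∷ []) h₁≢0 → vanish {R = R} (s * 1ℚ ∷ 1ℚ ∷ []) R∈
          (φ-hasValue s ℚ.1≢0 (λ eq → h₁≢0 (trans (ev-h₁ s) (trans (cong (λ s → ev h (s ∷ 1ℚ ∷ [])) (sym (ℚ.*-identityʳ s))) eq))) ∷ []) }
    where
    h₁ : Poly 1
    h₁ = substₚ h (var zero ∷ 1ₚ ∷ [])
    ev-h₁ : ∀ s → ev h₁ (s ∷ []) ≡ ev h (s ∷ 1ℚ ∷ [])
    ev-h₁ s = trans (ev-subst h (var zero ∷ 1ₚ ∷ []) (s ∷ []))
      (cong₂ (λ a b → ev h (a ∷ b ∷ [])) (ev-var zero (s ∷ [])) (ev-const 1ℚ (s ∷ [])))

  -- If ψ is a(s,t)/b(s,t) on the curve, then Y = ψ and S = s/t satisfy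
  -- Y·b(S,1) = a(S,1).
  φ-maximal : ∀ ψ → IsRationalFunction V ψ → AlgebraicallyDependent V (ψ ∷ φ ∷ [])
  φ-maximal (a /ₚ b) ((deg , a-hom , b-hom) , b∉V) = R , R≉0 , ∈ideal⁺ relation
    where
    dehomogenize : Poly n → Poly 2
    dehomogenize p = substₚ (substₚ p π) (var (suc zero) ∷ 1ₚ ∷ [])
    R : Poly 2
    R = dehomogenize b *ₚ var zero -ₚ dehomogenize a
    ev-dehomogenize : ∀ p y s → ev (dehomogenize p) (y ∷ s ∷ []) ≡ ev p (evs π (s ∷ 1ℚ ∷ []))
    ev-dehomogenize p y s = trans (ev-subst (substₚ p π) (var (suc zero) ∷ 1ₚ ∷ []) (y ∷ s ∷ []))
      (trans (cong₂ (λ a b → ev (substₚ p π) (a ∷ b ∷ [])) (ev-var (suc zero) (y ∷ s ∷ [])) (ev-const 1ℚ (y ∷ s ∷ [])))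
             (ev-subst p π (s ∷ 1ℚ ∷ [])))
    ev-R : ∀ y s → ev R (y ∷ s ∷ []) ≡ ev b (evs π (s ∷ 1ℚ ∷ [])) * y - ev a (evs π (s ∷ 1ℚ ∷ []))
    ev-R y s = trans (ev-minus (dehomogenize b *ₚ var zero) (dehomogenize a) (y ∷ s ∷ []))
      (cong₂ _-_ (trans (ev-* (dehomogenize b) (var zero) (y ∷ s ∷ []))
                        (cong₂ _*_ (ev-dehomogenize b y s) (ev-var zero (y ∷ s ∷ []))))
                 (ev-dehomogenize a y s))
    -- The value of a form at (s t, t) in terms of the value at (s, 1).
    homogeneity : ∀ {p} → Homogeneous w deg p → ∀ s t →
                  ev p (evs π (s * t ∷ t ∷ [])) ≡ (t ^ d) ^ deg * ev p (evs π (s ∷ 1ℚ ∷ []))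
    homogeneity {p} hom s t = begin
      ev p (evs π (s * t ∷ t ∷ []))                     ≡⟨ cong₂ (λ a b → ev p (evs π (a ∷ b ∷ []))) (lemma s t) (lemma′ t) ⟩
      ev p (evs π (scale w₁₁ t (s ∷ 1ℚ ∷ [])))          ≡⟨ cong (ev p) (evs-scale π-forms t (s ∷ 1ℚ ∷ [])) ⟩
      ev p (scale w (t ^ d) (evs π (s ∷ 1ℚ ∷ [])))      ≡⟨ ev-scale {w = w} p hom (t ^ d) (evs π (s ∷ 1ℚ ∷ [])) ⟩
      (t ^ d) ^ deg * ev p (evs π (s ∷ 1ℚ ∷ []))        ∎
      where
      lemma : ∀ s t → s * t ≡ t * 1ℚ * s
      lemma = solve-∀ ℚ-ring
      lemma′ : ∀ t → t ≡ t * 1ℚ * 1ℚ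
      lemma′ = solve-∀ ℚ-ring
    t≉0 : var {2} (suc zero) ≉ 0ₚ
    t≉0 = ≉0 (var (suc zero)) (0ℚ ∷ 1ℚ ∷ []) ℚ.1≢0
    b∘π≉0 : substₚ b π ≉ 0ₚ
    b∘π≉0 b∘π≈0 = b∉V (∈ideal⁺ λ x → trans (sym (ev-subst b π x)) (≈0⇒ev (substₚ b π) b∘π≈0 x))
    R≉0 : R ≉ 0ₚ
    R≉0 R≈0 = b∘π≉0 (≈0-on-dense (substₚ b π) (var (suc zero)) t≉0 b∘π≡0)
      where
      b≡0 : ∀ s → ev b (evs π (s ∷ 1ℚ ∷ [])) ≡ 0ℚ
      b≡0 s = begin
        B                                       ≡⟨ lemma A B ⟩
        (B * 1ℚ - A) - (B * 0ℚ - A)             ≡⟨ cong₂ _-_ (ev-R 1ℚ s) (ev-R 0ℚ s) ⟨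
        ev R (1ℚ ∷ s ∷ []) - ev R (0ℚ ∷ s ∷ []) ≡⟨ cong₂ _-_ (≈0⇒ev R R≈0 (1ℚ ∷ s ∷ [])) (≈0⇒ev R R≈0 (0ℚ ∷ s ∷ [])) ⟩
        0ℚ                                      ∎
        where
        A = ev a (evs π (s ∷ 1ℚ ∷ []))
        B = ev b (evs π (s ∷ 1ℚ ∷ []))
        lemma : ∀ A B → B ≡ (B * 1ℚ - A) - (B * 0ℚ - A)
        lemma = solve-∀ ℚ-ring
      b∘π≡0 : ∀ x → ev (var (suc zero)) x ≢ 0ℚ → ev (substₚ b π) x ≡ 0ℚ
      b∘π≡0 (s ∷ t ∷ []) t≢0 with divides-by s {t} (λ eq → t≢0 (trans (ev-var (suc zero) (s ∷ t ∷ [])) eq))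
      ... | σ , refl = trans (ev-subst b π (σ * t ∷ t ∷ [])) (trans (homogeneity {b} b-hom σ t)
        (trans (cong ((t ^ d) ^ deg *_) (b≡0 σ)) (ℚ.*-zeroʳ ((t ^ d) ^ deg))))
    Rψφ : Fraction n
    Rψφ = Evaluation.eval (fractionRing V) (λ c → const c /ₚ 1ₚ) R ((a /ₚ b) ∷ φ ∷ [])
    N : Poly n
    N = num Rψφ *ₚ 1ₚ -ₚ 0ₚ *ₚ den Rψφ
    -- Where t, h and b do not vanish, the functions have values.
    N≡0 : ∀ s t → t ≢ 0ℚ → ev h (s ∷ t ∷ []) ≢ 0ℚ → ev b (evs π (s ∷ t ∷ [])) ≢ 0ℚ → ev N (evs π (s ∷ t ∷ [])) ≡ 0ℚ
    N≡0 s t t≢0 h≢0 b≢0 with divides-by s t≢0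
    ... | σ , refl with divides-by (ev a (evs π (σ * t ∷ t ∷ []))) b≢0
    ...   | q , a≡qb = begin
      ev N (evs π x)                           ≡⟨ num-zero V (evs π x) Rψφ refl ⟩
      ev (num Rψφ) (evs π x)                   ≡⟨ HasValue.value-≡ Rψφ-value ⟩
      ev R (q ∷ σ ∷ []) * ev (den Rψφ) (evs π x) ≡⟨ cong (_* ev (den Rψφ) (evs π x)) (trans (ev-R q σ) R≡0) ⟩
      0ℚ * ev (den Rψφ) (evs π x)              ≡⟨ ℚ.*-zeroˡ (ev (den Rψφ) (evs π x)) ⟩
      0ℚ                                       ∎
      where
      x = σ * t ∷ t ∷ []
      A = ev a (evs π (σ ∷ 1ℚ ∷ []))
      B = ev b (evs π (σ ∷ 1ℚ ∷ []))
      T = (t ^ d) ^ deg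
      Rψφ-value : HasValue (evs π x) Rψφ (ev R (q ∷ σ ∷ []))
      Rψφ-value = eval-hasValue V (evs π x) R (hasValue b≢0 a≡qb ∷ φ-hasValue σ t≢0 h≢0 ∷ [])
      lemma : ∀ T A B q → T * (B * q - A) ≡ q * (T * B) - T * A
      lemma = solve-∀ ℚ-ring
      R≡0 : B * q - A ≡ 0ℚ
      R≡0 = [ (λ T≡0 → contradiction T≡0 (^-nonzero deg (^-nonzero d t≢0))) , id ]′ (ℚ-integral T (B * q - A) (begin
        T * (B * q - A)                        ≡⟨ lemma T A B q ⟩
        q * (T * B) - T * A                    ≡⟨ cong₂ (λ y z → q * y - z) (homogeneity {b} b-hom σ t) (homogeneity {a} a-hom σ t) ⟨
        q * ev b (evs π x) - ev a (evs π x)    ≡⟨ ≡⇒-≡0 (sym a≡qb) ⟩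
        0ℚ                                     ∎))
    relation : ∀ x → ev N (evs π x) ≡ 0ℚ
    relation x = trans (sym (ev-subst N π x)) (≈0⇒ev (substₚ N π) (≈0-on-dense (substₚ N π) (var (suc zero) *ₚ (h *ₚ substₚ b π))
      (*-≉0 (var (suc zero)) (h *ₚ substₚ b π) t≉0 (*-≉0 h (substₚ b π) h≉0 b∘π≉0)) λ
        { x@(s ∷ t ∷ []) ≢0 → trans (ev-subst N π x) (N≡0 s t
            (λ t≡0 → ≢0 (trans (ev-* (var (suc zero)) (h *ₚ substₚ b π) x) (trans (cong (_* ev (h *ₚ substₚ b π) x) (trans (ev-var (suc zero) x) t≡0)) (ℚ.*-zeroˡ (ev (h *ₚ substₚ b π) x)))))
            (λ h≡0 → ≢0 (factor x (trans (cong (_* ev (substₚ b π) x) h≡0) (ℚ.*-zeroˡ (ev (substₚ b π) x)))))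
            (λ b≡0 → ≢0 (factor x (trans (cong (ev h x *_) (trans (ev-subst b π x) b≡0)) (ℚ.*-zeroʳ (ev h x)))))) }) x)
      where
      factor : ∀ x → ev h x * ev (substₚ b π) x ≡ 0ℚ → ev (var (suc zero) *ₚ (h *ₚ substₚ b π)) x ≡ 0ℚ
      factor x eq = trans (ev-* (var (suc zero)) (h *ₚ substₚ b π) x)
        (trans (cong (ev (var (suc zero)) x *_) (trans (ev-* h (substₚ b π) x) eq)) (ℚ.*-zeroʳ (ev (var (suc zero)) x)))

  isCurve : IsCurve V
  isCurve = isVariety , φ ∷ [] , φ-isRationalFunction ∷ [] , φ-independent , φ-maximal

  not-isPoint : ¬ IsPoint V
  not-isPoint (_ , [] , _ , _ , maximal) = let R , R≉0 , R∈ = maximal φ φ-isRationalFunction in R≉0 (φ-independent R R∈)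

-- Division by a quadratic polynomial in the first variable

-- p as a polynomial that does not involve the first of the n + 1 variables.
weaken : Poly n → Poly (suc n)
weaken = List.map λ (c , e) → c , 0 ∷ e

ev-weaken : ∀ (p : Poly n) u v → ev (weaken p) (u ∷ v) ≡ ev p v
ev-weaken []            u v = refl
ev-weaken ((c , e) ∷ p) u v = cong₂ _+_ (cong (c *_) (ℚ.*-identityˡ (mono e v))) (ev-weaken p u v)

-- L^k·G = A + B·u + Q·(L·u² - N), where u is the first variable and does
-- not occur in L, N, A and B.
record Division (L N : Poly n) (G : Poly (suc n)) : Set where
  field
    exponent : ℕ
    A B      : Poly n
    Q        : Poly (suc n)
    division : ∀ u v → ev L v ^ exponent * ev G (u ∷ v) ≡
                       ev A v + ev B v * u + ev Q (u ∷ v) * (ev L v * (u * u) - ev N v)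

-- For a product, L·(A + B·u)·(A′ + B′·u) contains L·B·B′·u², which is replaced
-- by N·B·B′.
divide : ∀ (L N : Poly n) G → Division L N G
divide {n} L N = poly-induction (Division L N) divide-const divide-var divide-+ divide-*
  λ eq D → record { Division D; division = λ u v → trans (cong (ev L v ^ Division.exponent D *_) (sym (eq (u ∷ v)))) (Division.division D u v) }
  where
  open ≡-Reasoning
  divide-const : ∀ c → Division L N (const c)
  divide-const c = record
    { exponent = 0 ; A = const c ; B = 0ₚ ; Q = 0ₚ
    ; division = λ u v → trans (cong (1ℚ *_) (ev-const c (u ∷ v)))
        (trans (lemma c u (ev L v) (ev N v)) (cong (λ a → a + 0ℚ * u + 0ℚ * (ev L v * (u * u) - ev N v)) (sym (ev-const c v))))
    }
    where
    lemma : ∀ c u L N → 1ℚ * c ≡ c + 0ℚ * u + 0ℚ * (L * (u * u) - N)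
    lemma = solve-∀ ℚ-ring
  divide-var : ∀ i → Division L N (var i)
  divide-var zero = record
    { exponent = 0 ; A = 0ₚ ; B = 1ₚ ; Q = 0ₚ
    ; division = λ u v → trans (cong (1ℚ *_) (ev-var zero (u ∷ v)))
        (trans (lemma u (ev L v) (ev N v)) (cong (λ b → 0ℚ + b * u + 0ℚ * (ev L v * (u * u) - ev N v)) (sym (ev-const 1ℚ v))))
    }
    where
    lemma : ∀ u L N → 1ℚ * u ≡ 0ℚ + 1ℚ * u + 0ℚ * (L * (u * u) - N)
    lemma = solve-∀ ℚ-ring
  divide-var (suc i) = record
    { exponent = 0 ; A = var i ; B = 0ₚ ; Q = 0ₚ
    ; division = λ u v → trans (cong (1ℚ *_) (trans (ev-var (suc i) (u ∷ v)) (sym (ev-var i v)))) (lemma (ev (var i) v) u (ev L v) (ev N v))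
    }
    where
    lemma : ∀ a u L N → 1ℚ * a ≡ a + 0ℚ * u + 0ℚ * (L * (u * u) - N)
    lemma = solve-∀ ℚ-ring
  divide-+ : ∀ {G H} → Division L N G → Division L N H → Division L N (G +ₚ H)
  divide-+ {G} {H} D E = record
    { exponent = D.exponent ℕ.+ E.exponent
    ; A = toPoly (sum D.A E.A) ; B = toPoly (sum D.B E.B) ; Q = toPoly Q
    ; division = λ u v → let x = u ∷ v ; Lᵈ = ev L v ^ D.exponent ; Lᵉ = ev L v ^ E.exponent ; t = ev L v * (u * u) - ev N v in begin
        ev L v ^ (D.exponent ℕ.+ E.exponent) * ev (G +ₚ H) x
          ≡⟨ cong₂ _*_ (^-homo-* (ev L v) D.exponent E.exponent) (ev-+ G H x) ⟩
        Lᵈ * Lᵉ * (ev G x + ev H x)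
          ≡⟨ lemma₁ Lᵈ Lᵉ (ev G x) (ev H x) ⟩
        Lᵉ * (Lᵈ * ev G x) + Lᵈ * (Lᵉ * ev H x)
          ≡⟨ cong₂ (λ a b → Lᵉ * a + Lᵈ * b) (D.division u v) (E.division u v) ⟩
        Lᵉ * (ev D.A v + ev D.B v * u + ev D.Q x * t) + Lᵈ * (ev E.A v + ev E.B v * u + ev E.Q x * t)
          ≡⟨ lemma₂ Lᵉ Lᵈ (ev D.A v) (ev D.B v) (ev D.Q x) (ev E.A v) (ev E.B v) (ev E.Q x) u t ⟩
        (Lᵉ * ev D.A v + Lᵈ * ev E.A v) + (Lᵉ * ev D.B v + Lᵈ * ev E.B v) * u + (Lᵉ * ev D.Q x + Lᵈ * ev E.Q x) * t
          ≡⟨ cong₂ (λ a b → a + b * t)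
               (cong₂ (λ a b → a + b * u) (ev-toPoly (sum D.A E.A) v) (ev-toPoly (sum D.B E.B) v))
               (trans (ev-toPoly Q x) (cong (λ a → a ^ E.exponent * ev D.Q x + a ^ D.exponent * ev E.Q x) (ev-weaken L u v))) ⟨
        ev (toPoly (sum D.A E.A)) v + ev (toPoly (sum D.B E.B)) v * u + ev (toPoly Q) x * t ∎
    }
    where
    module D = Division D
    module E = Division E
    sum : Poly n → Poly n → Expr n
    sum a b = :poly L :^ E.exponent :* :poly a :+ :poly L :^ D.exponent :* :poly b
    Q : Expr (suc n)
    Q = :poly (weaken L) :^ E.exponent :* :poly D.Q :+ :poly (weaken L) :^ D.exponent :* :poly E.Q
    lemma₁ : ∀ a b g h → a * b * (g + h) ≡ b * (a * g) + a * (b * h)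
    lemma₁ = solve-∀ ℚ-ring
    lemma₂ : ∀ l k a b q a′ b′ q′ u t → l * (a + b * u + q * t) + k * (a′ + b′ * u + q′ * t) ≡
             (l * a + k * a′) + (l * b + k * b′) * u + (l * q + k * q′) * t
    lemma₂ = solve-∀ ℚ-ring
  divide-* : ∀ {G H} → Division L N G → Division L N H → Division L N (G *ₚ H)
  divide-* {G} {H} D E = record
    { exponent = suc (D.exponent ℕ.+ E.exponent)
    ; A = toPoly A ; B = toPoly B ; Q = toPoly Q
    ; division = λ u v → let x = u ∷ v ; Lᵈ = ev L v ^ D.exponent ; Lᵉ = ev L v ^ E.exponent ; t = ev L v * (u * u) - ev N v in begin
        ev L v * ev L v ^ (D.exponent ℕ.+ E.exponent) * ev (G *ₚ H) x
          ≡⟨ cong₂ (λ a b → ev L v * a * b) (^-homo-* (ev L v) D.exponent E.exponent) (ev-* G H x) ⟩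
        ev L v * (Lᵈ * Lᵉ) * (ev G x * ev H x)
          ≡⟨ lemma₁ (ev L v) Lᵈ Lᵉ (ev G x) (ev H x) ⟩
        ev L v * ((Lᵈ * ev G x) * (Lᵉ * ev H x))
          ≡⟨ cong₂ (λ a b → ev L v * (a * b)) (D.division u v) (E.division u v) ⟩
        ev L v * ((ev D.A v + ev D.B v * u + ev D.Q x * t) * (ev E.A v + ev E.B v * u + ev E.Q x * t))
          ≡⟨ lemma₂ (ev L v) (ev N v) (ev D.A v) (ev D.B v) (ev D.Q x) (ev E.A v) (ev E.B v) (ev E.Q x) u ⟩
        value A v + value B v * u + quotientValue (ev L v) (ev N v) (ev D.A v) (ev D.B v) (ev D.Q x) (ev E.A v) (ev E.B v) (ev E.Q x) u * t
          ≡⟨ cong₂ (λ a b → a + b * t)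
               (cong₂ (λ a b → a + b * u) (ev-toPoly A v) (ev-toPoly B v))
               (trans (ev-toPoly Q x) (weakened u v (ev D.Q x) (ev E.Q x))) ⟨
        ev (toPoly A) v + ev (toPoly B) v * u + ev (toPoly Q) x * t ∎
    }
    where
    module D = Division D
    module E = Division E
    A B : Expr n
    A = :poly L :* (:poly D.A :* :poly E.A) :+ :poly N :* (:poly D.B :* :poly E.B)
    B = :poly L :* (:poly D.A :* :poly E.B :+ :poly E.A :* :poly D.B)
    quotientValue : (L N a b q a′ b′ q′ u : ℚ) → ℚ
    quotientValue L N a b q a′ b′ q′ u =
      L * (q * (a′ + b′ * u) + q′ * (a + b * u) + q * q′ * (L * (u * u) - N)) + b * b′
    Q : Expr (suc n)
    Q = :poly (weaken L) :* (:poly D.Q :* (:poly (weaken E.A) :+ :poly (weaken E.B) :* :var zero) :+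
          :poly E.Q :* (:poly (weaken D.A) :+ :poly (weaken D.B) :* :var zero) :+
          :poly D.Q :* :poly E.Q :* (:poly (weaken L) :* (:var zero :* :var zero) :- :poly (weaken N))) :+
        :poly (weaken D.B) :* :poly (weaken E.B)
    weakened : ∀ u v q q′ →
      quotientValue (ev (weaken L) (u ∷ v)) (ev (weaken N) (u ∷ v)) (ev (weaken D.A) (u ∷ v)) (ev (weaken D.B) (u ∷ v)) q
                    (ev (weaken E.A) (u ∷ v)) (ev (weaken E.B) (u ∷ v)) q′ u ≡
      quotientValue (ev L v) (ev N v) (ev D.A v) (ev D.B v) q (ev E.A v) (ev E.B v) q′ u
    weakened u v q q′
      rewrite ev-weaken L u v | ev-weaken N u v | ev-weaken D.A u v | ev-weaken D.B u v
            | ev-weaken E.A u v | ev-weaken E.B u v = refl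
    lemma₁ : ∀ l a b g h → l * (a * b) * (g * h) ≡ l * ((a * g) * (b * h))
    lemma₁ = solve-∀ ℚ-ring
    lemma₂ : ∀ L N a b q a′ b′ q′ u →
             L * ((a + b * u + q * (L * (u * u) - N)) * (a′ + b′ * u + q′ * (L * (u * u) - N))) ≡
             (L * (a * a′) + N * (b * b′)) + (L * (a * b′ + a′ * b)) * u +
             (L * (q * (a′ + b′ * u) + q′ * (a + b * u) + q * q′ * (L * (u * u) - N)) + b * b′) * (L * (u * u) - N)
    lemma₂ = solve-∀ ℚ-ring

-- A polynomial of degree at most one in u that is a multiple of the monic
-- polynomial u² - D vanishes. Setting u = 0 and dividing by u gives the same
-- statement for high Q.
remainder-unique : ∀ b (D : Poly n) Q → HeadDegree< b Q → ∀ A B →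
                   (∀ u v → ev Q (u ∷ v) * (u * u - ev D v) ≡ ev A v + ev B v * u) →
                   (∀ v → ev A v ≡ 0ℚ) × (∀ v → ev B v ≡ 0ℚ)
remainder-unique zero    D []      []       A B eq = A≡0 , B≡0
  where
  open ≡-Reasoning
  linear : ∀ u v → 0ℚ ≡ ev A v + ev B v * u
  linear u v = trans (sym (ℚ.*-zeroˡ (u * u - ev D v))) (eq u v)
  A≡0 : ∀ v → ev A v ≡ 0ℚ
  A≡0 v = begin
    ev A v                 ≡⟨ lemma (ev A v) (ev B v) ⟩
    ev A v + ev B v * 0ℚ   ≡⟨ linear 0ℚ v ⟨
    0ℚ                     ∎
    where
    lemma : ∀ a b → a ≡ a + b * 0ℚ
    lemma = solve-∀ ℚ-ring
  B≡0 : ∀ v → ev B v ≡ 0ℚ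
  B≡0 v = begin
    ev B v                           ≡⟨ lemma (ev A v) (ev B v) ⟩
    (ev A v + ev B v * 1ℚ) - ev A v  ≡⟨ cong₂ _-_ (sym (linear 1ℚ v)) (A≡0 v) ⟩
    0ℚ                               ∎
    where
    lemma : ∀ a b → b ≡ (a + b * 1ℚ) - a
    lemma = solve-∀ ℚ-ring
remainder-unique zero    D (_ ∷ _) (() ∷ _) A B eq
remainder-unique {n} (suc b) D Q       bound    A B eq = A≡0 , proj₁ ih
  where
  open ≡-Reasoning
  minusLow : Poly n
  minusLow = -ₚ low Q
  difference : Expr (suc n)
  difference = :poly (high Q) :* (:var zero :* :var zero :- :poly (weaken D)) :- (:poly (weaken B) :+ :poly (weaken minusLow) :* :var zero)
  value-difference : ∀ u v → ev (toPoly difference) (u ∷ v) ≡ ev (high Q) (u ∷ v) * (u * u - ev D v) - (ev B v + ev minusLow v * u)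
  value-difference u v = trans (ev-toPoly difference (u ∷ v))
    (cong₂ (λ d r → ev (high Q) (u ∷ v) * (u * u - d) - r) (ev-weaken D u v)
      (cong₂ (λ b a → b + a * u) (ev-weaken B u v) (ev-weaken minusLow u v)))
  atZero : ∀ v → ev A v ≡ - (ev D v * ev (low Q) v)
  atZero v = begin
    ev A v                                     ≡⟨ lemma₁ (ev A v) (ev B v) ⟩
    ev A v + ev B v * 0ℚ                       ≡⟨ eq 0ℚ v ⟨
    ev Q (0ℚ ∷ v) * (0ℚ * 0ℚ - ev D v)         ≡⟨ cong (_* (0ℚ * 0ℚ - ev D v)) (ev-low-high Q 0ℚ v) ⟩
    (ev (low Q) v + 0ℚ * ev (high Q) (0ℚ ∷ v)) * (0ℚ * 0ℚ - ev D v)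
                                               ≡⟨ lemma₂ (ev (low Q) v) (ev (high Q) (0ℚ ∷ v)) (ev D v) ⟩
    - (ev D v * ev (low Q) v)                  ∎
    where
    lemma₁ : ∀ a b → a ≡ a + b * 0ℚ
    lemma₁ = solve-∀ ℚ-ring
    lemma₂ : ∀ l h d → (l + 0ℚ * h) * (0ℚ * 0ℚ - d) ≡ - (d * l)
    lemma₂ = solve-∀ ℚ-ring
  difference≈0 : toPoly difference ≈ 0ₚ
  difference≈0 = ≈0-on-dense (toPoly difference) (var zero) (≉0 (var zero) (1ℚ ∷ Vec.replicate n 0ℚ) (λ eq → ℚ.1≢0 (trans (sym (ev-var zero (1ℚ ∷ Vec.replicate n 0ℚ))) eq)))
    λ { (u ∷ v) u≢0 → [ (λ u≡0 → contradiction (trans (ev-var zero (u ∷ v)) u≡0) u≢0) , id ]′ (ℚ-integral u _ (begin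
      u * ev (toPoly difference) (u ∷ v)
        ≡⟨ cong (u *_) (trans (value-difference u v) (cong (λ a → ev (high Q) (u ∷ v) * (u * u - ev D v) - (ev B v + a * u)) (ev-neg (low Q) v))) ⟩
      u * (ev (high Q) (u ∷ v) * (u * u - ev D v) - (ev B v + - ev (low Q) v * u))
        ≡⟨ lemma u (ev (high Q) (u ∷ v)) (ev (low Q) v) (ev D v) (ev B v) ⟩
      (ev (low Q) v + u * ev (high Q) (u ∷ v)) * (u * u - ev D v) - (- (ev D v * ev (low Q) v) + ev B v * u)
        ≡⟨ cong₂ (λ q a → q * (u * u - ev D v) - (a + ev B v * u)) (ev-low-high Q u v) (atZero v) ⟨
      ev Q (u ∷ v) * (u * u - ev D v) - (ev A v + ev B v * u)
        ≡⟨ ≡⇒-≡0 (eq u v) ⟩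
      0ℚ ∎)) }
    where
    lemma : ∀ u h l d b → u * (h * (u * u - d) - (b + - l * u)) ≡ (l + u * h) * (u * u - d) - (- (d * l) + b * u)
    lemma = solve-∀ ℚ-ring
  ih = remainder-unique b D (high Q) (high-HeadDegree< Q bound) B minusLow λ u v →
    -≡0⇒≡ (trans (sym (value-difference u v)) (≈0⇒ev (toPoly difference) difference≈0 (u ∷ v)))
  A≡0 : ∀ v → ev A v ≡ 0ℚ
  A≡0 v = begin
    ev A v                         ≡⟨ atZero v ⟩
    - (ev D v * ev (low Q) v)      ≡⟨ lemma (ev D v) (ev (low Q) v) ⟩
    ev D v * (- ev (low Q) v)      ≡⟨ cong (ev D v *_) (trans (sym (ev-neg (low Q) v)) (proj₂ ih v)) ⟩
    ev D v * 0ℚ                    ≡⟨ ℚ.*-zeroʳ (ev D v) ⟩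
    0ℚ                             ∎
    where
    lemma : ∀ d l → - (d * l) ≡ d * (- l)
    lemma = solve-∀ ℚ-ring

-- D is not a square in the field of rational functions: A² = D·B² only for
-- A = B = 0.
IsNonsquare : Poly n → Set
IsNonsquare {n} D = ∀ (A B : Poly n) → (∀ v → ev A v * ev A v ≡ ev D v * (ev B v * ev B v)) →
                    (∀ v → ev A v ≡ 0ℚ) × (∀ v → ev B v ≡ 0ℚ)

-- Where D is not a square, u² - D generates a prime ideal: the norm
-- A² - D·B² of A + B·u is multiplicative.
quadratic-prime : ∀ (D : Poly n) (T : Poly (suc n)) → (∀ u v → ev T (u ∷ v) ≡ u * u - ev D v) → IsNonsquare D →
                  ∀ {G H} → G *ₚ H ∈ ⟨ T ∷ [] ⟩ → G ∈ ⟨ T ∷ [] ⟩ ⊎ H ∈ ⟨ T ∷ [] ⟩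
quadratic-prime {n} D T ev-T nonsquare {G} {H} GH∈ = Sum.map
  (λ norm≈0 → let A≡0 , B≡0 = nonsquare E.A E.B (norm E.A E.B norm≈0) in multiple-of-T G E A≡0 B≡0)
  (λ norm≈0 → let A≡0 , B≡0 = nonsquare F.A F.B (norm F.A F.B norm≈0) in multiple-of-T H F A≡0 B≡0)
  (*-integral (toPoly (normExpr E.A E.B)) (toPoly (normExpr F.A F.B)) norms)
  where
  open ≡-Reasoning
  E = divide 1ₚ D G
  F = divide 1ₚ D H
  module E = Division E
  module F = Division F
  normExpr : Poly n → Poly n → Expr n
  normExpr A B = :poly A :* :poly A :- :poly D :* (:poly B :* :poly B)
  norm : ∀ A B → toPoly (normExpr A B) ≈ 0ₚ → ∀ v → ev A v * ev A v ≡ ev D v * (ev B v * ev B v)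
  norm A B ≈0 v = -≡0⇒≡ (trans (sym (ev-toPoly (normExpr A B) v)) (≈0⇒ev (toPoly (normExpr A B)) ≈0 v))
  divided : ∀ K (E : Division 1ₚ D K) → let open Division E in
            ∀ u v → ev K (u ∷ v) ≡ ev A v + ev B v * u + ev Q (u ∷ v) * (u * u - ev D v)
  divided K E u v = begin
    ev K (u ∷ v)                            ≡⟨ ℚ.*-identityˡ (ev K (u ∷ v)) ⟨
    1ℚ * ev K (u ∷ v)                       ≡⟨ cong (_* ev K (u ∷ v)) (trans (cong (_^ exponent) (ev-const 1ℚ v)) (^-one exponent)) ⟨
    ev 1ₚ v ^ exponent * ev K (u ∷ v)       ≡⟨ division u v ⟩
    ev A v + ev B v * u + ev Q (u ∷ v) * (ev 1ₚ v * (u * u) - ev D v)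
      ≡⟨ cong (λ a → ev A v + ev B v * u + ev Q (u ∷ v) * (a - ev D v)) (trans (cong (_* (u * u)) (ev-const 1ℚ v)) (ℚ.*-identityˡ (u * u))) ⟩
    ev A v + ev B v * u + ev Q (u ∷ v) * (u * u - ev D v) ∎
    where open Division E
  multiple-of-T : ∀ K (E : Division 1ₚ D K) → let open Division E in
                  (∀ v → ev A v ≡ 0ℚ) → (∀ v → ev B v ≡ 0ℚ) → K ∈ ⟨ T ∷ [] ⟩
  multiple-of-T K E A≡0 B≡0 = ∈principal⁺ T K Q λ { (u ∷ v) → begin
    ev K (u ∷ v)                                           ≡⟨ divided K E u v ⟩
    ev A v + ev B v * u + ev Q (u ∷ v) * (u * u - ev D v)  ≡⟨ cong₂ (λ a b → a + b * u + ev Q (u ∷ v) * (u * u - ev D v)) (A≡0 v) (B≡0 v) ⟩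
    0ℚ + 0ℚ * u + ev Q (u ∷ v) * (u * u - ev D v)          ≡⟨ lemma u (ev Q (u ∷ v) * (u * u - ev D v)) ⟩
    ev Q (u ∷ v) * (u * u - ev D v)                        ≡⟨ cong (ev Q (u ∷ v) *_) (ev-T u v) ⟨
    ev Q (u ∷ v) * ev T (u ∷ v)                            ∎ }
    where
    open Division E
    lemma : ∀ u q → 0ℚ + 0ℚ * u + q ≡ q
    lemma = solve-∀ ℚ-ring
  c = proj₁ (∈principal⁻ T (G *ₚ H) GH∈)
  -- The remainder of G·H is R₀ + R₁·u = S·T.
  R₀ R₁ : Expr n
  R₀ = :poly E.A :* :poly F.A :+ :poly D :* (:poly E.B :* :poly F.B)
  R₁ = :poly E.A :* :poly F.B :+ :poly F.A :* :poly E.B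
  S : Expr (suc n)
  S = :poly c :- (:poly E.Q :* :poly H :+ :poly F.Q :* (:poly G :- :poly E.Q :* :poly T) :+ :poly (weaken E.B) :* :poly (weaken F.B))
  remainder : ∀ u v → ev (toPoly S) (u ∷ v) * (u * u - ev D v) ≡ ev (toPoly R₀) v + ev (toPoly R₁) v * u
  remainder u v = begin
    ev (toPoly S) (u ∷ v) * t
      ≡⟨ cong (_* t) (ev-toPoly S (u ∷ v)) ⟩
    (κ - (q * h + q′ * (g - q * ev T (u ∷ v)) + ev (weaken E.B) (u ∷ v) * ev (weaken F.B) (u ∷ v))) * t
      ≡⟨ cong₂ (λ τ β → (κ - (q * h + q′ * (g - q * τ) + β)) * t) (ev-T u v) (cong₂ _*_ (ev-weaken E.B u v) (ev-weaken F.B u v)) ⟩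
    (κ - (q * h + q′ * (g - q * t) + b * b′)) * t
      ≡⟨ lemma₁ κ q h q′ g t (b * b′) ⟩
    κ * t - (q * t * h + q′ * t * (g - q * t) + b * b′ * t)
      ≡⟨ cong (_- (q * t * h + q′ * t * (g - q * t) + b * b′ * t)) Ct≡gh ⟩
    g * h - (q * t * h + q′ * t * (g - q * t) + b * b′ * t)
      ≡⟨ cong₂ (λ g h → g * h - (q * t * h + q′ * t * (g - q * t) + b * b′ * t)) (divided G E u v) (divided H F u v) ⟩
    (a + b * u + q * t) * (a′ + b′ * u + q′ * t) -
      (q * t * (a′ + b′ * u + q′ * t) + q′ * t * (a + b * u + q * t - q * t) + b * b′ * t)
      ≡⟨ lemma₂ a b a′ b′ q q′ u t ⟩
    (a * a′ + (u * u - t) * (b * b′)) + (a * b′ + a′ * b) * u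
      ≡⟨ cong (λ d → (a * a′ + d * (b * b′)) + (a * b′ + a′ * b) * u) (lemma₃ u (ev D v)) ⟩
    (a * a′ + ev D v * (b * b′)) + (a * b′ + a′ * b) * u
      ≡⟨ cong₂ (λ r s → r + s * u) (ev-toPoly R₀ v) (ev-toPoly R₁ v) ⟨
    ev (toPoly R₀) v + ev (toPoly R₁) v * u ∎
    where
    t = u * u - ev D v
    κ = ev c (u ∷ v)
    g = ev G (u ∷ v)
    h = ev H (u ∷ v)
    q = ev E.Q (u ∷ v)
    q′ = ev F.Q (u ∷ v)
    a = ev E.A v
    b = ev E.B v
    a′ = ev F.A v
    b′ = ev F.B v
    Ct≡gh : κ * t ≡ g * h
    Ct≡gh = trans (cong (κ *_) (sym (ev-T u v))) (trans (sym (proj₂ (∈principal⁻ T (G *ₚ H) GH∈) (u ∷ v))) (ev-* G H (u ∷ v)))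
    lemma₁ : ∀ κ q h q′ g t β → (κ - (q * h + q′ * (g - q * t) + β)) * t ≡ κ * t - (q * t * h + q′ * t * (g - q * t) + β * t)
    lemma₁ = solve-∀ ℚ-ring
    lemma₂ : ∀ a b a′ b′ q q′ u t →
      (a + b * u + q * t) * (a′ + b′ * u + q′ * t) -
        (q * t * (a′ + b′ * u + q′ * t) + q′ * t * (a + b * u + q * t - q * t) + b * b′ * t) ≡
      (a * a′ + (u * u - t) * (b * b′)) + (a * b′ + a′ * b) * u
    lemma₂ = solve-∀ ℚ-ring
    lemma₃ : ∀ u d → u * u - (u * u - d) ≡ d
    lemma₃ = solve-∀ ℚ-ring
  remainder≡0 : (∀ v → ev (toPoly R₀) v ≡ 0ℚ) × (∀ v → ev (toPoly R₁) v ≡ 0ℚ)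
  remainder≡0 = let b , bound = headBound (toPoly S) in remainder-unique b D (toPoly S) bound (toPoly R₀) (toPoly R₁) remainder
  norms : ∀ v → ev (toPoly (normExpr E.A E.B)) v * ev (toPoly (normExpr F.A F.B)) v ≡ 0ℚ
  norms v = begin
    ev (toPoly (normExpr E.A E.B)) v * ev (toPoly (normExpr F.A F.B)) v
      ≡⟨ cong₂ _*_ (ev-toPoly (normExpr E.A E.B) v) (ev-toPoly (normExpr F.A F.B) v) ⟩
    value (normExpr E.A E.B) v * value (normExpr F.A F.B) v
      ≡⟨ lemma (ev D v) (ev E.A v) (ev E.B v) (ev F.A v) (ev F.B v) ⟩
    value R₀ v * value R₀ v - ev D v * (value R₁ v * value R₁ v)
      ≡⟨ cong₂ (λ r s → r * r - ev D v * (s * s)) (trans (sym (ev-toPoly R₀ v)) (proj₁ remainder≡0 v)) (trans (sym (ev-toPoly R₁ v)) (proj₂ remainder≡0 v)) ⟩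
    0ℚ * 0ℚ - ev D v * (0ℚ * 0ℚ)
      ≡⟨ lemma₀ (ev D v) ⟩
    0ℚ ∎
    where
    lemma₀ : ∀ d → 0ℚ * 0ℚ - d * (0ℚ * 0ℚ) ≡ 0ℚ
    lemma₀ = solve-∀ ℚ-ring
    lemma : ∀ d a b a′ b′ → (a * a - d * (b * b)) * (a′ * a′ - d * (b′ * b′)) ≡
            (a * a′ + d * (b * b′)) * (a * a′ + d * (b * b′)) - d * ((a * b′ + a′ * b) * (a * b′ + a′ * b))
    lemma = solve-∀ ℚ-ring

-- The polynomial a⁴ + b⁴ + c⁴ is not a square

private
  mod4 : ∀ r s i j → r ℕ.+ i ℕ.* 4 ≡ s ℕ.+ j ℕ.* 4 → r ℕ.% 4 ≡ s ℕ.% 4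
  mod4 r s i j eq = trans (sym (ℕ.[m+kn]%n≡m%n r i 4)) (trans (cong (ℕ._% 4) eq) (ℕ.[m+kn]%n≡m%n s j 4))

  halve : ∀ n → ∃[ h ] (n ≡ 2 ℕ.* h ⊎ n ≡ 1 ℕ.+ 2 ℕ.* h)
  halve zero    = 0 , inj₁ refl
  halve (suc n) with halve n
  ... | h , inj₁ refl = h , inj₂ refl
  ... | h , inj₂ refl = suc h , inj₁ (lemma h)
    where
    lemma : ∀ h → suc (1 ℕ.+ 2 ℕ.* h) ≡ 2 ℕ.* suc h
    lemma = ℕ-Solver.solve-∀

-- Infinite descent: modulo 4 both x and y are even.
x²≡[3+4k]y²⇒y≡0 : ∀ k x y → x ℕ.* x ≡ (3 ℕ.+ 4 ℕ.* k) ℕ.* (y ℕ.* y) → y ≡ 0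
x²≡[3+4k]y²⇒y≡0 k x y = bounded y x y ℕ.≤-refl
  where
  bounded : ∀ b x y → y ℕ.≤ b → x ℕ.* x ≡ (3 ℕ.+ 4 ℕ.* k) ℕ.* (y ℕ.* y) → y ≡ 0
  bounded b x zero    y≤b eq = refl
  bounded (suc b) x y@(suc y′) (ℕ.s≤s y′≤b) eq with halve x | halve y
  ... | i , inj₁ refl | j , inj₁ y≡2j = trans y≡2j (cong (2 ℕ.*_) (bounded b i j (ℕ.≤-trans j≤y′ y′≤b)
          (ℕ.*-cancelʳ-≡ (i ℕ.* i) _ 4 (trans (lemma i) (trans eq (trans (cong (λ y → (3 ℕ.+ 4 ℕ.* k) ℕ.* (y ℕ.* y)) y≡2j) (lemma′ k j)))))))
    where
    lemma : ∀ i → i ℕ.* i ℕ.* 4 ≡ 2 ℕ.* i ℕ.* (2 ℕ.* i)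
    lemma = ℕ-Solver.solve-∀
    lemma′ : ∀ k j → (3 ℕ.+ 4 ℕ.* k) ℕ.* (2 ℕ.* j ℕ.* (2 ℕ.* j)) ≡ (3 ℕ.+ 4 ℕ.* k) ℕ.* (j ℕ.* j) ℕ.* 4
    lemma′ = ℕ-Solver.solve-∀
    j≤y′ : j ℕ.≤ y′
    j≤y′ = ℕ.s≤s⁻¹ (ℕ.*-cancelˡ-< 2 j y (ℕ.≤-trans (ℕ.≤-reflexive (cong suc (sym y≡2j))) (ℕ.m<m+n y ℕ.z<s)))
  ... | i , inj₁ refl | j , inj₂ y≡1+2j = contradiction
          (mod4 0 3 (i ℕ.* i) (k ℕ.+ (3 ℕ.+ 4 ℕ.* k) ℕ.* (j ℕ.* j ℕ.+ j)) (trans (lemma i) (trans eq (trans (cong (λ y → (3 ℕ.+ 4 ℕ.* k) ℕ.* (y ℕ.* y)) y≡1+2j) (lemma′ k j))))) λ ()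
    where
    lemma : ∀ i → 0 ℕ.+ i ℕ.* i ℕ.* 4 ≡ 2 ℕ.* i ℕ.* (2 ℕ.* i)
    lemma = ℕ-Solver.solve-∀
    lemma′ : ∀ k j → (3 ℕ.+ 4 ℕ.* k) ℕ.* ((1 ℕ.+ 2 ℕ.* j) ℕ.* (1 ℕ.+ 2 ℕ.* j)) ≡
             3 ℕ.+ (k ℕ.+ (3 ℕ.+ 4 ℕ.* k) ℕ.* (j ℕ.* j ℕ.+ j)) ℕ.* 4
    lemma′ = ℕ-Solver.solve-∀
  ... | i , inj₂ refl | j , inj₁ y≡2j = contradiction
          (mod4 1 0 (i ℕ.* i ℕ.+ i) ((3 ℕ.+ 4 ℕ.* k) ℕ.* (j ℕ.* j)) (trans (lemma i) (trans eq (trans (cong (λ y → (3 ℕ.+ 4 ℕ.* k) ℕ.* (y ℕ.* y)) y≡2j) (lemma′ k j))))) λ ()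
    where
    lemma : ∀ i → 1 ℕ.+ (i ℕ.* i ℕ.+ i) ℕ.* 4 ≡ (1 ℕ.+ 2 ℕ.* i) ℕ.* (1 ℕ.+ 2 ℕ.* i)
    lemma = ℕ-Solver.solve-∀
    lemma′ : ∀ k j → (3 ℕ.+ 4 ℕ.* k) ℕ.* (2 ℕ.* j ℕ.* (2 ℕ.* j)) ≡ 0 ℕ.+ (3 ℕ.+ 4 ℕ.* k) ℕ.* (j ℕ.* j) ℕ.* 4
    lemma′ = ℕ-Solver.solve-∀
  ... | i , inj₂ refl | j , inj₂ y≡1+2j = contradiction
          (mod4 1 3 (i ℕ.* i ℕ.+ i) (k ℕ.+ (3 ℕ.+ 4 ℕ.* k) ℕ.* (j ℕ.* j ℕ.+ j)) (trans (lemma i) (trans eq (trans (cong (λ y → (3 ℕ.+ 4 ℕ.* k) ℕ.* (y ℕ.* y)) y≡1+2j) (lemma′ k j))))) λ ()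
    where
    lemma : ∀ i → 1 ℕ.+ (i ℕ.* i ℕ.+ i) ℕ.* 4 ≡ (1 ℕ.+ 2 ℕ.* i) ℕ.* (1 ℕ.+ 2 ℕ.* i)
    lemma = ℕ-Solver.solve-∀
    lemma′ : ∀ k j → (3 ℕ.+ 4 ℕ.* k) ℕ.* ((1 ℕ.+ 2 ℕ.* j) ℕ.* (1 ℕ.+ 2 ℕ.* j)) ≡
             3 ℕ.+ (k ℕ.+ (3 ℕ.+ 4 ℕ.* k) ℕ.* (j ℕ.* j ℕ.+ j)) ℕ.* 4
    lemma′ = ℕ-Solver.solve-∀

p²≡[3+4k]q²⇒q≡0 : ∀ k p q → p * p ≡ ι (ℤ.+ (3 ℕ.+ 4 ℕ.* k)) * (q * q) → q ≡ 0ℚ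
p²≡[3+4k]q²⇒q≡0 k p q eq = ℚ.↥p≡0⇒p≡0 q
  ([ id , (λ ()) ]′ (ℤ.i*j≡0⇒i≡0∨j≡0 (↥ q) (ℤ.∣i∣≡0⇒i≡0 (x²≡[3+4k]y²⇒y≡0 k ℤ.∣ ↥ p ℤ.* ↧ q ∣ ℤ.∣ ↥ q ℤ.* ↧ p ∣ squares))))
  where
  open ≡-Reasoning
  K = 3 ℕ.+ 4 ℕ.* k
  lemma : ∀ p a b → (p * a * b) * (p * a * b) ≡ p * p * (a * b * (a * b))
  lemma = solve-∀ ℚ-ring
  lemma′ : ∀ q a b κ → κ * (q * q) * (a * b * (a * b)) ≡ κ * ((q * b * a) * (q * b * a))
  lemma′ = solve-∀ ℚ-ring
  ιx : ι (↥ p ℤ.* ↧ q) ≡ p * ι (↧ p) * ι (↧ q)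
  ιx = trans (ι-* (↥ p) (↧ q)) (cong (_* ι (↧ q)) (sym (numerator-denominator p)))
  ιy : ι (↥ q ℤ.* ↧ p) ≡ q * ι (↧ q) * ι (↧ p)
  ιy = trans (ι-* (↥ q) (↧ p)) (cong (_* ι (↧ p)) (sym (numerator-denominator q)))
  integral-squares : (↥ p ℤ.* ↧ q) ℤ.* (↥ p ℤ.* ↧ q) ≡ ℤ.+ K ℤ.* ((↥ q ℤ.* ↧ p) ℤ.* (↥ q ℤ.* ↧ p))
  integral-squares = ι-injective (begin
    ι ((↥ p ℤ.* ↧ q) ℤ.* (↥ p ℤ.* ↧ q))                    ≡⟨ trans (ι-* (↥ p ℤ.* ↧ q) (↥ p ℤ.* ↧ q)) (cong₂ _*_ ιx ιx) ⟩
    (p * ι (↧ p) * ι (↧ q)) * (p * ι (↧ p) * ι (↧ q))      ≡⟨ lemma p (ι (↧ p)) (ι (↧ q)) ⟩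
    p * p * (ι (↧ p) * ι (↧ q) * (ι (↧ p) * ι (↧ q)))      ≡⟨ cong (_* (ι (↧ p) * ι (↧ q) * (ι (↧ p) * ι (↧ q)))) eq ⟩
    ι (ℤ.+ K) * (q * q) * (ι (↧ p) * ι (↧ q) * (ι (↧ p) * ι (↧ q))) ≡⟨ lemma′ q (ι (↧ p)) (ι (↧ q)) (ι (ℤ.+ K)) ⟩
    ι (ℤ.+ K) * ((q * ι (↧ q) * ι (↧ p)) * (q * ι (↧ q) * ι (↧ p))) ≡⟨ cong (ι (ℤ.+ K) *_) (trans (ι-* (↥ q ℤ.* ↧ p) (↥ q ℤ.* ↧ p)) (cong₂ _*_ ιy ιy)) ⟨
    ι (ℤ.+ K) * ι ((↥ q ℤ.* ↧ p) ℤ.* (↥ q ℤ.* ↧ p))        ≡⟨ ι-* (ℤ.+ K) ((↥ q ℤ.* ↧ p) ℤ.* (↥ q ℤ.* ↧ p)) ⟨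
    ι (ℤ.+ K ℤ.* ((↥ q ℤ.* ↧ p) ℤ.* (↥ q ℤ.* ↧ p)))        ∎)
  squares : ℤ.∣ ↥ p ℤ.* ↧ q ∣ ℕ.* ℤ.∣ ↥ p ℤ.* ↧ q ∣ ≡ K ℕ.* (ℤ.∣ ↥ q ℤ.* ↧ p ∣ ℕ.* ℤ.∣ ↥ q ℤ.* ↧ p ∣)
  squares = begin
    ℤ.∣ ↥ p ℤ.* ↧ q ∣ ℕ.* ℤ.∣ ↥ p ℤ.* ↧ q ∣                ≡⟨ ℤ.abs-* (↥ p ℤ.* ↧ q) (↥ p ℤ.* ↧ q) ⟨
    ℤ.∣ (↥ p ℤ.* ↧ q) ℤ.* (↥ p ℤ.* ↧ q) ∣                  ≡⟨ cong ℤ.∣_∣ integral-squares ⟩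
    ℤ.∣ ℤ.+ K ℤ.* ((↥ q ℤ.* ↧ p) ℤ.* (↥ q ℤ.* ↧ p)) ∣      ≡⟨ ℤ.abs-* (ℤ.+ K) ((↥ q ℤ.* ↧ p) ℤ.* (↥ q ℤ.* ↧ p)) ⟩
    K ℕ.* ℤ.∣ (↥ q ℤ.* ↧ p) ℤ.* (↥ q ℤ.* ↧ p) ∣            ≡⟨ cong (K ℕ.*_) (ℤ.abs-* (↥ q ℤ.* ↧ p) (↥ q ℤ.* ↧ p)) ⟩
    K ℕ.* (ℤ.∣ ↥ q ℤ.* ↧ p ∣ ℕ.* ℤ.∣ ↥ q ℤ.* ↧ p ∣)        ∎

-- The odd positive integers.
odds : TestPoints
odds = record
  { point    = λ i → ι (ℤ.+ (1 ℕ.+ 2 ℕ.* i))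
  ; distinct = λ {i} {j} eq → ℕ.*-cancelˡ-≡ i j 2 (ℕ.suc-injective (ℤ.+-injective
                   (ι-injective {ℤ.+ (1 ℕ.+ 2 ℕ.* i)} {ℤ.+ (1 ℕ.+ 2 ℕ.* j)} eq)))
  ; nonzero  = λ i eq → ℕ.1+n≢0 {2 ℕ.* i} (ℤ.+-injective (ι-injective {ℤ.+ (1 ℕ.+ 2 ℕ.* i)} {ℤ.+ 0} eq))
  }

sumOfFourthPowers : Expr 3
sumOfFourthPowers = :var zero :^ 4 :+ :var (suc zero) :^ 4 :+ :var (suc (suc zero)) :^ 4

-- At odd integers the sum of three fourth powers is congruent to 3 modulo
-- 4, and hence not a rational square.
sumOfFourthPowers-nonsquare : IsNonsquare (toPoly sumOfFourthPowers)
sumOfFourthPowers-nonsquare A B eq = ≈0⇒ev A A≈0 , ≈0⇒ev B B≈0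
  where
  open ≡-Reasoning
  -- The fourth power of 1 + 2i is 1 + 4·fourth i.
  fourth : ℕ → ℕ
  fourth i = 2 ℕ.* i ℕ.* (2 ℕ.* i ℕ.* i ℕ.* i ℕ.+ 4 ℕ.* i ℕ.* i ℕ.+ 3 ℕ.* i ℕ.+ 1)
  fourth-power : ∀ i → (1 ℕ.+ 2 ℕ.* i) ℕ.^ 4 ≡ 1 ℕ.+ 4 ℕ.* fourth i
  fourth-power i = lemma i
    where
    lemma : ∀ i → (1 ℕ.+ 2 ℕ.* i) ℕ.* ((1 ℕ.+ 2 ℕ.* i) ℕ.* ((1 ℕ.+ 2 ℕ.* i) ℕ.* ((1 ℕ.+ 2 ℕ.* i) ℕ.* 1))) ≡
            1 ℕ.+ 4 ℕ.* (2 ℕ.* i ℕ.* (2 ℕ.* i ℕ.* i ℕ.* i ℕ.+ 4 ℕ.* i ℕ.* i ℕ.+ 3 ℕ.* i ℕ.+ 1))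
    lemma = ℕ-Solver.solve-∀
  value-at-odds : ∀ v → ∃[ k ] ev (toPoly sumOfFourthPowers) (testPoint odds v) ≡ ι (ℤ.+ (3 ℕ.+ 4 ℕ.* k))
  value-at-odds v@(i ∷ j ∷ l ∷ []) = fourth i ℕ.+ fourth j ℕ.+ fourth l , (begin
    ev (toPoly sumOfFourthPowers) (testPoint odds v)
      ≡⟨ ev-toPoly sumOfFourthPowers (testPoint odds v) ⟩
    ι (ℤ.+ oᵢ) ^ 4 + ι (ℤ.+ oⱼ) ^ 4 + ι (ℤ.+ oₗ) ^ 4
      ≡⟨ cong₂ _+_ (cong₂ _+_ (ι-^ oᵢ 4) (ι-^ oⱼ 4)) (ι-^ oₗ 4) ⟨
    ι (ℤ.+ (oᵢ ℕ.^ 4)) + ι (ℤ.+ (oⱼ ℕ.^ 4)) + ι (ℤ.+ (oₗ ℕ.^ 4))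
      ≡⟨ cong (_+ ι (ℤ.+ (oₗ ℕ.^ 4))) (ι-+ (ℤ.+ (oᵢ ℕ.^ 4)) (ℤ.+ (oⱼ ℕ.^ 4))) ⟨
    ι (ℤ.+ (oᵢ ℕ.^ 4 ℕ.+ oⱼ ℕ.^ 4)) + ι (ℤ.+ (oₗ ℕ.^ 4))
      ≡⟨ ι-+ (ℤ.+ (oᵢ ℕ.^ 4 ℕ.+ oⱼ ℕ.^ 4)) (ℤ.+ (oₗ ℕ.^ 4)) ⟨
    ι (ℤ.+ (oᵢ ℕ.^ 4 ℕ.+ oⱼ ℕ.^ 4 ℕ.+ oₗ ℕ.^ 4))
      ≡⟨ cong (λ a → ι (ℤ.+ a)) (cong₂ ℕ._+_ (cong₂ ℕ._+_ (fourth-power i) (fourth-power j)) (fourth-power l)) ⟩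
    ι (ℤ.+ ((1 ℕ.+ 4 ℕ.* fourth i) ℕ.+ (1 ℕ.+ 4 ℕ.* fourth j) ℕ.+ (1 ℕ.+ 4 ℕ.* fourth l)))
      ≡⟨ cong (λ a → ι (ℤ.+ a)) (lemma (fourth i) (fourth j) (fourth l)) ⟩
    ι (ℤ.+ (3 ℕ.+ 4 ℕ.* (fourth i ℕ.+ fourth j ℕ.+ fourth l))) ∎)
    where
    oᵢ = 1 ℕ.+ 2 ℕ.* i
    oⱼ = 1 ℕ.+ 2 ℕ.* j
    oₗ = 1 ℕ.+ 2 ℕ.* l
    lemma : ∀ a b c → (1 ℕ.+ 4 ℕ.* a) ℕ.+ (1 ℕ.+ 4 ℕ.* b) ℕ.+ (1 ℕ.+ 4 ℕ.* c) ≡ 3 ℕ.+ 4 ℕ.* (a ℕ.+ b ℕ.+ c)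
    lemma = ℕ-Solver.solve-∀
  B≡0-at-odds : ∀ v → ev B (testPoint odds v) ≡ 0ℚ
  B≡0-at-odds v = let k , D≡ = value-at-odds v in
    p²≡[3+4k]q²⇒q≡0 k (ev A (testPoint odds v)) (ev B (testPoint odds v))
      (trans (eq (testPoint odds v)) (cong (_* (ev B (testPoint odds v) * ev B (testPoint odds v))) D≡))
  B≈0 : B ≈ 0ₚ
  B≈0 = vanishes⇒≈0 odds B B≡0-at-odds
  A≈0 : A ≈ 0ₚ
  A≈0 = ev⇒≈0 A λ v → [ id , id ]′ (ℚ-integral (ev A v) (ev A v) (begin
    ev A v * ev A v                                          ≡⟨ eq v ⟩
    ev (toPoly sumOfFourthPowers) v * (ev B v * ev B v)      ≡⟨ cong (λ b → ev (toPoly sumOfFourthPowers) v * (b * b)) (≈0⇒ev B B≈0 v) ⟩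
    ev (toPoly sumOfFourthPowers) v * (0ℚ * 0ℚ)              ≡⟨ ℚ.*-zeroʳ (ev (toPoly sumOfFourthPowers) v) ⟩
    0ℚ                                                       ∎))

-- The surfaces X and X′

areForms? : (w : Vec ℕ n) (d : ℕ) (v : Vec ℕ k) (f : Vec (Poly n) k) → Dec (AreForms w d v f)
areForms? w d v f = Dec.map′ areForms AreForms.form (Fin.all? λ j → isForm? w (d ℕ.* lookup v j) (lookup f j))

∉principal : ∀ (t p : Poly n) x → ev t x ≡ 0ℚ → ev p x ≢ 0ℚ → p ∉ ⟨ t ∷ [] ⟩
∉principal t p x tx≡0 px≢0 p∈ = let c , eq = ∈principal⁻ t p p∈ in
  px≢0 (trans (eq x) (trans (cong (ev c x *_) tx≡0) (ℚ.*-zeroʳ (ev c x))))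

-- An isomorphism of polynomial rings carries principal ideals to principal
-- ideals.
module _ (s : Poly k) (t : Poly n) (σ : Vec (Poly k) n) (τ : Vec (Poly n) k) (c d : ℚ)
         (t∘σ : ∀ x → ev t (evs σ x) ≡ c * ev s x) (s∘τ : ∀ y → ev s (evs τ y) ≡ d * ev t y)
         (σ∘τ : ∀ y → evs σ (evs τ y) ≡ y) where

  open ≡-Reasoning

  principal-preimage⁺ : ∀ {p} → p ∈ ⟨ t ∷ [] ⟩ → substₚ p σ ∈ ⟨ s ∷ [] ⟩
  principal-preimage⁺ {p} p∈ = let a , eq = ∈principal⁻ t p p∈ in
    ∈principal⁺ s (substₚ p σ) (substₚ a σ *ₚ const c) λ x → begin
      ev (substₚ p σ) x                       ≡⟨ ev-subst p σ x ⟩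
      ev p (evs σ x)                          ≡⟨ eq (evs σ x) ⟩
      ev a (evs σ x) * ev t (evs σ x)         ≡⟨ cong₂ _*_ (sym (ev-subst a σ x)) (t∘σ x) ⟩
      ev (substₚ a σ) x * (c * ev s x)        ≡⟨ ℚ.*-assoc (ev (substₚ a σ) x) c (ev s x) ⟨
      ev (substₚ a σ) x * c * ev s x          ≡⟨ cong (_* ev s x) (trans (ev-* (substₚ a σ) (const c) x) (cong (ev (substₚ a σ) x *_) (ev-const c x))) ⟨
      ev (substₚ a σ *ₚ const c) x * ev s x   ∎

  principal-preimage⁻ : ∀ {p} → substₚ p σ ∈ ⟨ s ∷ [] ⟩ → p ∈ ⟨ t ∷ [] ⟩
  principal-preimage⁻ {p} p∈ = let a , eq = ∈principal⁻ s (substₚ p σ) p∈ in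
    ∈principal⁺ t p (substₚ a τ *ₚ const d) λ y → begin
      ev p y                                  ≡⟨ cong (ev p) (σ∘τ y) ⟨
      ev p (evs σ (evs τ y))                  ≡⟨ ev-subst p σ (evs τ y) ⟨
      ev (substₚ p σ) (evs τ y)               ≡⟨ eq (evs τ y) ⟩
      ev a (evs τ y) * ev s (evs τ y)         ≡⟨ cong₂ _*_ (sym (ev-subst a τ y)) (s∘τ y) ⟩
      ev (substₚ a τ) y * (d * ev t y)        ≡⟨ ℚ.*-assoc (ev (substₚ a τ) y) d (ev t y) ⟨
      ev (substₚ a τ) y * d * ev t y          ≡⟨ cong (_* ev t y) (trans (ev-* (substₚ a τ) (const d) y) (cong (ev (substₚ a τ) y *_) (ev-const d y))) ⟨
      ev (substₚ a τ *ₚ const d) y * ev t y   ∎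

private
  v₀ v₁ v₂ v₃ : Expr 4
  v₀ = :var zero
  v₁ = :var (suc zero)
  v₂ = :var (suc (suc zero))
  v₃ = :var (suc (suc (suc zero)))

evs-toPoly : ∀ (f : Vec (Expr n) k) x → evs (Vec.map toPoly f) x ≡ Vec.map (λ a → value a x) f
evs-toPoly f x = trans (sym (Vec.map-∘ (λ p → ev p x) toPoly f)) (Vec.map-cong (λ a → ev-toPoly a x) f)

w₂₁₁₁ : Vec ℕ 4
w₂₁₁₁ = 2 ∷ 1 ∷ 1 ∷ 1 ∷ []

-- The surface u² = a⁴ + b⁴ + c⁴, with the variables in the order (u,a,b,c).
equationS : Expr 4
equationS = v₀ :* v₀ :- (v₁ :^ 4 :+ v₂ :^ 4 :+ v₃ :^ 4)

S : Closed w₂₁₁₁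
S = zeros w₂₁₁₁ (toPoly equationS ∷ [])

ev-equationS : ∀ u a b c → ev (toPoly equationS) (u ∷ a ∷ b ∷ c ∷ []) ≡ u * u - (a ^ 4 + b ^ 4 + c ^ 4)
ev-equationS u a b c = ev-toPoly equationS (u ∷ a ∷ b ∷ c ∷ [])

a∉S : var (suc zero) ∉ ideal S
a∉S = ∉principal (toPoly equationS) (var (suc zero)) (1ℚ ∷ 1ℚ ∷ 0ℚ ∷ 0ℚ ∷ []) refl λ ()

S-isVariety : IsVariety S
S-isVariety = hypersurface-isVariety (toPoly equationS) (_ ∷ _ ∷ _ ∷ _ ∷ []) (from-yes (isForm? w₂₁₁₁ 4 (toPoly equationS)))
  (1ℚ ∷ 1ℚ ∷ 0ℚ ∷ 0ℚ ∷ [] , refl)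
  (λ {p} {q} → quadratic-prime (toPoly sumOfFourthPowers) (toPoly equationS) ev-S sumOfFourthPowers-nonsquare {p} {q})
  (suc zero , a∉S)
  where
  ev-S : ∀ u v → ev (toPoly equationS) (u ∷ v) ≡ u * u - ev (toPoly sumOfFourthPowers) v
  ev-S u v@(a ∷ b ∷ c ∷ []) = trans (ev-equationS u a b c) (cong (λ d → u * u - d) (sym (ev-toPoly sumOfFourthPowers v)))

ev-equationX : ∀ x y z w → ev equationX (x ∷ y ∷ z ∷ w ∷ []) ≡ x ^ 4 + y ^ 4 + z ^ 4 - w ^ 2
ev-equationX x y z w = ev-toPoly (v₀ :^ 4 :+ v₁ :^ 4 :+ v₂ :^ 4 :- v₃ :^ 2) (x ∷ y ∷ z ∷ w ∷ [])

2ℚ : ℚ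
2ℚ = ℤ.+ 2 ℚ./ 1

ev-equationX′ : ∀ p q r m → ev equationX′ (p ∷ q ∷ r ∷ m ∷ []) ≡ m ^ 2 - p ^ 4 - q ^ 4 - 2ℚ * m * r ^ 2
ev-equationX′ p q r m = ev-toPoly (v₃ :^ 2 :- v₀ :^ 4 :- v₁ :^ 4 :- :con 2ℚ :* v₃ :* v₂ :^ 2) (p ∷ q ∷ r ∷ m ∷ [])

-- The isomorphism (u,a,b,c) ↦ (a,b,c,u) from S to X and its inverse.
S→X X→S : Vec (Expr 4) 4
S→X = v₁ ∷ v₂ ∷ v₃ ∷ v₀ ∷ []
X→S = v₃ ∷ v₀ ∷ v₁ ∷ v₂ ∷ []

X-isVariety : IsVariety X
X-isVariety = isVariety-resp
  (λ {p} → principal-preimage⁻ (toPoly equationS) equationX (Vec.map toPoly S→X) (Vec.map toPoly X→S) (- 1ℚ) (- 1ℚ) X∘ S∘ inverse {p})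
  (λ {p} → principal-preimage⁺ (toPoly equationS) equationX (Vec.map toPoly S→X) (Vec.map toPoly X→S) (- 1ℚ) (- 1ℚ) X∘ S∘ inverse {p})
  (image-isVariety (Vec.map toPoly S→X) S-isVariety (_ ∷ _ ∷ _ ∷ _ ∷ []) (from-yes (areForms? w₂₁₁₁ 1 w₁₁₁₂ (Vec.map toPoly S→X)))
    (zero , a∉S))
  where
  X∘ : ∀ x → ev equationX (evs (Vec.map toPoly S→X) x) ≡ - 1ℚ * ev (toPoly equationS) x
  X∘ x@(u ∷ a ∷ b ∷ c ∷ []) = trans (cong (ev equationX) (evs-toPoly S→X x))
    (trans (ev-equationX a b c u) (trans (lemma u (a ^ 4) (b ^ 4) (c ^ 4)) (cong (- 1ℚ *_) (sym (ev-equationS u a b c)))))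
    where
    lemma : ∀ u a b c → a + b + c - u * (u * 1ℚ) ≡ - 1ℚ * (u * u - (a + b + c))
    lemma = solve-∀ ℚ-ring
  S∘ : ∀ x → ev (toPoly equationS) (evs (Vec.map toPoly X→S) x) ≡ - 1ℚ * ev equationX x
  S∘ v@(x ∷ y ∷ z ∷ w ∷ []) = trans (cong (ev (toPoly equationS)) (evs-toPoly X→S v))
    (trans (ev-equationS w x y z) (trans (lemma w (x ^ 4) (y ^ 4) (z ^ 4)) (cong (- 1ℚ *_) (sym (ev-equationX x y z w)))))
    where
    lemma : ∀ u a b c → u * u - (a + b + c) ≡ - 1ℚ * (a + b + c - u * (u * 1ℚ))
    lemma = solve-∀ ℚ-ring
  inverse : ∀ x → evs (Vec.map toPoly S→X) (evs (Vec.map toPoly X→S) x) ≡ x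
  inverse v@(x ∷ y ∷ z ∷ w ∷ []) = trans (cong (evs (Vec.map toPoly S→X)) (evs-toPoly X→S v)) (evs-toPoly S→X (w ∷ x ∷ y ∷ z ∷ []))

-- The isomorphism (u,a,b,c) ↦ (b,c,a,a²-u) from S to X′ and its inverse.
S→X′ X′→S : Vec (Expr 4) 4
S→X′ = v₂ ∷ v₃ ∷ v₁ ∷ v₁ :^ 2 :- v₀ ∷ []
X′→S = v₂ :^ 2 :- v₃ ∷ v₂ ∷ v₀ ∷ v₁ ∷ []

X′-isVariety : IsVariety X′
X′-isVariety = isVariety-resp
  (λ {p} → principal-preimage⁻ (toPoly equationS) equationX′ (Vec.map toPoly S→X′) (Vec.map toPoly X′→S) 1ℚ 1ℚ X′∘ S∘ inverse {p})
  (λ {p} → principal-preimage⁺ (toPoly equationS) equationX′ (Vec.map toPoly S→X′) (Vec.map toPoly X′→S) 1ℚ 1ℚ X′∘ S∘ inverse {p})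
  (image-isVariety (Vec.map toPoly S→X′) S-isVariety (_ ∷ _ ∷ _ ∷ _ ∷ []) (from-yes (areForms? w₂₁₁₁ 1 w₁₁₁₂ (Vec.map toPoly S→X′)))
    (suc (suc zero) , a∉S))
  where
  X′∘ : ∀ x → ev equationX′ (evs (Vec.map toPoly S→X′) x) ≡ 1ℚ * ev (toPoly equationS) x
  X′∘ x@(u ∷ a ∷ b ∷ c ∷ []) = trans (cong (ev equationX′) (evs-toPoly S→X′ x))
    (trans (ev-equationX′ b c a (a ^ 2 - u)) (trans (lemma u a (b ^ 4) (c ^ 4)) (cong (1ℚ *_) (sym (ev-equationS u a b c)))))
    where
    lemma : ∀ u a b c → (a * (a * 1ℚ) - u) * ((a * (a * 1ℚ) - u) * 1ℚ) - b - c - (1ℚ + 1ℚ) * (a * (a * 1ℚ) - u) * (a * (a * 1ℚ)) ≡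
            1ℚ * (u * u - (a * (a * (a * (a * 1ℚ))) + b + c))
    lemma = solve-∀ ℚ-ring
  S∘ : ∀ x → ev (toPoly equationS) (evs (Vec.map toPoly X′→S) x) ≡ 1ℚ * ev equationX′ x
  S∘ x@(p ∷ q ∷ r ∷ m ∷ []) = trans (cong (ev (toPoly equationS)) (evs-toPoly X′→S x))
    (trans (ev-equationS (r ^ 2 - m) r p q) (trans (lemma (p ^ 4) (q ^ 4) r m) (cong (1ℚ *_) (sym (ev-equationX′ p q r m)))))
    where
    lemma : ∀ p q r m → (r * (r * 1ℚ) - m) * (r * (r * 1ℚ) - m) - (r * (r * (r * (r * 1ℚ))) + p + q) ≡
            1ℚ * (m * (m * 1ℚ) - p - q - (1ℚ + 1ℚ) * m * (r * (r * 1ℚ)))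
    lemma = solve-∀ ℚ-ring
  inverse : ∀ x → evs (Vec.map toPoly S→X′) (evs (Vec.map toPoly X′→S) x) ≡ x
  inverse x@(p ∷ q ∷ r ∷ m ∷ []) = trans (cong (evs (Vec.map toPoly S→X′)) (evs-toPoly X′→S x))
    (trans (evs-toPoly S→X′ (r ^ 2 - m ∷ r ∷ p ∷ q ∷ [])) (cong (λ m → p ∷ q ∷ r ∷ m ∷ []) (lemma r m)))
    where
    lemma : ∀ r m → r * (r * 1ℚ) - (r * (r * 1ℚ) - m) ≡ m
    lemma = solve-∀ ℚ-ring

-- Kernels of parametrizations

-- A polynomial that vanishes on a curve parametrized by forms vanishes on
-- the weighted cone over this curve: its restriction to a line of the cone is a
-- polynomial in c that vanishes at all d-th powers.
vanishes-on-cone : ∀ {w : Vec ℕ n} {d} .{{_ : NonZero d}} {π : Vec (Poly 2) n} → AreForms w₁₁ d w π →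
                   ∀ p → (∀ x → ev p (evs π x) ≡ 0ℚ) → ∀ c x → ev p (scale w c (evs π x)) ≡ 0ℚ
vanishes-on-cone {n} {w} {d} {π} forms p p∘π≡0 c x = trans (sym (ev-line c)) (≈0⇒ev line line≈0 (c ∷ []))
  where
  coordinates : ∀ {n} → Vec ℕ n → Vec ℚ n → Vec (Poly 1) n
  coordinates = Vec.zipWith λ i a → toPoly (:var zero :^ i :* :con a)
  evs-coordinates : ∀ {n} (w : Vec ℕ n) y c → evs (coordinates w y) (c ∷ []) ≡ scale w c y
  evs-coordinates []      []      c = refl
  evs-coordinates (i ∷ w) (a ∷ y) c = cong₂ _∷_ (ev-toPoly (:var zero :^ i :* :con a) (c ∷ [])) (evs-coordinates w y c)
  line : Poly 1
  line = substₚ p (coordinates w (evs π x))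
  ev-line : ∀ c → ev line (c ∷ []) ≡ ev p (scale w c (evs π x))
  ev-line c = trans (ev-subst p (coordinates w (evs π x)) (c ∷ [])) (cong (ev p) (evs-coordinates w (evs π x) c))
  line≈0 : line ≈ 0ₚ
  line≈0 = vanishes⇒≈0 (powers d) line λ { (i ∷ []) → begin
    ev line (ι (ℤ.+ (suc i ℕ.^ d)) ∷ [])              ≡⟨ ev-line (ι (ℤ.+ (suc i ℕ.^ d))) ⟩
    ev p (scale w (ι (ℤ.+ (suc i ℕ.^ d))) (evs π x))  ≡⟨ cong (λ c → ev p (scale w c (evs π x))) (ι-^ (suc i) d) ⟩
    ev p (scale w (ι (ℤ.+ suc i) ^ d) (evs π x))      ≡⟨ cong (ev p) (evs-scale forms (ι (ℤ.+ suc i)) x) ⟨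
    ev p (evs π (scale w₁₁ (ι (ℤ.+ suc i)) x))        ≡⟨ p∘π≡0 (scale w₁₁ (ι (ℤ.+ suc i)) x) ⟩
    0ℚ                                                ∎ }
    where open ≡-Reasoning

-- The points (b(x+1), b(x-1)), where x is the square of a positive integer,
-- are dense in the plane: for fixed b ≠ 0 they are infinitely many points of a
-- line.
dense-squares : (F : Poly 2) →
                (∀ i b → let x = point (powers 2) i in ev F (b * (x + 1ℚ) ∷ b * (x - 1ℚ) ∷ []) ≡ 0ℚ) →
                F ≈ 0ₚ
dense-squares F vanishes = ≈0-on-dense F (toPoly (:var zero :- :var (suc zero)))
  (≉0 (toPoly (:var zero :- :var (suc zero))) (1ℚ ∷ 0ℚ ∷ []) λ ()) everywhere
  where
  open ≡-Reasoning
  -- The line of the points (b(x+1), b(x-1)) for a fixed b.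
  curve : ℚ → Vec (Poly 1) 2
  curve b = toPoly (:con b :* (:var zero :+ :con 1ℚ)) ∷ toPoly (:con b :* (:var zero :- :con 1ℚ)) ∷ []
  ev-curve : ∀ b x → ev (substₚ F (curve b)) (x ∷ []) ≡ ev F (b * (x + 1ℚ) ∷ b * (x - 1ℚ) ∷ [])
  ev-curve b x = trans (ev-subst F (curve b) (x ∷ [])) (cong₂ (λ y z → ev F (y ∷ z ∷ []))
    (ev-toPoly (:con b :* (:var zero :+ :con 1ℚ)) (x ∷ [])) (ev-toPoly (:con b :* (:var zero :- :con 1ℚ)) (x ∷ [])))
  on-curve : ∀ b x → ev F (b * (x + 1ℚ) ∷ b * (x - 1ℚ) ∷ []) ≡ 0ℚ
  on-curve b x = trans (sym (ev-curve b x)) (≈0⇒ev (substₚ F (curve b))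
    (vanishes⇒≈0 (powers 2) (substₚ F (curve b)) λ { (i ∷ []) → trans (ev-curve b (point (powers 2) i)) (vanishes i b) }) (x ∷ []))
  everywhere : ∀ v → ev (toPoly (:var zero :- :var (suc zero))) v ≢ 0ℚ → ev F v ≡ 0ℚ
  everywhere v@(q ∷ r ∷ []) q-r≢0 = let b = ½ * (q - r) ; x , y≡xb = divides-by (½ * (q + r)) {b} b≢0 in begin
    ev F (q ∷ r ∷ [])
      ≡⟨ cong₂ (λ y z → ev F (y ∷ z ∷ [])) (lemma₁ q r) (lemma₂ q r) ⟨
    ev F (½ * (q + r) + b ∷ ½ * (q + r) - b ∷ [])
      ≡⟨ cong (λ y → ev F (y + b ∷ y - b ∷ [])) y≡xb ⟩
    ev F (x * b + b ∷ x * b - b ∷ [])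
      ≡⟨ cong₂ (λ y z → ev F (y ∷ z ∷ [])) (lemma₃ b x) (lemma₄ b x) ⟩
    ev F (b * (x + 1ℚ) ∷ b * (x - 1ℚ) ∷ [])
      ≡⟨ on-curve b x ⟩
    0ℚ ∎
    where
    b≢0 : ½ * (q - r) ≢ 0ℚ
    b≢0 = *-nonzero {½} (λ ()) (λ eq → q-r≢0 (trans (ev-toPoly (:var zero :- :var (suc zero)) v) eq))
    half : ∀ a → (½ + ½) * a ≡ a
    half = ℚ.*-identityˡ
    lemma₁′ : ∀ h q r → h * (q + r) + h * (q - r) ≡ (h + h) * q
    lemma₁′ = solve-∀ ℚ-ring
    lemma₂′ : ∀ h q r → h * (q + r) - h * (q - r) ≡ (h + h) * r
    lemma₂′ = solve-∀ ℚ-ring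
    lemma₁ : ∀ q r → ½ * (q + r) + ½ * (q - r) ≡ q
    lemma₁ q r = trans (lemma₁′ ½ q r) (half q)
    lemma₂ : ∀ q r → ½ * (q + r) - ½ * (q - r) ≡ r
    lemma₂ q r = trans (lemma₂′ ½ q r) (half r)
    lemma₃ : ∀ b x → x * b + b ≡ b * (x + 1ℚ)
    lemma₃ = solve-∀ ℚ-ring
    lemma₄ : ∀ b x → x * b - b ≡ b * (x - 1ℚ)
    lemma₄ = solve-∀ ℚ-ring

-- The curve Γ and its parametrization

-- The parametrization of the conic a² = b² + c² by (s : t): a = s² + t²,
-- b = s² - t² and c = 2st.
â b̂ ĉ : Expr 2
â = :var zero :* :var zero :+ :var (suc zero) :* :var (suc zero)
b̂ = :var zero :* :var zero :- :var (suc zero) :* :var (suc zero)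
ĉ = (:con 1ℚ :+ :con 1ℚ) :* :var zero :* :var (suc zero)

conic : ∀ x → value â x * value â x ≡ value b̂ x * value b̂ x + value ĉ x * value ĉ x
conic (s ∷ t ∷ []) = lemma s t
  where
  lemma : ∀ s t → (s * s + t * t) * (s * s + t * t) ≡ (s * s - t * t) * (s * s - t * t) + (1ℚ + 1ℚ) * s * t * ((1ℚ + 1ℚ) * s * t)
  lemma = solve-∀ ℚ-ring

-- In terms of 1/r² = 1/p² + 1/q², take 1/p : 1/q : 1/r = c : b : a.
Γ-expressions : Vec (Expr 2) 3
Γ-expressions = â :* b̂ ∷ ĉ :* â ∷ ĉ :* b̂ ∷ []

πΓ : Vec (Poly 2) 3
πΓ = Vec.map toPoly Γ-expressions

πΓ-forms : AreForms w₁₁ 4 w₁₁₁ πΓ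
πΓ-forms = from-yes (areForms? w₁₁ 4 w₁₁₁ πΓ)

-- The left-hand side of the equation E = 0 of Γ.
E : (p q r : ℚ) → ℚ
E p q r = p * p * (q * q) - (p * p + q * q) * (r * r)

ev-equationΓ : ∀ p q r → ev equationΓ (p ∷ q ∷ r ∷ []) ≡ E p q r
ev-equationΓ p q r = trans (ev-toPoly (x :^ 2 :* y :^ 2 :- (x :^ 2 :+ y :^ 2) :* z :^ 2) (p ∷ q ∷ r ∷ [])) (lemma p q r)
  where
  x y z : Expr 3
  x = :var zero
  y = :var (suc zero)
  z = :var (suc (suc zero))
  lemma : ∀ p q r → p * (p * 1ℚ) * (q * (q * 1ℚ)) - (p * (p * 1ℚ) + q * (q * 1ℚ)) * (r * (r * 1ℚ)) ≡ p * p * (q * q) - (p * p + q * q) * (r * r)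
  lemma = solve-∀ ℚ-ring

equationΓ∘πΓ : ∀ x → ev equationΓ (evs πΓ x) ≡ 0ℚ
equationΓ∘πΓ x = trans (cong (ev equationΓ) (evs-toPoly Γ-expressions x))
  (trans (ev-equationΓ (a * b) (c * a) (c * b)) (trans (lemma a b c) (trans
    (cong (a * a * (b * b) * (c * c) *_) (≡⇒-≡0 (conic x))) (ℚ.*-zeroʳ (a * a * (b * b) * (c * c))))))
  where
  a = value â x
  b = value b̂ x
  c = value ĉ x
  lemma : ∀ a b c → a * b * (a * b) * (c * a * (c * a)) - (a * b * (a * b) + c * a * (c * a)) * (c * b * (c * b)) ≡
          a * a * (b * b) * (c * c) * (a * a - (b * b + c * c))
  lemma = solve-∀ ℚ-ring

-- The equation of Γ is prime to r - ε·q for ε = ±1, since it restricts to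
-- -q⁴ where r = ε·q.
cancel-linear : ∀ ε → ε * ε ≡ 1ℚ → ∀ K Q →
                (∀ p q r → let v = p ∷ q ∷ r ∷ [] in (r - ε * q) * ev K v ≡ ev Q v * E p q r) →
                ∃[ h ] ∀ p q r → let v = p ∷ q ∷ r ∷ [] in ev K v ≡ ev h v * E p q r
cancel-linear ε ε²≡1 K Q eq = h , K≡hE
  where
  open ≡-Reasoning
  ℓ : Expr 3
  ℓ = :var (suc (suc zero)) :- :con ε :* :var (suc zero)
  ρ : Vec (Expr 3) 3
  ρ = :var zero ∷ :var (suc zero) ∷ :con ε :* :var (suc zero) ∷ []
  Q-on-line : substₚ Q (Vec.map toPoly ρ) ≈ 0ₚ
  Q-on-line = ≈0-on-dense (substₚ Q (Vec.map toPoly ρ)) (var (suc zero)) (≉0 (var (suc zero)) (0ℚ ∷ 1ℚ ∷ 0ℚ ∷ []) λ ())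
    λ { v@(p ∷ q ∷ r ∷ []) q≢0′ →
      let q≢0 : q ≢ 0ℚ
          q≢0 q≡0 = q≢0′ (trans (ev-var (suc zero) v) q≡0)
          v′ = p ∷ q ∷ ε * q ∷ []
      in trans (ev-subst Q (Vec.map toPoly ρ) v) (trans (cong (ev Q) (evs-toPoly ρ v))
        ([ id , (λ E≡0 → contradiction E≡0 (λ eq₀ → *-nonzero (*-nonzero q≢0 q≢0) (*-nonzero q≢0 q≢0) (begin
            q * q * (q * q)      ≡⟨ lemma₁ p q ⟩
            - (p * p * (q * q) - (p * p + q * q) * (1ℚ * (q * q)))      ≡⟨ cong (λ e → - (p * p * (q * q) - (p * p + q * q) * (e * (q * q)))) ε²≡1 ⟨
            - (p * p * (q * q) - (p * p + q * q) * (ε * ε * (q * q)))   ≡⟨ cong (λ e → - (p * p * (q * q) - (p * p + q * q) * e)) (lemma₂ ε q) ⟩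
            - E p q (ε * q)      ≡⟨ cong -_ eq₀ ⟩
            0ℚ                   ∎))) ]′
          (ℚ-integral (ev Q v′) (E p q (ε * q)) (begin
            ev Q v′ * E p q (ε * q)            ≡⟨ eq p q (ε * q) ⟨
            (ε * q - ε * q) * ev K v′          ≡⟨ cong (_* ev K v′) (ℚ.+-inverseʳ (ε * q)) ⟩
            0ℚ * ev K v′                       ≡⟨ ℚ.*-zeroˡ (ev K v′) ⟩
            0ℚ                                 ∎)))) }
    where
    lemma₁ : ∀ p q → q * q * (q * q) ≡ - (p * p * (q * q) - (p * p + q * q) * (1ℚ * (q * q)))
    lemma₁ = solve-∀ ℚ-ring
    lemma₂ : ∀ ε q → ε * ε * (q * q) ≡ ε * q * (ε * q)
    lemma₂ = solve-∀ ℚ-ring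
  difference : ∀ i → ∃[ h ] ∀ x → lookup x i - lookup (evs (Vec.map toPoly ρ) x) i ≡ ev h x * ev (toPoly ℓ) x
  difference zero             = 0ₚ , λ { x@(p ∷ q ∷ r ∷ []) → trans (cong (λ y → p - lookup y zero) (evs-toPoly ρ x)) (trans (ℚ.+-inverseʳ p) (sym (ℚ.*-zeroˡ (ev (toPoly ℓ) x)))) }
  difference (suc zero)       = 0ₚ , λ { x@(p ∷ q ∷ r ∷ []) → trans (cong (λ y → q - lookup y (suc zero)) (evs-toPoly ρ x)) (trans (ℚ.+-inverseʳ q) (sym (ℚ.*-zeroˡ (ev (toPoly ℓ) x)))) }
  difference (suc (suc zero)) = 1ₚ , λ { x@(p ∷ q ∷ r ∷ []) → trans (cong (λ y → r - lookup y (suc (suc zero))) (evs-toPoly ρ x))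
    (sym (trans (cong₂ _*_ (ev-const 1ℚ x) (ev-toPoly ℓ x)) (ℚ.*-identityˡ (r - ε * q)))) }
  h : Poly 3
  h = proj₁ (multiple-of-difference (toPoly ℓ) (Vec.map toPoly ρ) difference Q)
  Q≡hℓ : ∀ x → ev Q x ≡ ev h x * ev (toPoly ℓ) x
  Q≡hℓ x = begin
    ev Q x                                             ≡⟨ lemma (ev Q x) ⟩
    ev Q x - 0ℚ                                        ≡⟨ cong (λ y → ev Q x - y) (trans (sym (ev-subst Q (Vec.map toPoly ρ) x)) (≈0⇒ev (substₚ Q (Vec.map toPoly ρ)) Q-on-line x)) ⟨
    ev Q x - ev Q (evs (Vec.map toPoly ρ) x)           ≡⟨ proj₂ (multiple-of-difference (toPoly ℓ) (Vec.map toPoly ρ) difference Q) x ⟩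
    ev h x * ev (toPoly ℓ) x                           ∎
    where
    lemma : ∀ a → a ≡ a - 0ℚ
    lemma = solve-∀ ℚ-ring
  F : Expr 3
  F = :poly K :- :poly h :* :poly equationΓ
  F≈0 : toPoly F ≈ 0ₚ
  F≈0 = ≈0-on-dense (toPoly F) (toPoly ℓ) (≉0 (toPoly ℓ) (0ℚ ∷ 0ℚ ∷ 1ℚ ∷ []) λ eq → ℚ.1≢0 (trans (sym (trans (ev-toPoly ℓ (0ℚ ∷ 0ℚ ∷ 1ℚ ∷ [])) (lemma₀ ε))) eq))
    λ { v@(p ∷ q ∷ r ∷ []) ℓ≢0 → [ (λ ℓ≡0 → contradiction (trans (ev-toPoly ℓ v) ℓ≡0) ℓ≢0) , id ]′ (ℚ-integral (r - ε * q) (ev (toPoly F) v) (begin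
      (r - ε * q) * ev (toPoly F) v                               ≡⟨ cong ((r - ε * q) *_) (ev-toPoly F v) ⟩
      (r - ε * q) * (ev K v - ev h v * ev equationΓ v)            ≡⟨ cong (λ e → (r - ε * q) * (ev K v - ev h v * e)) (ev-equationΓ p q r) ⟩
      (r - ε * q) * (ev K v - ev h v * E p q r)                   ≡⟨ lemma (r - ε * q) (ev K v) (ev h v) (E p q r) ⟩
      (r - ε * q) * ev K v - ev h v * (r - ε * q) * E p q r       ≡⟨ cong₂ _-_ (eq p q r) (cong (λ y → ev h v * y * E p q r) (sym (ev-toPoly ℓ v))) ⟩
      ev Q v * E p q r - ev h v * ev (toPoly ℓ) v * E p q r       ≡⟨ ≡⇒-≡0 (cong (_* E p q r) (Q≡hℓ v)) ⟩
      0ℚ                                                          ∎)) }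
    where
    lemma₀ : ∀ ε → 1ℚ - ε * 0ℚ ≡ 1ℚ
    lemma₀ = solve-∀ ℚ-ring
    lemma : ∀ l k h e → l * (k - h * e) ≡ l * k - h * l * e
    lemma = solve-∀ ℚ-ring
  K≡hE : ∀ p q r → let v = p ∷ q ∷ r ∷ [] in ev K v ≡ ev h v * E p q r
  K≡hE p q r = let v = p ∷ q ∷ r ∷ [] in trans
    (-≡0⇒≡ (trans (sym (ev-toPoly F v)) (≈0⇒ev (toPoly F) F≈0 v))) (cong (ev h v *_) (ev-equationΓ p q r))

-- q² - r² is -(r - q)(r + q).
cancel-quadratic : ∀ K Q →
                   (∀ p q r → let v = p ∷ q ∷ r ∷ [] in (q * q - r * r) * ev K v ≡ ev Q v * E p q r) →
                   ∃[ h ] ∀ p q r → let v = p ∷ q ∷ r ∷ [] in ev K v ≡ ev h v * E p q r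
cancel-quadratic K Q eq = second (cancel-linear 1ℚ refl (toPoly (ℓ :* :poly (-ₚ K))) Q first)
  where
  open ≡-Reasoning
  ℓ : Expr 3
  ℓ = :var (suc (suc zero)) :- :con (- 1ℚ) :* :var (suc zero)
  lemma : ∀ q r y → (r - 1ℚ * q) * ((r - - 1ℚ * q) * - y) ≡ (q * q - r * r) * y
  lemma = solve-∀ ℚ-ring
  lemma′ : ∀ a → a ≡ - - a
  lemma′ = solve-∀ ℚ-ring
  first : ∀ p q r → let v = p ∷ q ∷ r ∷ [] in (r - 1ℚ * q) * ev (toPoly (ℓ :* :poly (-ₚ K))) v ≡ ev Q v * E p q r
  first p q r = let v = p ∷ q ∷ r ∷ [] in begin
    (r - 1ℚ * q) * ev (toPoly (ℓ :* :poly (-ₚ K))) v   ≡⟨ cong ((r - 1ℚ * q) *_) (ev-toPoly (ℓ :* :poly (-ₚ K)) v) ⟩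
    (r - 1ℚ * q) * ((r - - 1ℚ * q) * ev (-ₚ K) v)      ≡⟨ cong (λ y → (r - 1ℚ * q) * ((r - - 1ℚ * q) * y)) (ev-neg K v) ⟩
    (r - 1ℚ * q) * ((r - - 1ℚ * q) * - ev K v)         ≡⟨ lemma q r (ev K v) ⟩
    (q * q - r * r) * ev K v                           ≡⟨ eq p q r ⟩
    ev Q v * E p q r                                   ∎
  negate : (∃[ h ] ∀ p q r → let v = p ∷ q ∷ r ∷ [] in ev (-ₚ K) v ≡ ev h v * E p q r) →
           ∃[ h ] ∀ p q r → let v = p ∷ q ∷ r ∷ [] in ev K v ≡ ev h v * E p q r
  negate (h , eq′) = -ₚ h , λ p q r → let v = p ∷ q ∷ r ∷ [] in begin
    ev K v                   ≡⟨ lemma′ (ev K v) ⟩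
    - - ev K v               ≡⟨ cong -_ (trans (sym (ev-neg K v)) (eq′ p q r)) ⟩
    - (ev h v * E p q r)     ≡⟨ ℚ.neg-distribˡ-* (ev h v) (E p q r) ⟩
    - ev h v * E p q r       ≡⟨ cong (_* E p q r) (ev-neg h v) ⟨
    ev (-ₚ h) v * E p q r    ∎
  second : (∃[ h ] ∀ p q r → let v = p ∷ q ∷ r ∷ [] in ev (toPoly (ℓ :* :poly (-ₚ K))) v ≡ ev h v * E p q r) →
           ∃[ h ] ∀ p q r → let v = p ∷ q ∷ r ∷ [] in ev K v ≡ ev h v * E p q r
  second (h , eq′) = negate (cancel-linear (- 1ℚ) refl (-ₚ K) h λ p q r →
    trans (sym (ev-toPoly (ℓ :* :poly (-ₚ K)) (p ∷ q ∷ r ∷ []))) (eq′ p q r))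

-- Every G for which (q² - r²)^k·G is a multiple of E is a multiple of E.
CancelsLeading : ℕ → Set
CancelsLeading k = ∀ G Q → (∀ p q r → let v = p ∷ q ∷ r ∷ [] in (q * q - r * r) ^ k * ev G v ≡ ev Q v * E p q r) →
                   ∃[ h ] ∀ p q r → let v = p ∷ q ∷ r ∷ [] in ev G v ≡ ev h v * E p q r

cancels-one-more : ∀ k → CancelsLeading k → CancelsLeading (suc k)
cancels-one-more k cancels G Q eq = let h , eq′ = cancel-quadratic (toPoly K) Q one-factor in
  cancels G h λ p q r → trans (sym (ev-toPoly K (p ∷ q ∷ r ∷ []))) (eq′ p q r)
  where
  K : Expr 3
  K = (:var (suc zero) :* :var (suc zero) :- :var (suc (suc zero)) :* :var (suc (suc zero))) :^ k :* :poly G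
  one-factor : ∀ p q r → let v = p ∷ q ∷ r ∷ [] in (q * q - r * r) * ev (toPoly K) v ≡ ev Q v * E p q r
  one-factor p q r = let v = p ∷ q ∷ r ∷ [] in trans (cong ((q * q - r * r) *_) (ev-toPoly K v))
    (trans (sym (ℚ.*-assoc (q * q - r * r) ((q * q - r * r) ^ k) (ev G v))) (eq p q r))

cancels-leading : ∀ k → CancelsLeading k
cancels-leading zero    G Q eq = Q , λ p q r → trans (sym (ℚ.*-identityˡ (ev G (p ∷ q ∷ r ∷ [])))) (eq p q r)
cancels-leading (suc k) = cancels-one-more k (cancels-leading k)

-- For (q,r) in a dense set there is p such that both (p,q,r) and (-p,q,r) lie
-- on the cone over the image of πΓ: the points c·πΓ(n,1) and -c·πΓ(n,-1)
-- differ by the sign of p. For x = n² and 2nc = b they have the given q and r.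
cone-points : ∀ i b → let x = point (powers 2) i ; q = b * (x + 1ℚ) ; r = b * (x - 1ℚ) in
              ∃[ p ] ∀ G → (∀ y → ev G (evs πΓ y) ≡ 0ℚ) →
                ev G (p ∷ q ∷ r ∷ []) ≡ 0ℚ × ev G (- p ∷ q ∷ r ∷ []) ≡ 0ℚ
cone-points i b = let n = ι (ℤ.+ suc i) ; c , b≡c[2n] = divides-by b (2n≢0 n (λ eq → ℕ.1+n≢0 {i} (ℤ.+-injective (ι-injective {ℤ.+ suc i} {ℤ.+ 0} eq)))) in
  c * ((n * n + 1ℚ) * (n * n - 1ℚ)) , λ G G∘π≡0 →
    trans (cong (ev G) (sym (trans (cong (scale w₁₁₁ c) (evs-toPoly Γ-expressions (n ∷ 1ℚ ∷ [])))
            (point-≡ (p₊ c n) (trans (q₊ c n) (cong₂ (λ b x → b * (x + 1ℚ)) (sym b≡c[2n]) (sym (ι-^ (suc i) 2))))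
                              (trans (r₊ c n) (cong₂ (λ b x → b * (x - 1ℚ)) (sym b≡c[2n]) (sym (ι-^ (suc i) 2))))))))
      (vanishes-on-cone πΓ-forms G G∘π≡0 c (n ∷ 1ℚ ∷ [])) ,
    trans (cong (ev G) (sym (trans (cong (scale w₁₁₁ (- c)) (evs-toPoly Γ-expressions (n ∷ - 1ℚ ∷ [])))
            (point-≡ (p₋ c n) (trans (q₋ c n) (cong₂ (λ b x → b * (x + 1ℚ)) (sym b≡c[2n]) (sym (ι-^ (suc i) 2))))
                              (trans (r₋ c n) (cong₂ (λ b x → b * (x - 1ℚ)) (sym b≡c[2n]) (sym (ι-^ (suc i) 2))))))))
      (vanishes-on-cone πΓ-forms G G∘π≡0 (- c) (n ∷ - 1ℚ ∷ []))
  where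
  point-≡ : ∀ {p q r p′ q′ r′ : ℚ} → p ≡ p′ → q ≡ q′ → r ≡ r′ → _≡_ {A = Vec ℚ 3} (p ∷ q ∷ r ∷ []) (p′ ∷ q′ ∷ r′ ∷ [])
  point-≡ refl refl refl = refl
  2n≢0 : ∀ n → n ≢ 0ℚ → (1ℚ + 1ℚ) * n ≢ 0ℚ
  2n≢0 n = *-nonzero {1ℚ + 1ℚ} {n} (λ ())
  p₊ : ∀ c n → c * 1ℚ * ((n * n + 1ℚ * 1ℚ) * (n * n - 1ℚ * 1ℚ)) ≡ c * ((n * n + 1ℚ) * (n * n - 1ℚ))
  p₊ = solve-∀ ℚ-ring
  q₊ : ∀ c n → c * 1ℚ * ((1ℚ + 1ℚ) * n * 1ℚ * (n * n + 1ℚ * 1ℚ)) ≡ c * ((1ℚ + 1ℚ) * n) * (n * (n * 1ℚ) + 1ℚ)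
  q₊ = solve-∀ ℚ-ring
  r₊ : ∀ c n → c * 1ℚ * ((1ℚ + 1ℚ) * n * 1ℚ * (n * n - 1ℚ * 1ℚ)) ≡ c * ((1ℚ + 1ℚ) * n) * (n * (n * 1ℚ) - 1ℚ)
  r₊ = solve-∀ ℚ-ring
  p₋ : ∀ c n → - c * 1ℚ * ((n * n + - 1ℚ * - 1ℚ) * (n * n - - 1ℚ * - 1ℚ)) ≡ - (c * ((n * n + 1ℚ) * (n * n - 1ℚ)))
  p₋ = solve-∀ ℚ-ring
  q₋ : ∀ c n → - c * 1ℚ * ((1ℚ + 1ℚ) * n * - 1ℚ * (n * n + - 1ℚ * - 1ℚ)) ≡ c * ((1ℚ + 1ℚ) * n) * (n * (n * 1ℚ) + 1ℚ)
  q₋ = solve-∀ ℚ-ring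
  r₋ : ∀ c n → - c * 1ℚ * ((1ℚ + 1ℚ) * n * - 1ℚ * (n * n - - 1ℚ * - 1ℚ)) ≡ c * ((1ℚ + 1ℚ) * n) * (n * (n * 1ℚ) - 1ℚ)
  r₋ = solve-∀ ℚ-ring

-- A polynomial in the kernel of the parametrization is a multiple of E.
Γ-kernel : ∀ G → (∀ x → ev G (evs πΓ x) ≡ 0ℚ) → ∃[ h ] ∀ p q r → let v = p ∷ q ∷ r ∷ [] in ev G v ≡ ev h v * E p q r
Γ-kernel G G∘π≡0 = cancels-leading exponent G Q λ p q r → let v = p ∷ q ∷ r ∷ [] ; u = q ∷ r ∷ [] in begin
    (q * q - r * r) ^ exponent * ev G v
      ≡⟨ cong (λ l → l ^ exponent * ev G v) (ev-toPoly L u) ⟨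
    ev (toPoly L) u ^ exponent * ev G v
      ≡⟨ division p u ⟩
    ev A u + ev B u * p + ev Q v * (ev (toPoly L) u * (p * p) - ev (toPoly N) u)
      ≡⟨ cong₂ (λ a b → a + b * p + ev Q v * (ev (toPoly L) u * (p * p) - ev (toPoly N) u)) (≈0⇒ev A A≈0 u) (≈0⇒ev B B≈0 u) ⟩
    0ℚ + 0ℚ * p + ev Q v * (ev (toPoly L) u * (p * p) - ev (toPoly N) u)
      ≡⟨ cong (λ e → 0ℚ + 0ℚ * p + ev Q v * e) (T≡E p q r) ⟩
    0ℚ + 0ℚ * p + ev Q v * E p q r
      ≡⟨ lemma₀ p (ev Q v * E p q r) ⟩
    ev Q v * E p q r ∎
  where
  open ≡-Reasoning
  q r : Expr 2
  q = :var zero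
  r = :var (suc zero)
  L N : Expr 2
  L = q :* q :- r :* r
  N = q :* q :* (r :* r)
  open Division (divide (toPoly L) (toPoly N) G)
  lemma₀ : ∀ p a → 0ℚ + 0ℚ * p + a ≡ a
  lemma₀ = solve-∀ ℚ-ring
  T≡E : ∀ p q r → let u = q ∷ r ∷ [] in ev (toPoly L) u * (p * p) - ev (toPoly N) u ≡ E p q r
  T≡E p q r = trans (cong₂ (λ l n → l * (p * p) - n) (ev-toPoly L (q ∷ r ∷ [])) (ev-toPoly N (q ∷ r ∷ []))) (lemma p q r)
    where
    lemma : ∀ p q r → (q * q - r * r) * (p * p) - q * q * (r * r) ≡ p * p * (q * q) - (p * p + q * q) * (r * r)
    lemma = solve-∀ ℚ-ring
  linear : ∀ p q r → ev G (p ∷ q ∷ r ∷ []) ≡ 0ℚ → ev equationΓ (p ∷ q ∷ r ∷ []) ≡ 0ℚ → ev A (q ∷ r ∷ []) + ev B (q ∷ r ∷ []) * p ≡ 0ℚ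
  linear p q r G≡0 E≡0 = let v = p ∷ q ∷ r ∷ [] ; u = q ∷ r ∷ [] in begin
    ev A u + ev B u * p                      ≡⟨ lemma (ev A u + ev B u * p) (ev Q v) ⟩
    ev A u + ev B u * p + ev Q v * 0ℚ        ≡⟨ cong (λ e → ev A u + ev B u * p + ev Q v * e) (trans (T≡E p q r) (trans (sym (ev-equationΓ p q r)) E≡0)) ⟨
    ev A u + ev B u * p + ev Q v * (ev (toPoly L) u * (p * p) - ev (toPoly N) u)
                                             ≡⟨ division p u ⟨
    ev (toPoly L) u ^ exponent * ev G v      ≡⟨ cong (ev (toPoly L) u ^ exponent *_) G≡0 ⟩
    ev (toPoly L) u ^ exponent * 0ℚ          ≡⟨ ℚ.*-zeroʳ (ev (toPoly L) u ^ exponent) ⟩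
    0ℚ                                       ∎
    where
    lemma : ∀ a q → a ≡ a + q * 0ℚ
    lemma = solve-∀ ℚ-ring
  double : ∀ {a} → a + a ≡ 0ℚ → a ≡ 0ℚ
  double {a} eq = [ (λ ()) , id ]′ (ℚ-integral (1ℚ + 1ℚ) a (trans (lemma a) eq))
    where
    lemma : ∀ a → (1ℚ + 1ℚ) * a ≡ a + a
    lemma = solve-∀ ℚ-ring
  A≈0 : A ≈ 0ₚ
  A≈0 = dense-squares A λ i b → let x = point (powers 2) i ; q = b * (x + 1ℚ) ; r = b * (x - 1ℚ) ; u = q ∷ r ∷ []
                                    p , vanish = cone-points i b
                                    G≡0 , G≡0′ = vanish G G∘π≡0
                                    E≡0 , E≡0′ = vanish equationΓ equationΓ∘πΓ in
    double (begin
      ev A u + ev A u                                          ≡⟨ lemma (ev A u) (ev B u) p ⟩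
      (ev A u + ev B u * p) + (ev A u + ev B u * - p)          ≡⟨ cong₂ _+_ (linear p q r G≡0 E≡0) (linear (- p) q r G≡0′ E≡0′) ⟩
      0ℚ + 0ℚ                                                  ≡⟨⟩
      0ℚ                                                       ∎)
    where
    lemma : ∀ a b p → a + a ≡ (a + b * p) + (a + b * - p)
    lemma = solve-∀ ℚ-ring
  -- B·p = 0, and (B·q·r)² = (q²-r²)·(B·p)² on the curve.
  Bqr : Expr 2
  Bqr = :poly B :* (q :* r)
  Bqr≈0 : toPoly Bqr ≈ 0ₚ
  Bqr≈0 = dense-squares (toPoly Bqr) λ i b → let x = point (powers 2) i ; q = b * (x + 1ℚ) ; r = b * (x - 1ℚ) ; u = q ∷ r ∷ []
                                                 p , vanish = cone-points i b
                                                 Bp≡0 = begin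
                                                   ev B u * p              ≡⟨ ℚ.+-identityˡ (ev B u * p) ⟨
                                                   0ℚ + ev B u * p         ≡⟨ cong (_+ ev B u * p) (≈0⇒ev A A≈0 u) ⟨
                                                   ev A u + ev B u * p     ≡⟨ linear p q r (proj₁ (vanish G G∘π≡0)) (proj₁ (vanish equationΓ equationΓ∘πΓ)) ⟩
                                                   0ℚ                      ∎
    in trans (ev-toPoly Bqr u) ([ id , id ]′ (ℚ-integral (ev B u * (q * r)) (ev B u * (q * r)) (begin
      ev B u * (q * r) * (ev B u * (q * r))
        ≡⟨ lemma (ev B u) p q r ⟩
      (q * q - r * r) * (ev B u * p * (ev B u * p)) - ev B u * ev B u * E p q r
        ≡⟨ cong₂ (λ β e → (q * q - r * r) * (β * β) - ev B u * ev B u * e) Bp≡0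
             (trans (sym (ev-equationΓ p q r)) (proj₁ (vanish equationΓ equationΓ∘πΓ))) ⟩
      (q * q - r * r) * (0ℚ * 0ℚ) - ev B u * ev B u * 0ℚ
        ≡⟨ lemma′ (q * q - r * r) (ev B u * ev B u) ⟩
      0ℚ ∎)))
    where
    lemma : ∀ β p q r → β * (q * r) * (β * (q * r)) ≡
            (q * q - r * r) * (β * p * (β * p)) - β * β * (p * p * (q * q) - (p * p + q * q) * (r * r))
    lemma = solve-∀ ℚ-ring
    lemma′ : ∀ a b → a * (0ℚ * 0ℚ) - b * 0ℚ ≡ 0ℚ
    lemma′ = solve-∀ ℚ-ring
  B≈0 : B ≈ 0ₚ
  B≈0 = [ id , (λ qr≈0 → contradiction qr≈0 (≉0 (toPoly (q :* r)) (1ℚ ∷ 1ℚ ∷ []) λ ())) ]′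
    (*-integral B (toPoly (q :* r)) λ u → trans (sym (ev-* B (toPoly (q :* r)) u)) (≈0⇒ev (toPoly Bqr) Bqr≈0 u))

∈Γ⁻ : ∀ {G} → G ∈ ideal Γ → ∀ x → ev G (evs πΓ x) ≡ 0ℚ
∈Γ⁻ {G} G∈ x = let c , eq = ∈principal⁻ equationΓ G G∈ in
  trans (eq (evs πΓ x)) (trans (cong (ev c (evs πΓ x) *_) (equationΓ∘πΓ x)) (ℚ.*-zeroʳ (ev c (evs πΓ x))))

∈Γ⁺ : ∀ {G} → (∀ x → ev G (evs πΓ x) ≡ 0ℚ) → G ∈ ideal Γ
∈Γ⁺ {G} G∘π≡0 = let h , eq = Γ-kernel G G∘π≡0 in
  ∈principal⁺ equationΓ G h λ { v@(p ∷ q ∷ r ∷ []) → trans (eq p q r) (cong (ev h v *_) (sym (ev-equationΓ p q r))) }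

-- The curve C and its parametrization

-- The parametrization of Γ, completed by m = p² + q² = a⁴.
C-expressions : Vec (Expr 2) 4
C-expressions = â :* b̂ ∷ ĉ :* â ∷ ĉ :* b̂ ∷ â :* â :* (â :* â) ∷ []

πC : Vec (Poly 2) 4
πC = Vec.map toPoly C-expressions

πC-forms : AreForms w₁₁ 4 w₁₁₁₂ πC
πC-forms = from-yes (areForms? w₁₁ 4 w₁₁₁₂ πC)

ev-equationC : ∀ p q r m → ev equationC (p ∷ q ∷ r ∷ m ∷ []) ≡ m - (p * p + q * q)
ev-equationC p q r m = trans (ev-toPoly (:var (suc (suc (suc zero))) :- (:var zero :^ 2 :+ :var (suc zero) :^ 2)) (p ∷ q ∷ r ∷ m ∷ []))
  (lemma p q m)
  where
  lemma : ∀ p q m → m - (p * (p * 1ℚ) + q * (q * 1ℚ)) ≡ m - (p * p + q * q)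
  lemma = solve-∀ ℚ-ring

-- Modulo m - (p² + q²), the equation of X′ is twice that of Γ.
ev-equationX′-C : ∀ p q r m → ev equationX′ (p ∷ q ∷ r ∷ m ∷ []) ≡
                  2ℚ * E p q r + ev equationC (p ∷ q ∷ r ∷ m ∷ []) * (m + (p * p + q * q) - 2ℚ * (r * r))
ev-equationX′-C p q r m = trans (ev-equationX′ p q r m) (trans (lemma p q r m)
  (cong (λ c → 2ℚ * E p q r + c * (m + (p * p + q * q) - 2ℚ * (r * r))) (sym (ev-equationC p q r m))))
  where
  lemma : ∀ p q r m → m * (m * 1ℚ) - p * (p * (p * (p * 1ℚ))) - q * (q * (q * (q * 1ℚ))) - (1ℚ + 1ℚ) * m * (r * (r * 1ℚ)) ≡
          (1ℚ + 1ℚ) * (p * p * (q * q) - (p * p + q * q) * (r * r)) +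
          (m - (p * p + q * q)) * (m + (p * p + q * q) - (1ℚ + 1ℚ) * (r * r))
  lemma = solve-∀ ℚ-ring

equationC∘πC : ∀ x → ev equationC (evs πC x) ≡ 0ℚ
equationC∘πC x = trans (cong (ev equationC) (evs-toPoly C-expressions x))
  (trans (ev-equationC (a * b) (c * a) (c * b) (a * a * (a * a))) (trans (lemma a b c)
    (trans (cong (a * a *_) (≡⇒-≡0 (conic x))) (ℚ.*-zeroʳ (a * a)))))
  where
  a = value â x
  b = value b̂ x
  c = value ĉ x
  lemma : ∀ a b c → a * a * (a * a) - (a * b * (a * b) + c * a * (c * a)) ≡ a * a * (a * a - (b * b + c * c))
  lemma = solve-∀ ℚ-ring

equationX′∘πC : ∀ x → ev equationX′ (evs πC x) ≡ 0ℚ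
equationX′∘πC x = trans (cong (ev equationX′) (evs-toPoly C-expressions x))
  (trans (ev-equationX′-C p q r m) (trans
    (cong₂ (λ e c → 2ℚ * e + c * (m + (p * p + q * q) - 2ℚ * (r * r)))
      (trans (sym (ev-equationΓ p q r)) (trans (cong (ev equationΓ) (sym (evs-toPoly Γ-expressions x))) (equationΓ∘πΓ x)))
      (trans (cong (ev equationC) (sym (evs-toPoly C-expressions x))) (equationC∘πC x)))
    (lemma 2ℚ (m + (p * p + q * q) - 2ℚ * (r * r)))))
  where
  p = value (â :* b̂) x
  q = value (ĉ :* â) x
  r = value (ĉ :* b̂) x
  m = value (â :* â :* (â :* â)) x
  lemma : ∀ a b → a * 0ℚ + 0ℚ * b ≡ 0ℚ
  lemma = solve-∀ ℚ-ring

ev-combination : ∀ (a b s t : Poly n) x → ev (combination (a ∷ b ∷ []) (s ∷ t ∷ [])) x ≡ ev a x * ev s x + ev b x * ev t x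
ev-combination a b s t x = trans (ev-toPoly (:poly a :* :poly s :+ (:poly b :* :poly t :+ :poly 0ₚ)) x)
  (cong (ev a x * ev s x +_) (ℚ.+-identityʳ (ev b x * ev t x)))

∈C⁻ : ∀ {G} → G ∈ ideal C → ∀ x → ev G (evs πC x) ≡ 0ℚ
∈C⁻ {G} (a ∷ b ∷ [] , G≈) x = let y = evs πC x in begin
  ev G y                                                        ≡⟨ ≈⇒ev G (combination (a ∷ b ∷ []) (equationX′ ∷ equationC ∷ [])) G≈ y ⟩
  ev (combination (a ∷ b ∷ []) (equationX′ ∷ equationC ∷ [])) y ≡⟨ ev-combination a b equationX′ equationC y ⟩
  ev a y * ev equationX′ y + ev b y * ev equationC y            ≡⟨ cong₂ (λ s t → ev a y * s + ev b y * t) (equationX′∘πC x) (equationC∘πC x) ⟩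
  ev a y * 0ℚ + ev b y * 0ℚ                                     ≡⟨ cong₂ _+_ (ℚ.*-zeroʳ (ev a y)) (ℚ.*-zeroʳ (ev b y)) ⟩
  0ℚ                                                            ∎
  where open ≡-Reasoning

-- The inverse (p,q,r) ↦ (p,q,r,p²+q²) of eliminate-m.
restore-m-expressions : Vec (Expr 3) 4
restore-m-expressions = p ∷ q ∷ r ∷ p :^ 2 :+ q :^ 2 ∷ []
  where
  p = :var zero
  q = :var (suc zero)
  r = :var (suc (suc zero))

restore-m : Vec (Poly 3) 4
restore-m = Vec.map toPoly restore-m-expressions

evs-restore-m : ∀ p q r → evs restore-m (p ∷ q ∷ r ∷ []) ≡ p ∷ q ∷ r ∷ p * p + q * q ∷ []
evs-restore-m p q r = trans (evs-toPoly restore-m-expressions (p ∷ q ∷ r ∷ []))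
  (cong (λ m → p ∷ q ∷ r ∷ m ∷ []) (lemma p q))
  where
  lemma : ∀ p q → p * (p * 1ℚ) + q * (q * 1ℚ) ≡ p * p + q * q
  lemma = solve-∀ ℚ-ring

evs-eliminate-m : ∀ p q r m → evs eliminate-m (p ∷ q ∷ r ∷ m ∷ []) ≡ p ∷ q ∷ r ∷ []
evs-eliminate-m p q r m = evs-toPoly (:var zero ∷ :var (suc zero) ∷ :var (suc (suc zero)) ∷ []) (p ∷ q ∷ r ∷ m ∷ [])

restore-m∘πΓ : ∀ x → evs restore-m (evs πΓ x) ≡ evs πC x
restore-m∘πΓ x = trans (cong (evs restore-m) (evs-toPoly Γ-expressions x)) (trans (evs-restore-m (a * b) (c * a) (c * b))
  (trans (cong (λ m → a * b ∷ c * a ∷ c * b ∷ m ∷ []) (trans (lemma a b c) (cong (a * a *_) (sym (conic x)))))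
         (sym (evs-toPoly C-expressions x))))
  where
  a = value â x
  b = value b̂ x
  c = value ĉ x
  lemma : ∀ a b c → a * b * (a * b) + c * a * (c * a) ≡ a * a * (b * b + c * c)
  lemma = solve-∀ ℚ-ring

eliminate-m∘πC : ∀ x → evs eliminate-m (evs πC x) ≡ evs πΓ x
eliminate-m∘πC x = trans (cong (evs eliminate-m) (evs-toPoly C-expressions x))
  (trans (evs-eliminate-m (value (â :* b̂) x) (value (ĉ :* â) x) (value (ĉ :* b̂) x) (value (â :* â :* (â :* â)) x)) (sym (evs-toPoly Γ-expressions x)))

-- For G in the kernel, G(p,q,r,p²+q²) is a multiple c·E by the corresponding
-- result for Γ, and G differs from it by a multiple of m - (p² + q²); E itself
-- is half the equation of X′ up to such a multiple.
∈C⁺ : ∀ {G} → (∀ x → ev G (evs πC x) ≡ 0ℚ) → G ∈ ideal C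
∈C⁺ {G} G∘π≡0 = toPoly a ∷ toPoly b ∷ [] ,
  ev⇒≈ G (combination (toPoly a ∷ toPoly b ∷ []) (equationX′ ∷ equationC ∷ [])) λ { v@(p ∷ q ∷ r ∷ m ∷ []) →
    let c = ev (substₚ c₃ eliminate-m) v ; g = m + (p * p + q * q) - 2ℚ * (r * r) ; κ = ev equationC v in sym (begin
    ev (combination (toPoly a ∷ toPoly b ∷ []) (equationX′ ∷ equationC ∷ [])) v
      ≡⟨ ev-combination (toPoly a) (toPoly b) equationX′ equationC v ⟩
    ev (toPoly a) v * ev equationX′ v + ev (toPoly b) v * κ
      ≡⟨ cong₂ _+_ (cong₂ _*_ (ev-toPoly a v) (ev-equationX′-C p q r m)) (cong (_* κ) (ev-toPoly b v)) ⟩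
    ½ * c * (2ℚ * E p q r + κ * g) + (ev h v - ½ * c * g) * κ
      ≡⟨ lemma₁ ½ c 2ℚ (E p q r) κ g (ev h v) ⟩
    (½ * 2ℚ) * (c * E p q r) + ev h v * κ
      ≡⟨ cong (_+ ev h v * κ) (ℚ.*-identityˡ (c * E p q r)) ⟩
    c * E p q r + ev h v * κ
      ≡⟨ cong₂ _+_ (trans (cong (_* E p q r) (trans (ev-subst c₃ eliminate-m v) (cong (ev c₃) (evs-eliminate-m p q r m))))
                          (sym (G₃≡ p q r))) (sym (G-G₃ v)) ⟩
    ev G₃ (p ∷ q ∷ r ∷ []) + (ev G v - ev G (evs ρ v))
      ≡⟨ cong (λ y → y + (ev G v - ev G (evs ρ v))) (trans (ev-subst G restore-m (p ∷ q ∷ r ∷ [])) (cong (ev G) (trans (evs-restore-m p q r) (sym (evs-ρ p q r m))))) ⟩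
    ev G (evs ρ v) + (ev G v - ev G (evs ρ v))
      ≡⟨ lemma₂ (ev G v) (ev G (evs ρ v)) ⟩
    ev G v ∎) }
  where
  open ≡-Reasoning
  p q r m : Expr 4
  p = :var zero
  q = :var (suc zero)
  r = :var (suc (suc zero))
  m = :var (suc (suc (suc zero)))
  G₃ : Poly 3
  G₃ = substₚ G restore-m
  kernel : ∃[ c ] ∀ p q r → let v = p ∷ q ∷ r ∷ [] in ev G₃ v ≡ ev c v * E p q r
  kernel = Γ-kernel G₃ λ x → trans (ev-subst G restore-m (evs πΓ x)) (trans (cong (ev G) (restore-m∘πΓ x)) (G∘π≡0 x))
  c₃ : Poly 3
  c₃ = proj₁ kernel
  G₃≡ : ∀ p q r → let v = p ∷ q ∷ r ∷ [] in ev G₃ v ≡ ev c₃ v * E p q r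
  G₃≡ = proj₂ kernel
  ρ-expressions : Vec (Expr 4) 4
  ρ-expressions = p ∷ q ∷ r ∷ p :* p :+ q :* q ∷ []
  ρ : Vec (Poly 4) 4
  ρ = Vec.map toPoly ρ-expressions
  evs-ρ : ∀ p q r m → evs ρ (p ∷ q ∷ r ∷ m ∷ []) ≡ p ∷ q ∷ r ∷ p * p + q * q ∷ []
  evs-ρ p q r m = evs-toPoly ρ-expressions (p ∷ q ∷ r ∷ m ∷ [])
  unchanged : ∀ a κ → a - a ≡ 0ℚ * κ
  unchanged = solve-∀ ℚ-ring
  difference : ∀ i → ∃[ h ] ∀ x → lookup x i - lookup (evs ρ x) i ≡ ev h x * ev equationC x
  difference zero = 0ₚ , λ { x@(p ∷ q ∷ r ∷ m ∷ []) → trans (cong (λ y → p - lookup y zero) (evs-ρ p q r m)) (unchanged p (ev equationC x)) }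
  difference (suc zero) = 0ₚ , λ { x@(p ∷ q ∷ r ∷ m ∷ []) → trans (cong (λ y → q - lookup y (suc zero)) (evs-ρ p q r m)) (unchanged q (ev equationC x)) }
  difference (suc (suc zero)) = 0ₚ , λ { x@(p ∷ q ∷ r ∷ m ∷ []) → trans (cong (λ y → r - lookup y (suc (suc zero))) (evs-ρ p q r m)) (unchanged r (ev equationC x)) }
  difference (suc (suc (suc zero))) = 1ₚ , λ { x@(p ∷ q ∷ r ∷ m ∷ []) → trans (cong (λ y → m - lookup y (suc (suc (suc zero)))) (evs-ρ p q r m))
    (sym (trans (cong₂ _*_ (ev-const 1ℚ x) (ev-equationC p q r m)) (ℚ.*-identityˡ (m - (p * p + q * q))))) }
  h : Poly 4
  h = proj₁ (multiple-of-difference equationC ρ difference G)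
  G-G₃ : ∀ x → ev G x - ev G (evs ρ x) ≡ ev h x * ev equationC x
  G-G₃ = proj₂ (multiple-of-difference equationC ρ difference G)
  a b : Expr 4
  a = :con ½ :* :poly (substₚ c₃ eliminate-m)
  b = :poly h :- :con ½ :* :poly (substₚ c₃ eliminate-m) :* (m :+ (p :* p :+ q :* q) :- :con 2ℚ :* (r :* r))
  lemma₁ : ∀ h c d e κ g η → h * c * (d * e + κ * g) + (η - h * c * g) * κ ≡ (h * d) * (c * e) + η * κ
  lemma₁ = solve-∀ ℚ-ring
  lemma₂ : ∀ a b → b + (a - b) ≡ a
  lemma₂ = solve-∀ ℚ-ring

-- The image of C in X

f-expressions : Vec (Expr 4) 4
f-expressions = r ∷ p ∷ q ∷ r :^ 2 :- m ∷ []
  where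
  p = :var zero
  q = :var (suc zero)
  r = :var (suc (suc zero))
  m = :var (suc (suc (suc zero)))

evs-f : ∀ p q r m → evs f (p ∷ q ∷ r ∷ m ∷ []) ≡ r ∷ p ∷ q ∷ r ^ 2 - m ∷ []
evs-f p q r m = evs-toPoly f-expressions (p ∷ q ∷ r ∷ m ∷ [])

evs-∘ₘ : ∀ {k l} (g : Vec (Poly k) l) (f : Vec (Poly n) k) x → evs (g ∘ₘ f) x ≡ evs g (evs f x)
evs-∘ₘ g f x = trans (sym (Vec.map-∘ (λ p → ev p x) (λ p → substₚ p f) g)) (Vec.map-cong (λ p → ev-subst p f x) g)

-- The closure of the image of C, parametrized by f ∘ πC.
f[C] : Closed w₁₁₁₂
f[C] = image f w₁₁₁₂ C

πf[C] : Vec (Poly 2) 4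
πf[C] = f ∘ₘ πC

∈f[C]⁻ : ∀ {G} → G ∈ ideal f[C] → ∀ x → ev G (evs πf[C] x) ≡ 0ℚ
∈f[C]⁻ {G} G∈ x = trans (cong (ev G) (evs-∘ₘ f πC x)) (trans (sym (ev-subst G f (evs πC x))) (∈C⁻ {substₚ G f} G∈ x))

∈f[C]⁺ : ∀ {G} → (∀ x → ev G (evs πf[C] x) ≡ 0ℚ) → G ∈ ideal f[C]
∈f[C]⁺ {G} eq = ∈C⁺ {substₚ G f} λ x → trans (ev-subst G f (evs πC x)) (trans (cong (ev G) (sym (evs-∘ₘ f πC x))) (eq x))

-- C and its image are rational curves

w₁₁₁₂>0 : All NonZero w₁₁₁₂
w₁₁₁₂>0 = _ ∷ _ ∷ _ ∷ _ ∷ []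

-- The map (p : q : r : m) ↦ (p(q+r) : qr) inverts πC up to the factor
-- 4s²t(s⁴-t⁴), since q + r = 4s³t.
C→ℙ¹-expressions : Vec (Expr 4) 2
C→ℙ¹-expressions = p :* (q :+ r) ∷ q :* r ∷ []
  where
  p = :var zero
  q = :var (suc zero)
  r = :var (suc (suc zero))

C→ℙ¹ : Vec (Poly 4) 2
C→ℙ¹ = Vec.map toPoly C→ℙ¹-expressions

-- The form 4s²t(s⁴-t⁴) of degree 7.
factor : Expr 2
factor = (:con 1ℚ :+ :con 1ℚ) :* :var zero :* ĉ :* (â :* b̂)

factor-form : IsForm w₁₁ 7 (toPoly factor)
factor-form = isForm-* {d = 3} (from-yes (isForm? w₁₁ 3 (toPoly ((:con 1ℚ :+ :con 1ℚ) :* :var zero :* ĉ)))) (from-yes (isForm? w₁₁ 4 (toPoly (â :* b̂))))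

factor≢0 : ev (toPoly factor) (2ℚ ∷ 1ℚ ∷ []) ≢ 0ℚ
factor≢0 eq = contradiction (trans (sym (ev-toPoly factor (2ℚ ∷ 1ℚ ∷ []))) eq) λ ()

C→ℙ¹∘πC : ∀ x → evs C→ℙ¹ (evs πC x) ≡ scale w₁₁ (ev (toPoly factor) x) x
C→ℙ¹∘πC x@(s ∷ t ∷ []) = begin
  evs C→ℙ¹ (evs πC x)
    ≡⟨ trans (cong (evs C→ℙ¹) (evs-toPoly C-expressions x)) (evs-toPoly C→ℙ¹-expressions (Vec.map (λ e → value e x) C-expressions)) ⟩
  a * b * (c * a + c * b) ∷ c * a * (c * b) ∷ []
    ≡⟨ cong₂ (λ y z → y ∷ z ∷ []) (trans (lemma₁ a b c) (trans (cong (λ d → c * (a * b) * d) (lemma₂ s t)) (lemma₃ s c (a * b)))) (lemma₄ s t a b) ⟩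
  scale w₁₁ (value factor x) x
    ≡⟨ cong (λ h → scale w₁₁ h x) (ev-toPoly factor x) ⟨
  scale w₁₁ (ev (toPoly factor) x) x ∎
  where
  open ≡-Reasoning
  a = value â x
  b = value b̂ x
  c = value ĉ x
  lemma₁ : ∀ a b c → a * b * (c * a + c * b) ≡ c * (a * b) * (a + b)
  lemma₁ = solve-∀ ℚ-ring
  lemma₂ : ∀ s t → (s * s + t * t) + (s * s - t * t) ≡ (1ℚ + 1ℚ) * s * s
  lemma₂ = solve-∀ ℚ-ring
  lemma₃ : ∀ s c d → c * d * ((1ℚ + 1ℚ) * s * s) ≡ (1ℚ + 1ℚ) * s * c * d * 1ℚ * s
  lemma₃ = solve-∀ ℚ-ring
  lemma₄ : ∀ s t a b → (1ℚ + 1ℚ) * s * t * a * ((1ℚ + 1ℚ) * s * t * b) ≡ (1ℚ + 1ℚ) * s * ((1ℚ + 1ℚ) * s * t) * (a * b) * 1ℚ * t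
  lemma₄ = solve-∀ ℚ-ring

C→ℙ¹-forms : AreForms w₁₁₁₂ 2 w₁₁ C→ℙ¹
C→ℙ¹-forms = from-yes (areForms? w₁₁₁₂ 2 w₁₁ C→ℙ¹)

πC₀≉0 : lookup πC zero ≉ 0ₚ
πC₀≉0 = ≉0 (toPoly (â :* b̂)) (2ℚ ∷ 1ℚ ∷ []) λ eq → contradiction (trans (sym (ev-toPoly (â :* b̂) (2ℚ ∷ 1ℚ ∷ []))) eq) λ ()

module C-rational = RationalCurve C w₁₁₁₂>0 πC πC-forms (λ {G} → ∈C⁻ {G}) (λ {G} → ∈C⁺ {G})
  C→ℙ¹ C→ℙ¹-forms (toPoly factor) factor-form C→ℙ¹∘πC 2ℚ factor≢0 zero refl πC₀≉0

-- The same map in terms of (x,y,z) = (r,p,q).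
f[C]→ℙ¹-expressions : Vec (Expr 4) 2
f[C]→ℙ¹-expressions = y :* (z :+ x) ∷ z :* x ∷ []
  where
  x = :var zero
  y = :var (suc zero)
  z = :var (suc (suc zero))

f[C]→ℙ¹ : Vec (Poly 4) 2
f[C]→ℙ¹ = Vec.map toPoly f[C]→ℙ¹-expressions

f[C]→ℙ¹-forms : AreForms w₁₁₁₂ 2 w₁₁ f[C]→ℙ¹
f[C]→ℙ¹-forms = from-yes (areForms? w₁₁₁₂ 2 w₁₁ f[C]→ℙ¹)

f[C]→ℙ¹∘f : ∀ y → evs f[C]→ℙ¹ (evs f y) ≡ evs C→ℙ¹ y
f[C]→ℙ¹∘f y@(p ∷ q ∷ r ∷ m ∷ []) = trans (cong (evs f[C]→ℙ¹) (evs-f p q r m))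
  (trans (evs-toPoly f[C]→ℙ¹-expressions (r ∷ p ∷ q ∷ r ^ 2 - m ∷ [])) (sym (evs-toPoly C→ℙ¹-expressions y)))

f[C]→ℙ¹∘πf[C] : ∀ x → evs f[C]→ℙ¹ (evs πf[C] x) ≡ scale w₁₁ (ev (toPoly factor) x) x
f[C]→ℙ¹∘πf[C] x = trans (cong (evs f[C]→ℙ¹) (evs-∘ₘ f πC x)) (trans (f[C]→ℙ¹∘f (evs πC x)) (C→ℙ¹∘πC x))

f-forms : AreForms w₁₁₁₂ 1 w₁₁₁₂ f
f-forms = from-yes (areForms? w₁₁₁₂ 1 w₁₁₁₂ f)

πf[C]-forms : AreForms w₁₁ 4 w₁₁₁₂ πf[C]
πf[C]-forms = from-yes (areForms? w₁₁ 4 w₁₁₁₂ πf[C])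

πf[C]₀≉0 : lookup πf[C] zero ≉ 0ₚ
πf[C]₀≉0 = ≉0 (lookup πf[C] zero) (2ℚ ∷ 1ℚ ∷ []) λ eq → contradiction (trans (sym r≡) eq) λ ()
  where
  r≡ : ev (lookup πf[C] zero) (2ℚ ∷ 1ℚ ∷ []) ≡ value (ĉ :* b̂) (2ℚ ∷ 1ℚ ∷ [])
  r≡ = trans (ev-subst (lookup f zero) πC (2ℚ ∷ 1ℚ ∷ [])) (trans (ev-var (suc (suc zero)) (evs πC (2ℚ ∷ 1ℚ ∷ []))) (ev-toPoly (ĉ :* b̂) (2ℚ ∷ 1ℚ ∷ [])))

module f[C]-rational = RationalCurve f[C] w₁₁₁₂>0 πf[C] πf[C]-forms (λ {G} → ∈f[C]⁻ {G}) (λ {G} → ∈f[C]⁺ {G})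
  f[C]→ℙ¹ f[C]→ℙ¹-forms (toPoly factor) factor-form f[C]→ℙ¹∘πf[C] 2ℚ factor≢0 zero refl πf[C]₀≉0

-- Birational maps

module _ {w : Vec ℕ n} {V : Closed w} (isV : IsVariety V) where

  open IsVariety isV

  -- Maps whose coordinates agree modulo the ideal of V are equal on V.
  sameMap : ∀ {k} (v : Vec ℕ k) (f g : Vec (Poly n) k) → (∀ j → lookup f j -ₚ lookup g j ∈ ideal V) → SameMap V v f g
  sameMap v f g f-g∈V = 1ₚ , 1ₚ , (0 , isForm⇒homogeneous {w = w} (isForm-const w 1ℚ)) , (0 , isForm⇒homogeneous {w = w} (isForm-const w 1ℚ)) ,
    proper , proper , λ j → respects (ev⇒≈ (lookup f j -ₚ lookup g j) (1ₚ ^ₚ lookup v j *ₚ lookup f j -ₚ 1ₚ ^ₚ lookup v j *ₚ lookup g j) λ x →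
      trans (ev-minus (lookup f j) (lookup g j) x) (sym
        (trans (ev-toPoly (:poly 1ₚ :^ lookup v j :* :poly (lookup f j) :- :poly 1ₚ :^ lookup v j :* :poly (lookup g j)) x)
          (trans (cong (λ a → a * ev (lookup f j) x - a * ev (lookup g j) x) (trans (cong (_^ lookup v j) (ev-const 1ℚ x)) (^-one (lookup v j))))
            (cong₂ _-_ (ℚ.*-identityˡ (ev (lookup f j) x)) (ℚ.*-identityˡ (ev (lookup g j) x))))))) (f-g∈V j)

coordinate-difference : ∀ {k} (f g : Vec (Poly n) k) x → evs f x ≡ evs g x → ∀ j → ev (lookup f j -ₚ lookup g j) x ≡ 0ℚ
coordinate-difference f g x eq j = trans (ev-minus (lookup f j) (lookup g j) x)
  (≡⇒-≡0 (trans (sym (lookup-evs f x j)) (trans (cong (λ y → lookup y j) eq) (lookup-evs g x j))))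

inverse⇒sameMap : ∀ {k} {w : Vec ℕ n} {V : Closed w} → IsVariety V → (f : Vec (Poly n) k) (g : Vec (Poly k) n) →
                  (∀ x → evs g (evs f x) ≡ x) → SameMap V w (g ∘ₘ f) vars
inverse⇒sameMap {w = w} isV f g g∘f = sameMap isV w (g ∘ₘ f) vars λ j → IsVariety.respects isV
  (λ e → sym (ev⇒≈0 (lookup (g ∘ₘ f) j -ₚ lookup vars j) (λ x →
    coordinate-difference (g ∘ₘ f) vars x (trans (evs-∘ₘ g f x) (trans (g∘f x) (sym (evs-vars x)))) j) e))
  (IsVariety.0∈ isV)

-- The inverse (x,y,z,w) ↦ (y,z,x,x²-w) of f.
f⁻¹-expressions : Vec (Expr 4) 4
f⁻¹-expressions = y ∷ z ∷ x ∷ x :^ 2 :- w ∷ []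
  where
  x = :var zero
  y = :var (suc zero)
  z = :var (suc (suc zero))
  w = :var (suc (suc (suc zero)))

f⁻¹ : Vec (Poly 4) 4
f⁻¹ = Vec.map toPoly f⁻¹-expressions

evs-f⁻¹ : ∀ x y z w → evs f⁻¹ (x ∷ y ∷ z ∷ w ∷ []) ≡ y ∷ z ∷ x ∷ x ^ 2 - w ∷ []
evs-f⁻¹ x y z w = evs-toPoly f⁻¹-expressions (x ∷ y ∷ z ∷ w ∷ [])

private
  involution : ∀ r m → r * (r * 1ℚ) - (r * (r * 1ℚ) - m) ≡ m
  involution = solve-∀ ℚ-ring

f⁻¹∘f : ∀ x → evs f⁻¹ (evs f x) ≡ x
f⁻¹∘f (p ∷ q ∷ r ∷ m ∷ []) = trans (cong (evs f⁻¹) (evs-f p q r m)) (trans (evs-f⁻¹ r p q (r ^ 2 - m))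
  (cong (λ m → p ∷ q ∷ r ∷ m ∷ []) (involution r m)))

f∘f⁻¹ : ∀ x → evs f (evs f⁻¹ x) ≡ x
f∘f⁻¹ (x ∷ y ∷ z ∷ w ∷ []) = trans (cong (evs f) (evs-f⁻¹ x y z w)) (trans (evs-f y z x (x ^ 2 - w))
  (cong (λ w → x ∷ y ∷ z ∷ w ∷ []) (involution x w)))

equationX∘f : ∀ x → ev equationX (evs f x) ≡ - 1ℚ * ev equationX′ x
equationX∘f x@(p ∷ q ∷ r ∷ m ∷ []) = trans (cong (ev equationX) (evs-f p q r m)) (trans (ev-equationX r p q (r ^ 2 - m))
  (trans (lemma (p ^ 4) (q ^ 4) r m) (cong (- 1ℚ *_) (sym (ev-equationX′ p q r m)))))
  where
  lemma : ∀ p q r m → r * (r * (r * (r * 1ℚ))) + p + q - (r * (r * 1ℚ) - m) * ((r * (r * 1ℚ) - m) * 1ℚ) ≡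
          - 1ℚ * (m * (m * 1ℚ) - p - q - (1ℚ + 1ℚ) * m * (r * (r * 1ℚ)))
  lemma = solve-∀ ℚ-ring

equationX′∘f⁻¹ : ∀ x → ev equationX′ (evs f⁻¹ x) ≡ - 1ℚ * ev equationX x
equationX′∘f⁻¹ v@(x ∷ y ∷ z ∷ w ∷ []) = trans (cong (ev equationX′) (evs-f⁻¹ x y z w)) (trans (ev-equationX′ y z x (x ^ 2 - w))
  (trans (lemma x (y ^ 4) (z ^ 4) w) (cong (- 1ℚ *_) (sym (ev-equationX x y z w)))))
  where
  lemma : ∀ x y z w → (x * (x * 1ℚ) - w) * ((x * (x * 1ℚ) - w) * 1ℚ) - y - z - (1ℚ + 1ℚ) * (x * (x * 1ℚ) - w) * (x * (x * 1ℚ)) ≡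
          - 1ℚ * (x * (x * (x * (x * 1ℚ))) + y + z - w * (w * 1ℚ))
  lemma = solve-∀ ℚ-ring

f-isRationalMap : IsRationalMap X′ X f
f-isRationalMap = record
  { degree    = 1
  ; positive  = _
  ; isForm    = λ j → isForm⇒homogeneous {w = w₁₁₁₂} (AreForms.form f-forms j)
  ; isDefined = zero , ∉principal equationX′ (lookup f zero) (0ℚ ∷ 0ℚ ∷ 1ℚ ∷ 2ℚ ∷ []) refl λ ()
  ; intoW     = λ {G} → principal-preimage⁺ equationX′ equationX f f⁻¹ (- 1ℚ) (- 1ℚ) equationX∘f equationX′∘f⁻¹ f∘f⁻¹ {G}
  }

f⁻¹-isRationalMap : IsRationalMap X X′ f⁻¹
f⁻¹-isRationalMap = record
  { degree    = 1
  ; positive  = _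
  ; isForm    = λ j → isForm⇒homogeneous {w = w₁₁₁₂} (AreForms.form (from-yes (areForms? w₁₁₁₂ 1 w₁₁₁₂ f⁻¹)) j)
  ; isDefined = suc (suc zero) , ∉principal equationX (lookup f⁻¹ (suc (suc zero))) (1ℚ ∷ 0ℚ ∷ 0ℚ ∷ 1ℚ ∷ []) refl λ ()
  ; intoW     = λ {G} → principal-preimage⁺ equationX equationX′ f⁻¹ f (- 1ℚ) (- 1ℚ) equationX′∘f⁻¹ equationX∘f f⁻¹∘f {G}
  }

f-isBirational : IsBirational X′ X f
f-isBirational = X′-isVariety , X-isVariety , f-isRationalMap , f⁻¹ , f⁻¹-isRationalMap ,
  inverse⇒sameMap X′-isVariety f f⁻¹ f⁻¹∘f , inverse⇒sameMap X-isVariety f⁻¹ f f∘f⁻¹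

Γ-isVariety : IsVariety Γ
Γ-isVariety = isVariety-resp
  (λ {G} G∈ → ∈Γ⁺ {G} λ x → trans (sym (ev-subst G πΓ x)) (≈0⇒ev (substₚ G πΓ) (∈ℙ¹⁻ (substₚ G πΓ) G∈) x))
  (λ {G} G∈ → ∈ℙ¹⁺ (substₚ G πΓ) (ev⇒≈0 (substₚ G πΓ) λ x → trans (ev-subst G πΓ x) (∈Γ⁻ {G} G∈ x)))
  (image-isVariety πΓ ℙ¹-isVariety (_ ∷ _ ∷ _ ∷ []) πΓ-forms (zero , λ π∈ → πC₀≉0 (∈ℙ¹⁻ (lookup πΓ zero) π∈)))

eliminate-m-isRationalMap : IsRationalMap C Γ eliminate-m
eliminate-m-isRationalMap = record
  { degree    = 1
  ; positive  = _
  ; isForm    = λ j → isForm⇒homogeneous {w = w₁₁₁₂} (AreForms.form (from-yes (areForms? w₁₁₁₂ 1 w₁₁₁ eliminate-m)) j)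
  ; isDefined = zero , λ p∈C → πC₀≉0 (ev⇒≈0 (lookup πC zero) λ x → trans (sym (trans (ev-var zero (evs πC x)) (lookup-evs πC x zero))) (∈C⁻ {var zero} p∈C x))
  ; intoW     = λ {G} G∈Γ → ∈C⁺ {substₚ G eliminate-m} λ x → trans (ev-subst G eliminate-m (evs πC x))
                  (trans (cong (ev G) (eliminate-m∘πC x)) (∈Γ⁻ {G} G∈Γ x))
  }

restore-m-isRationalMap : IsRationalMap Γ C restore-m
restore-m-isRationalMap = record
  { degree    = 1
  ; positive  = _
  ; isForm    = λ j → isForm⇒homogeneous {w = w₁₁₁} (AreForms.form (from-yes (areForms? w₁₁₁ 1 w₁₁₁₂ restore-m)) j)
  ; isDefined = zero , λ p∈Γ → πC₀≉0 (ev⇒≈0 (lookup πΓ zero) λ x → trans (sym (trans (ev-var zero (evs πΓ x)) (lookup-evs πΓ x zero))) (∈Γ⁻ {var zero} p∈Γ x))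
  ; intoW     = λ {G} G∈C → ∈Γ⁺ {substₚ G restore-m} λ x → trans (ev-subst G restore-m (evs πΓ x))
                  (trans (cong (ev G) (restore-m∘πΓ x)) (∈C⁻ {G} G∈C x))
  }

eliminate-m-isBirational : IsBirational C Γ eliminate-m
eliminate-m-isBirational = C-rational.isVariety , Γ-isVariety , eliminate-m-isRationalMap , restore-m , restore-m-isRationalMap ,
  sameMap C-rational.isVariety w₁₁₁₂ (restore-m ∘ₘ eliminate-m) vars
    (λ j → ∈C⁺ {lookup (restore-m ∘ₘ eliminate-m) j -ₚ lookup vars j} λ x →
      coordinate-difference (restore-m ∘ₘ eliminate-m) vars (evs πC x)
        (trans (evs-∘ₘ restore-m eliminate-m (evs πC x)) (trans (cong (evs restore-m) (eliminate-m∘πC x))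
          (trans (restore-m∘πΓ x) (sym (evs-vars (evs πC x)))))) j) ,
  inverse⇒sameMap Γ-isVariety restore-m eliminate-m eliminate∘restore
  where
  eliminate∘restore : ∀ x → evs eliminate-m (evs restore-m x) ≡ x
  eliminate∘restore (p ∷ q ∷ r ∷ []) = trans (cong (evs eliminate-m) (evs-restore-m p q r)) (evs-eliminate-m p q r (p * p + q * q))

C⊑X′ : C ⊑ X′
C⊑X′ {G} G∈X′ = ∈C⁺ {G} λ x → let c , eq = ∈principal⁻ equationX′ G G∈X′ in
  trans (eq (evs πC x)) (trans (cong (ev c (evs πC x) *_) (equationX′∘πC x)) (ℚ.*-zeroʳ (ev c (evs πC x))))

f[C]⊑X : f[C] ⊑ X
f[C]⊑X {G} G∈X = C⊑X′ {substₚ G f} (IsRationalMap.intoW f-isRationalMap {G} G∈X)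

mainTheorem6 : IsBirational X′ X f ×
    (IsCurve C × C ⊑ X′) ×
    IsBirational C Γ eliminate-m ×
    BirationallyEquivalent C ℙ¹ ×
    ¬ Contracts f w₁₁₁₂ C ×
    (IsCurve (image f w₁₁₁₂ C) × image f w₁₁₁₂ C ⊑ X) ×
    BirationallyEquivalent (image f w₁₁₁₂ C) ℙ¹
mainTheorem6 =
  f-isBirational ,
  (C-rational.isCurve , λ {G} → C⊑X′ {G}) ,
  eliminate-m-isBirational ,
  C-rational.birational ,
  f[C]-rational.not-isPoint ,
  (f[C]-rational.isCurve , λ {G} → f[C]⊑X {G}) ,
  f[C]-rational.birational
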